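{- Let $G=G(M^*)$ be a $\emptyset$-definable group in a monster model $M^*\succ M$, equipped with a $\bigvee$-definable group topology $\mathcal T$ such that for all $n\in\mathbb N$ the projections (to all subproducts) of every type-definable, closed set in $G^n$ are closed. Assume that $\mathcal D_{\mathcal T}$ carries a normalized, $G$-invariant mean $m$. Then $\mathrm{cl}(G^{00}_M)=\mathrm{cl}(G^{000}_M)$. More precisely, there exists an $M$-type-definable set $\widehat D\subseteq G^{000}_M$ with $\mathrm{cl}(\widehat D)=\mathrm{cl}(G^{00}_M)$. In fact, for any closed, $M$-type-definable set $P$ which is wide (i.e. $m(P)>0$) we have $P^4:=PPP^{ -1}P^{ -1}\supseteq G^{00}_M$.
   Context: A monster model is a $\kappa$-saturated, strongly $\kappa$-homogeneous model for a sufficiently large cardinal $\kappa$; bounded/small means of cardinality $<\kappa$; $M$ is small. Type-definable sets are over small sets of parameters. $G^{00}_M$ is the smallest $M$-type-definable subgroup of $G$ of bounded index; $G^{000}_M$ is the smallest $\mathrm{Aut}(M^*/M)$-invariant subgroup of $G$ of bounded index. A $\bigvee$-definable family of definable subsets of $G$ is a class $\mathcal T=\{\varphi_i(x,\bar y_i): i\in I,\ \bar y_i \text{ from any model}\}$, where the $\varphi_i$ are formulas over $\emptyset$ implying $G(x)$; here $I$ is a directed set such that for $i<j$, for every $\bar y_i$ there is $\bar y_j$ such that $\varphi_j(x,\bar y_j)$ implies $\varphi_i(x,\bar y_i)$. For a model $N$, $\mathcal T(N):=\{\varphi_i(N,\bar y_i): i\in I,\ \bar y_i\in N\}$. A $\bigvee$-definable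 group topology on $G$ is such a family $\mathcal T$, consisting of sets containing $1$, such that in any model $N$, $\mathcal T(N)$ forms a basis of (not necessarily open) neighborhoods of the identity for a (not necessarily Hausdorff) topology on $G(N)$ making the group operations continuous. The topology on $G=G(M^*)$ is the one induced by $\mathcal T(M^*)$, $G^n$ has the product topology, and $\mathrm{cl}$ denotes the closure in the topology on $G$. $\mathcal D_{\mathcal T}$ is the lattice of closed subsets of $G$ that are type-definable in $M^*$ over arbitrary (small sets of) parameters; it is closed under left translations by $G$. A normalized $G$-invariant mean on it is a monotone function $m:\mathcal D_{\mathcal T}\to[0,1]$ with $m(\emptyset)=0$, $m(G)=1$, $m(Y\cup Z)=m(Y)+m(Z)-m(Y\cap Z)$, and $m(gY)=m(Y)$ for $g\in G$. -}

module Defs where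

open import Algebra.Bundles using (Group)
open import Algebra.Structures using (IsGroup)
open import Data.Bool.Base using (Bool)
open import Data.Empty.Polymorphic using (⊥)
open import Data.Fin.Base as Fin using (Fin; zero; suc)
open import Data.List.Base using (List)
open import Data.List.Relation.Unary.All using (All)
open import Data.Nat.Base using (ℕ; suc; _+_; _*_)
open import Data.Product.Base using (Σ; Σ-syntax; ∃; ∃-syntax; ∃₂; _×_; _,_; proj₁; proj₂)
open import Data.Rational.Base as ℚ using (ℚ; 0ℚ; 1ℚ)
import Data.Rational.Properties as ℚ
open import Data.Unit.Polymorphic using (⊤)
open import Data.Vec.Base using (Vec; []; _∷_; _++_; lookup; map; concat; tabulate)
open import Data.Vec.Functional.Relation.Binary.Equality.Setoid using (≋-setoid)
open import Function.Base using (_∘_)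
open import Function.Bundles using (Injection; _↔_; _⇔_; Inverse)
open import Function.Construct.Identity using (⇔-id)
open import Level using (Level; Lift; 0ℓ) renaming (suc to lsuc)
open import Relation.Binary.Bundles using (Setoid)
open import Relation.Binary.Core using (Rel)
open import Relation.Binary.Definitions using (_Respects_)
open import Relation.Binary.PropositionalEquality using (_≡_; refl; sym; trans; _→-setoid_)
open import Relation.Binary.PropositionalEquality.Properties using (setoid)
open import Relation.Binary.Structures using (IsPreorder)
open import Relation.Nullary using (¬_)
open import Relation.Unary using (Pred; _∈_; _∉_; _⊆_; _≐_; _≬_; _∩_; _∪_; ∁; ⋃; Empty; Universal)

-- Real numbers, as Dedekind cuts given by their lower halves.  Only the
-- lower half is recorded, which is adequate in the presence of excluded
-- middle.

record ℝ : Set₁ where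
  field
    lower    : Pred ℚ 0ℓ
    nonempty : ∃ λ q → q ∈ lower
    bounded  : ∃ λ q → q ∉ lower
    down     : ∀ {p q} → p ℚ.< q → q ∈ lower → p ∈ lower
    open′    : ∀ {p} → p ∈ lower → ∃ λ q → p ℚ.< q × q ∈ lower

open ℝ using (lower)

infix 4 _≤ᴿ_ _<ᴿ_ _≃ᴿ_
infixl 6 _+ᴿ_ _-ᴿ_

_≤ᴿ_ _<ᴿ_ _≃ᴿ_ : ℝ → ℝ → Set
x ≤ᴿ y = lower x ⊆ lower y
x <ᴿ y = ∃ λ q → q ∈ lower y × q ∉ lower x
x ≃ᴿ y = lower x ≐ lower y

private
  pred< : ∀ q → q ℚ.- 1ℚ ℚ.< q
  pred< q = ℚ.<-respʳ-≡ (ℚ.+-identityʳ q)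
              (ℚ.+-monoʳ-< q (ℚ.neg-antimono-< (ℚ.positive⁻¹ 1ℚ)))

  <⇒≱ : ∀ {p q} → p ℚ.< q → ¬ q ℚ.≤ p
  <⇒≱ p<q q≤p = ℚ.<-irrefl refl (ℚ.<-≤-trans p<q q≤p)

  ∈<∉ : (x : ℝ) → ∀ {p q} → p ∈ lower x → q ∉ lower x → p ℚ.≤ q
  ∈<∉ x p∈ q∉ = ℚ.≮⇒≥ λ q<p → q∉ (ℝ.down x q<p p∈)

fromℚ : ℚ → ℝ
fromℚ r = record
  { lower    = ℚ._< r
  ; nonempty = r ℚ.- 1ℚ , pred< r
  ; bounded  = r , ℚ.<-irrefl refl
  ; down     = ℚ.<-trans
  ; open′    = λ p<r → let q , p<q , q<r = ℚ.<-dense p<r in q , p<q , q<r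
  }

0ᴿ 1ᴿ : ℝ
0ᴿ = fromℚ 0ℚ
1ᴿ = fromℚ 1ℚ

_+ᴿ_ : ℝ → ℝ → ℝ
x +ᴿ y = record
  { lower    = λ q → ∃₂ λ a b → a ∈ lower x × b ∈ lower y × q ℚ.< a ℚ.+ b
  ; nonempty = let a , a∈ = ℝ.nonempty x ; b , b∈ = ℝ.nonempty y in
               a ℚ.+ b ℚ.- 1ℚ , a , b , a∈ , b∈ , pred< (a ℚ.+ b)
  ; bounded  = let u , u∉ = ℝ.bounded x ; v , v∉ = ℝ.bounded y in
               u ℚ.+ v , λ (a , b , a∈ , b∈ , u+v<a+b) →
                 <⇒≱ u+v<a+b (ℚ.+-mono-≤ (∈<∉ x a∈ u∉) (∈<∉ y b∈ v∉))
  ; down     = λ p<q (a , b , a∈ , b∈ , q<) → a , b , a∈ , b∈ , ℚ.<-trans p<q q<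
  ; open′    = λ (a , b , a∈ , b∈ , p<) → let q , p<q , q< = ℚ.<-dense p< in
               q , p<q , a , b , a∈ , b∈ , q<
  }

-- b ∉ lower y says y ≤ b.
_-ᴿ_ : ℝ → ℝ → ℝ
x -ᴿ y = record
  { lower    = λ q → ∃₂ λ a b → a ∈ lower x × b ∉ lower y × q ℚ.< a ℚ.- b
  ; nonempty = let a , a∈ = ℝ.nonempty x ; b , b∉ = ℝ.bounded y in
               a ℚ.- b ℚ.- 1ℚ , a , b , a∈ , b∉ , pred< (a ℚ.- b)
  ; bounded  = let u , u∉ = ℝ.bounded x ; v , v∈ = ℝ.nonempty y in
               u ℚ.- v , λ (a , b , a∈ , b∉ , u-v<a-b) →
                 <⇒≱ u-v<a-b (ℚ.+-mono-≤ (∈<∉ x a∈ u∉)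
                                            (ℚ.neg-antimono-≤ (∈<∉ y v∈ b∉)))
  ; down     = λ p<q (a , b , a∈ , b∉ , q<) → a , b , a∈ , b∉ , ℚ.<-trans p<q q<
  ; open′    = λ (a , b , a∈ , b∉ , p<) → let q , p<q , q< = ℚ.<-dense p< in
               q , p<q , a , b , a∈ , b∉ , q<
  }

-- Cardinalities.  A cardinal is represented by any type of that size;
-- setoids are used so that 2^X can be formed up to pointwise equality.

infix 4 _≺_

_≺_ : ∀ {a b c d} → Setoid a b → Setoid c d → Set _
S ≺ T = Injection S T × ¬ Injection T S

Small : ∀ {ℓ} → Set ℓ → Set ℓ → Set ℓ
Small κ A = setoid A ≺ setoid κ

-- First-order logic with equality (the classical connectives other than
-- ⊥, ⇒ and ∀ are the usual abbreviations).

record Language (ℓ : Level) : Set (lsuc ℓ) where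
  field
    FunSym : ℕ → Set ℓ
    RelSym : ℕ → Set ℓ

module _ {ℓ : Level} (L : Language ℓ) where
  open Language L

  data Term (n : ℕ) : Set ℓ where
    var : Fin n → Term n
    app : ∀ {k} → FunSym k → Vec (Term n) k → Term n

  infix  7 _≈′_
  infixr 6 _⇒′_

  -- Formulas with free variables among 0, …, n - 1; ∀′ binds variable 0.
  data Form (n : ℕ) : Set ℓ where
    ⊥′   : Form n
    _≈′_ : Term n → Term n → Form n
    rel′ : ∀ {k} → RelSym k → Vec (Term n) k → Form n
    _⇒′_ : Form n → Form n → Form n
    ∀′   : Form (suc n) → Form n

  record Structure : Set (lsuc ℓ) where
    field
      Carrier   : Set ℓ
      inhabitant : Carrier
      fun       : ∀ {k} → FunSym k → Vec Carrier k → Carrier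
      rel       : ∀ {k} → RelSym k → Pred (Vec Carrier k) ℓ

module _ {ℓ : Level} {L : Language ℓ} where
  open Language L

  ∣_∣ : Structure L → Set ℓ
  ∣ N ∣ = Structure.Carrier N

  module _ (N : Structure L) where
    open Structure N

    mutual
      eval : ∀ {n} → Vec Carrier n → Term L n → Carrier
      eval v (var i)    = lookup v i
      eval v (app f ts) = fun f (evals v ts)

      evals : ∀ {n k} → Vec Carrier n → Vec (Term L n) k → Vec Carrier k
      evals v []       = []
      evals v (t ∷ ts) = eval v t ∷ evals v ts

  infix 4 _⊨_[_]

  _⊨_[_] : (N : Structure L) → ∀ {n} → Form L n → Vec ∣ N ∣ n → Set ℓ
  N ⊨ ⊥′        [ v ] = ⊥
  N ⊨ s ≈′ t    [ v ] = eval N v s ≡ eval N v t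
  N ⊨ rel′ R ts [ v ] = Structure.rel N R (evals N v ts)
  N ⊨ φ ⇒′ ψ    [ v ] = N ⊨ φ [ v ] → N ⊨ ψ [ v ]
  N ⊨ ∀′ φ      [ v ] = ∀ x → N ⊨ φ [ x ∷ v ]

  -- N ≡ₑ N′ : N is a model of the complete theory of N′.
  _≡ₑ_ : Structure L → Structure L → Set ℓ
  N ≡ₑ N′ = ∀ (φ : Form L 0) → N ⊨ φ [ [] ] ⇔ N′ ⊨ φ [ [] ]

  -- Elementary embeddings, rather than literal substructures.
  record _≼_ (N N′ : Structure L) : Set ℓ where
    field
      to         : ∣ N ∣ → ∣ N′ ∣
      elementary : ∀ {n} (φ : Form L n) v → N ⊨ φ [ v ] ⇔ N′ ⊨ φ [ map to v ]

  record Aut (N : Structure L) : Set ℓ where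
    open Structure N
    field
      bij      : Carrier ↔ Carrier
    open Inverse bij public using (to)
    field
      pres-fun : ∀ {k} (f : FunSym k) v → to (fun f v) ≡ fun f (map to v)
      pres-rel : ∀ {k} (R : RelSym k) v → rel R v ⇔ rel R (map to v)

  FormOver : Set ℓ → ℕ → Set ℓ
  FormOver A n = ∃ λ k → Form L (n + k) × Vec A k

  module _ (N : Structure L) {A : Set ℓ} (p : A → ∣ N ∣) where

    Sat : ∀ {n} → Vec ∣ N ∣ n → FormOver A n → Set ℓ
    Sat x (_ , φ , a) = N ⊨ φ [ x ++ map p a ]

    Realises : ∀ {n} → Vec ∣ N ∣ n → Pred (FormOver A n) ℓ → Set ℓ
    Realises x Φ = ∀ θ → θ ∈ Φ → Sat x θ

    FinitelySatisfiable : ∀ {n} → Pred (FormOver A n) ℓ → Set ℓ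
    FinitelySatisfiable Φ = ∀ (θs : List _) → All Φ θs → ∃ λ x → All (Sat x) θs

    -- X is a set of points whose coordinates in N are given by c.
    TypeDefinableOver : ∀ {x} {Pt : Set x} {n} → (Pt → Vec ∣ N ∣ n) →
                        Pred Pt ℓ → Set _
    TypeDefinableOver c X =
      ∃ λ (Φ : Pred (FormOver A _) ℓ) → ∀ g → g ∈ X ⇔ Realises (c g) Φ

  TypeDefinable : Set ℓ → (N : Structure L) → ∀ {x} {Pt : Set x} {n} →
                  (Pt → Vec ∣ N ∣ n) → Pred Pt ℓ → Set _
  TypeDefinable κ N c X =
    Σ[ A ∈ Set ℓ ] Small κ A × (∃ λ (p : A → ∣ N ∣) → TypeDefinableOver N p c X)

  Saturated : Set ℓ → Structure L → Set (lsuc ℓ)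
  Saturated κ N = ∀ {A : Set ℓ} → Small κ A → (p : A → ∣ N ∣) →
    ∀ {n} (Φ : Pred (FormOver A n) ℓ) → FinitelySatisfiable N p Φ →
    ∃ λ x → Realises N p x Φ

  -- Elementary maps between subsets of size < κ extend to automorphisms.
  StronglyHomogeneous : Set ℓ → Structure L → Set (lsuc ℓ)
  StronglyHomogeneous κ N = ∀ {A : Set ℓ} → Small κ A → (a b : A → ∣ N ∣) →
    (∀ {k} (φ : Form L k) i → N ⊨ φ [ map a i ] ⇔ N ⊨ φ [ map b i ]) →
    Σ[ σ ∈ Aut N ] ∀ i → Aut.to σ (a i) ≡ b i

  -- κ > 2^(|L| + |M| + ℵ₀): the number of sentences with parameters in M is
  -- |L| + |M| + ℵ₀.
  SufficientlyLarge : Set ℓ → Structure L → Set ℓ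
  SufficientlyLarge κ M = (FormOver ∣ M ∣ 0 →-setoid Bool) ≺ setoid κ

  record IsMonster (κ : Set ℓ) (M M* : Structure L) : Set (lsuc ℓ) where
    field
      large       : SufficientlyLarge κ M
      saturated   : Saturated κ M*
      homogeneous : StronglyHomogeneous κ M*

-- Unions indexed by types in Set s suffice: a union of any collection of
-- open subsets can be reindexed by its points.
record Topology {s} (S : Setoid s s) : Set (lsuc (lsuc s)) where
  open Setoid S
  field
    Open      : Pred (Pred Carrier s) (lsuc s)
    open-ext  : ∀ {O O′} → O ≐ O′ → Open O → Open O′
    open-resp : ∀ {O} → Open O → O Respects _≈_
    open-U    : Open (λ _ → ⊤)
    open-∩    : ∀ {O O′} → Open O → Open O′ → Open (O ∩ O′)
    open-⋃    : ∀ {J : Set s} (O : J → Pred Carrier s) →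
                (∀ j → Open (O j)) → Open (⋃ J O)

  Closed : Pred (Pred Carrier s) (lsuc s)
  Closed Y = Open (∁ Y)

  Neighbourhood : Carrier → Pred (Pred Carrier s) (lsuc s)
  Neighbourhood x V = ∃ λ O → Open O × x ∈ O × O ⊆ V

  cl : Pred Carrier s → Pred Carrier (lsuc s)
  cl X x = ∀ O → Open O → x ∈ O → O ≬ X

  -- A (not necessarily open) basis of neighbourhoods of x.
  IsNeighbourhoodBasis : Carrier → ∀ {J : Set s} → (J → Pred Carrier s) → Set (lsuc s)
  IsNeighbourhoodBasis x B =
    (∀ j → Neighbourhood x (B j)) ×
    (∀ V → Neighbourhood x V → ∃ λ j → B j ⊆ V)

Continuous : ∀ {s} {S T : Setoid s s} → Topology S → Topology T →
             (Setoid.Carrier S → Setoid.Carrier T) → Set (lsuc s)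
Continuous τ τ′ f = ∀ O → Topology.Open τ′ O → Topology.Open τ (O ∘ f)

Power : ∀ {s} {S : Setoid s s} → Topology S → (n : ℕ) → Topology (≋-setoid S n)
Power {s} {S} τ n = record
  { Open      = λ O → ∀ x → x ∈ O → Σ[ V ∈ (Fin n → Pred Carrier s) ]
                  (∀ k → Open (V k)) × (∀ k → x k ∈ V k) ×
                  (∀ y → (∀ k → y k ∈ V k) → y ∈ O)
  ; open-ext  = λ (O⊆ , ⊆O) o x x∈ → let V , oV , x∈V , V⊆ = o x (⊆O x∈) in
                  V , oV , x∈V , λ y y∈ → O⊆ (V⊆ y y∈)
  ; open-resp = λ o {x} {y} x≈y x∈ → let V , oV , x∈V , V⊆ = o x x∈ in
                  V⊆ y λ k → open-resp (oV k) (x≈y k) (x∈V k)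
  ; open-U    = λ _ _ → (λ _ _ → ⊤) , (λ _ → open-U) , _ , _
  ; open-∩    = λ o o′ x (x∈ , x∈′) →
                  let V , oV , x∈V , V⊆ = o x x∈
                      W , oW , x∈W , W⊆ = o′ x x∈′
                  in (λ k → V k ∩ W k) , (λ k → open-∩ (oV k) (oW k)) ,
                     (λ k → x∈V k , x∈W k) ,
                     λ y y∈ → V⊆ y (proj₁ ∘ y∈) , W⊆ y (proj₂ ∘ y∈)
  ; open-⋃    = λ O o x (j , x∈) → let V , oV , x∈V , V⊆ = o j x x∈ in
                  V , oV , x∈V , λ y y∈ → j , V⊆ y y∈
  }
  where open Setoid S ; open Topology τ

record IsGroupTopology {s} (G : Group s s) (τ : Topology (Group.setoid G)) : Set (lsuc s) where
  open Group G
  field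
    ∙-continuous : Continuous (Power τ 2) τ (λ x → x zero ∙ x (suc zero))
    ⁻¹-continuous : Continuous τ τ _⁻¹

module GroupSubsets {s} (G : Group s s) where
  open Group G

  infixl 7 _·_
  infixl 8 _⁻ˢ
  infixr 7 _◁_

  _·_ : Pred Carrier s → Pred Carrier s → Pred Carrier s
  (X · Y) z = ∃₂ λ x y → x ∈ X × y ∈ Y × z ≈ x ∙ y

  _⁻ˢ : Pred Carrier s → Pred Carrier s
  (X ⁻ˢ) z = ∃ λ x → x ∈ X × z ≈ x ⁻¹

  _◁_ : Carrier → Pred Carrier s → Pred Carrier s
  (g ◁ Y) z = ∃ λ y → y ∈ Y × z ≈ g ∙ y

  record IsSubgroup (H : Pred Carrier s) : Set s where
    field
      resp     : H Respects _≈_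
      ε-closed : ε ∈ H
      ∙-closed : ∀ {x y} → x ∈ H → y ∈ H → x ∙ y ∈ H
      ⁻¹-closed : ∀ {x} → x ∈ H → x ⁻¹ ∈ H

  -- Index < κ: fewer than κ left cosets of H cover the group.
  BoundedIndex : Set s → Pred Carrier s → Set (lsuc s)
  BoundedIndex κ H = Σ[ A ∈ Set s ] Small κ A ×
    (∃ λ (r : A → Carrier) → ∀ g → ∃ λ a → g ∈ r a ◁ H)

module _ {ℓ : Level} {L : Language ℓ} where

  -- Formulas defining the underlying set and the graph of multiplication.
  record GroupFormulas : Set ℓ where
    field
      dim   : ℕ
      dom   : Form L dim
      graph : Form L (dim + (dim + dim))

  -- G(N), for G the underlying set.  Points are compared by their
  -- coordinates only.
  module _ (N : Structure L) (F : GroupFormulas) where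
    open GroupFormulas F

    Point : Set ℓ
    Point = Σ[ x ∈ Vec ∣ N ∣ dim ] N ⊨ dom [ x ]

    _≈ₚ_ : Rel Point ℓ
    x ≈ₚ y = proj₁ x ≡ proj₁ y

    record IsGroupIn : Set ℓ where
      field
        _∙_     : Point → Point → Point
        ε       : Point
        _⁻¹     : Point → Point
        isGroup : IsGroup _≈ₚ_ _∙_ ε _⁻¹
        graph-∙ : ∀ x y z →
          N ⊨ graph [ proj₁ x ++ (proj₁ y ++ proj₁ z) ] ⇔ (x ∙ y) ≈ₚ z

      group : Group ℓ ℓ
      group = record { isGroup = isGroup }

  record DefinableGroup (N : Structure L) : Set ℓ where
    field
      formulas : GroupFormulas
      isGroupIn : IsGroupIn N formulas
    open GroupFormulas formulas public
    open IsGroupIn isGroupIn public using (group)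

  record ⋁Family (M* : Structure L) (F : GroupFormulas) : Set (lsuc ℓ) where
    open GroupFormulas F
    field
      I          : Set ℓ
      _≤_        : Rel I ℓ
      isPreorder : IsPreorder _≡_ _≤_
      directed   : ∀ i j → ∃ λ k → i ≤ k × j ≤ k
      arity      : I → ℕ
      φ          : ∀ i → Form L (dim + arity i)
      φ⇒dom      : ∀ N → N ≡ₑ M* → ∀ i (x : Vec ∣ N ∣ dim) y →
                   N ⊨ φ i [ x ++ y ] → N ⊨ dom [ x ]
      refine     : ∀ N → N ≡ₑ M* → ∀ {i j} → i ≤ j → ∀ y → ∃ λ y′ →
                   ∀ (x : Vec ∣ N ∣ dim) → N ⊨ φ j [ x ++ y′ ] → N ⊨ φ i [ x ++ y ]

    -- The family 𝒯(N), indexed by formulas with parameters from N.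
    Index : Structure L → Set ℓ
    Index N = ∃ λ i → Vec ∣ N ∣ (arity i)

    member : ∀ N → Index N → Pred (Point N F) ℓ
    member N (i , y) g = N ⊨ φ i [ proj₁ g ++ y ]

  -- The group structure on F(N) is determined by the formulas, and exists
  -- for every N ≡ₑ M*; the topology is determined by 𝒯(N).
  record ⋁GroupTopology (M* : Structure L) (G : DefinableGroup M*) : Set (lsuc (lsuc ℓ)) where
    open DefinableGroup G
    field
      family : ⋁Family M* formulas
    open ⋁Family family
    field
      contains-1 : ∀ N → N ≡ₑ M* → (H : IsGroupIn N formulas) →
                   ∀ j → IsGroupIn.ε H ∈ member N j
      topologyIn : ∀ N → N ≡ₑ M* → (H : IsGroupIn N formulas) →
                   Topology (Group.setoid (IsGroupIn.group H))
      isGroupTopology : ∀ N e H → IsGroupTopology (IsGroupIn.group H) (topologyIn N e H)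
      isBasis : ∀ N e H → Topology.IsNeighbourhoodBasis (topologyIn N e H)
                            (IsGroupIn.ε H) (member N)

    topology : Topology (Group.setoid group)
    topology = topologyIn M* (λ _ → ⇔-id _) isGroupIn

module Setting {ℓ : Level} {L : Language ℓ} (κ : Set ℓ) {M M* : Structure L}
               (M≼M* : M ≼ M*) (G : DefinableGroup M*) (𝒯 : ⋁GroupTopology M* G) where
  open DefinableGroup G using (group; dim) public
  open Group group using (Carrier; _≈_) public
  open GroupSubsets group public
  open Topology (⋁GroupTopology.topology 𝒯) using (Closed; cl) public

  coords : Carrier → Vec ∣ M* ∣ dim
  coords = proj₁

  coordsⁿ : ∀ {n} → (Fin n → Carrier) → Vec ∣ M* ∣ (n * dim)
  coordsⁿ x = concat (tabulate (coords ∘ x))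

  -- Subproducts of Gⁿ correspond to increasing sequences of coordinates.
  ProjectionsClosed : Set (lsuc ℓ)
  ProjectionsClosed = ∀ n (X : Pred (Fin n → Carrier) ℓ) →
    TypeDefinable κ M* coordsⁿ X → Topology.Closed (Power τ n) X →
    ∀ k (s : Fin k → Fin n) → (∀ {i j} → i Fin.< j → s i Fin.< s j) →
    Topology.Closed (Power τ k) (λ y → ∃ λ x → x ∈ X × (∀ i → y i ≈ x (s i)))
    where τ = ⋁GroupTopology.topology 𝒯

  M-TypeDefinable : Pred Carrier ℓ → Set (lsuc ℓ)
  M-TypeDefinable = TypeDefinableOver M* (_≼_.to M≼M*) coords

  M-Invariant : Pred Carrier ℓ → Set ℓ
  M-Invariant X = ∀ (σ : Aut M*) → (∀ a → Aut.to σ (_≼_.to M≼M* a) ≡ _≼_.to M≼M* a) →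
    ∀ x y → coords y ≡ map (Aut.to σ) (coords x) → x ∈ X → y ∈ X

  IsSmallestBoundedSubgroup : (Pred Carrier ℓ → Set (lsuc ℓ)) → Pred Carrier ℓ → Set (lsuc ℓ)
  IsSmallestBoundedSubgroup Q H =
    Candidate H × (∀ H′ → Candidate H′ → H ⊆ H′)
    where
      Candidate : Pred Carrier ℓ → Set (lsuc ℓ)
      Candidate K = IsSubgroup K × Q K × BoundedIndex κ K

  IsG⁰⁰ IsG⁰⁰⁰ : Pred Carrier ℓ → Set (lsuc ℓ)
  IsG⁰⁰  = IsSmallestBoundedSubgroup M-TypeDefinable
  IsG⁰⁰⁰ = IsSmallestBoundedSubgroup (λ H → Lift (lsuc ℓ) (M-Invariant H))

  record 𝒟 : Set (lsuc ℓ) where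
    field
      set           : Pred Carrier ℓ
      closed        : Closed set
      typeDefinable : TypeDefinable κ M* coords set

  open 𝒟 public using (set)

  -- Members of 𝒟 are compared through their underlying sets, so Y ∪ Z, Y ∩ Z
  -- and gY are any members of 𝒟 with the appropriate underlying set.
  record Mean : Set (lsuc ℓ) where
    field
      mean      : 𝒟 → ℝ
      0≤mean    : ∀ Y → 0ᴿ ≤ᴿ mean Y
      mean≤1    : ∀ Y → mean Y ≤ᴿ 1ᴿ
      monotone  : ∀ Y Z → set Y ⊆ set Z → mean Y ≤ᴿ mean Z
      mean-∅    : ∀ Y → Empty (set Y) → mean Y ≃ᴿ 0ᴿ
      mean-G    : ∀ Y → Universal (set Y) → mean Y ≃ᴿ 1ᴿ
      mean-∪    : ∀ Y Z V W → set V ≐ set Y ∪ set Z → set W ≐ set Y ∩ set Z →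
                  mean V ≃ᴿ mean Y +ᴿ mean Z -ᴿ mean W
      invariant : ∀ g Y Z → set Z ≐ g ◁ set Y → mean Z ≃ᴿ mean Y

    Wide : 𝒟 → Set
    Wide Y = 0ᴿ <ᴿ mean Y

-- Put f(x) = m(xP ∩ PP).  It is a matrix coefficient x ↦ ⟨xξ , η⟩ of a unitary
-- representation of G, it equals m(P) on P, and it vanishes on gP for g ∉ P⁴.
-- Among the coefficients with these two properties consider those whose square
-- has nearly the least invariant mean.  By the parallelogram law any two of them
-- are close in mean square, so that they have a limit which depends on no choice;
-- its stabiliser is an M-invariant subgroup of index at most 2^ℵ₀.  An element g
-- of the stabiliser lies in P⁴, because otherwise translation by g would change
-- the limit on the wide set P.  Hence G⁰⁰⁰ ⊆ P⁴.
--
-- Next, G⁰⁰⁰ contains a point h that is wide over M: every M-definable set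
-- containing h has a wide closure.  Let D be the set of realisations of tp(h / M)
-- and D̂ = D D D⁻¹ D⁻¹.  Then D̂ ⊆ G⁰⁰⁰, and the previous paragraph applied to the
-- closures of the M-definable sets containing h gives G⁰⁰⁰ ⊆ cl(D̂) by compactness.
-- So cl(G⁰⁰⁰) = cl(D̂) is an M-type-definable subgroup of bounded index, and it
-- contains G⁰⁰.  As P⁴ is closed by the hypothesis on projections, it contains
-- cl(G⁰⁰⁰) and therefore G⁰⁰.
module Submission where

open import Axiom.ExcludedMiddle using (ExcludedMiddle)
open import Algebra.Bundles using (Group)
open import Level using (Level)

-- The mean lives on a lattice of closed sets without complements, so neither a measure space nor a
-- Hilbert space is built. A representation with two vectors is replaced by the Gram kernel of their
-- orbits, and the limit of coefficients by the class of near minimisers at every precision.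
--
-- An invariant mean of squared coefficients needs no amenability: ⟨xξ , η⟩² is a coefficient of the
-- tensor square, and an average of the translates of ξ ⊗ ξ with nearly least norm is nearly fixed
-- by G. Hence squares are minimised and kernels carry a Schur condition. Averaging on the left and
-- on the right gives the same value, which makes the mean unique and yields a parallelogram law for
-- it.
--
-- The other obstacle is size. κ is an arbitrary type above 2^(|L| + |M| + ℵ₀), with no cardinal
-- arithmetic at hand; parameter sets are therefore embedded in the set of sentences over M, which
-- absorbs sums. The wide point of G⁰⁰⁰ is found as x⁻¹y, with x and y in one coset and y wide over
-- M and x: translation by x then makes x⁻¹y wide over M.

-- Definable relations and saturation

module Definable where

  open import Defs
  open import Axiom.ExcludedMiddle using (ExcludedMiddle)
  import Data.Empty as Empty₀
  open import Data.Empty.Polymorphic using (⊥; ⊥-elim)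
  open import Data.Fin.Base as Fin using (Fin; zero; suc; _↑ˡ_; _↑ʳ_; splitAt; join)
  import Data.Fin.Properties as Fin
  open import Data.List.Base using (List; []; _∷_)
  open import Data.List.Relation.Unary.All using (All; []; _∷_)
  open import Data.List.Relation.Unary.Any using (here; there)
  open import Data.List.Membership.Propositional using (_∈_)
  open import Data.Nat.Base using (ℕ; zero; suc; _+_)
  open import Data.Product.Base using (∃; _×_; _,_; proj₁; proj₂)
  open import Data.Sum.Base as Sum using (_⊎_; inj₁; inj₂; [_,_]′)
  open import Data.Unit.Polymorphic using (⊤; tt)
  open import Data.Vec.Base using (Vec; []; _∷_; _++_; lookup; map; take; drop)
  import Data.Vec.Properties as Vec
  open import Function.Base using (_∘_; id)
  open import Function.Bundles using (_⇔_; mk⇔; Equivalence; Inverse)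
  open import Function.Construct.Composition using (_⇔-∘_)
  open import Function.Construct.Identity using (⇔-id)
  open import Function.Construct.Symmetry public using (⇔-sym)
  open import Level using (Level; Lift; lift)
  open import Relation.Binary.PropositionalEquality.Core using (_≡_; refl; sym; trans; cong; cong₂; subst)
  open import Relation.Nullary using (Dec; yes; no)
  open import Relation.Nullary.Decidable using (decidable-stable)

  open Equivalence using (to; from)

  ⇔-refl : ∀ {a} {A : Set a} → A ⇔ A
  ⇔-refl = ⇔-id _

  ⇔-trans : ∀ {a b c} {A : Set a} {B : Set b} {C : Set c} → A ⇔ B → B ⇔ C → A ⇔ C
  ⇔-trans e f = f ⇔-∘ e

  ≡⇒⇔ : ∀ {a} {A B : Set a} → A ≡ B → A ⇔ B
  ≡⇒⇔ refl = ⇔-refl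

  lookup-splitAt : ∀ {a} {A : Set a} {m n} (xs : Vec A m) (ys : Vec A n) i → lookup (xs ++ ys) i ≡ [ lookup xs , lookup ys ]′ (splitAt m i)
  lookup-splitAt {m = m} xs ys i = Vec.lookup-splitAt m xs ys i

  lookup-ext : ∀ {a} {A : Set a} {n} (xs ys : Vec A n) → (∀ i → lookup xs i ≡ lookup ys i) → xs ≡ ys
  lookup-ext []       []       e = refl
  lookup-ext (x ∷ xs) (y ∷ ys) e = cong₂ _∷_ (e zero) (lookup-ext xs ys (e ∘ suc))

  size : List ℕ → ℕ
  size []       = 0
  size (m ∷ ms) = m + size ms

  module _ {ℓ : Level} {L : Language ℓ} where
    open Language L

    mutual
      renameᵗ : ∀ {m n} → (Fin m → Fin n) → Term L m → Term L n
      renameᵗ ρ (var i)    = var (ρ i)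
      renameᵗ ρ (app f ts) = app f (renamesᵗ ρ ts)

      renamesᵗ : ∀ {m n k} → (Fin m → Fin n) → Vec (Term L m) k → Vec (Term L n) k
      renamesᵗ ρ []       = []
      renamesᵗ ρ (t ∷ ts) = renameᵗ ρ t ∷ renamesᵗ ρ ts

    rename : ∀ {m n} → (Fin m → Fin n) → Form L m → Form L n
    rename ρ ⊥′         = ⊥′
    rename ρ (s ≈′ t)   = renameᵗ ρ s ≈′ renameᵗ ρ t
    rename ρ (rel′ P ts) = rel′ P (renamesᵗ ρ ts)
    rename ρ (φ ⇒′ ψ)   = rename ρ φ ⇒′ rename ρ ψ
    rename ρ (∀′ φ)     = ∀′ (rename (Fin.lift 1 ρ) φ)

    ∀^ : ∀ m {n} → Form L (m + n) → Form L n
    ∀^ zero    φ = φ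
    ∀^ (suc m) φ = ∀^ m (∀′ φ)

    module _ (N : Structure L) where
      private C = ∣ N ∣

      mutual
        eval-rename : ∀ {m n} (ρ : Fin m → Fin n) {v : Vec C m} {w} → (∀ i → lookup v i ≡ lookup w (ρ i)) →
                      ∀ t → eval N w (renameᵗ ρ t) ≡ eval N v t
        eval-rename ρ e (var i)    = sym (e i)
        eval-rename ρ e (app f ts) = cong (Structure.fun N f) (evals-rename ρ e ts)

        evals-rename : ∀ {m n k} (ρ : Fin m → Fin n) {v : Vec C m} {w} → (∀ i → lookup v i ≡ lookup w (ρ i)) →
                       ∀ (ts : Vec _ k) → evals N w (renamesᵗ ρ ts) ≡ evals N v ts
        evals-rename ρ e []       = refl
        evals-rename ρ e (t ∷ ts) = cong₂ _∷_ (eval-rename ρ e t) (evals-rename ρ e ts)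

      ⊨-rename : ∀ {m n} (φ : Form L m) (ρ : Fin m → Fin n) {v w} → (∀ i → lookup v i ≡ lookup w (ρ i)) →
                 N ⊨ rename ρ φ [ w ] ⇔ N ⊨ φ [ v ]
      ⊨-rename ⊥′          ρ e = ⇔-refl
      ⊨-rename (s ≈′ t)    ρ e = ≡⇒⇔ (cong₂ _≡_ (eval-rename ρ e s) (eval-rename ρ e t))
      ⊨-rename (rel′ P ts) ρ e = ≡⇒⇔ (cong (Structure.rel N P) (evals-rename ρ e ts))
      ⊨-rename (φ ⇒′ ψ)    ρ e = mk⇔ (λ h → to (⊨-rename ψ ρ e) ∘ h ∘ from (⊨-rename φ ρ e))
                                     (λ h → from (⊨-rename ψ ρ e) ∘ h ∘ to (⊨-rename φ ρ e))
      ⊨-rename (∀′ φ)      ρ {v} {w} e = mk⇔ (λ h x → to (⊨-rename φ (Fin.lift 1 ρ) (e′ x)) (h x))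
                                             (λ h x → from (⊨-rename φ (Fin.lift 1 ρ) (e′ x)) (h x))
        where
          e′ : ∀ x i → lookup (x ∷ v) i ≡ lookup (x ∷ w) (Fin.lift 1 ρ i)
          e′ x zero    = refl
          e′ x (suc i) = e i

      ⊨-∀^ : ∀ m {n} (φ : Form L (m + n)) w → N ⊨ ∀^ m φ [ w ] ⇔ (∀ (y : Vec C m) → N ⊨ φ [ y ++ w ])
      ⊨-∀^ zero    φ w = mk⇔ (λ { h [] → h }) (λ h → h [])
      ⊨-∀^ (suc m) φ w = ⇔-trans (⊨-∀^ m (∀′ φ) w) (mk⇔ (λ { h (x ∷ y) → h y x }) (λ h y x → h (x ∷ y)))

      module _ (σ : Aut N) where
        open Aut σ using (bij; pres-fun; pres-rel) renaming (to to s)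

        mutual
          eval-aut : ∀ {n} (v : Vec C n) t → eval N (map s v) t ≡ s (eval N v t)
          eval-aut v (var i)    = Vec.lookup-map i s v
          eval-aut v (app f ts) = trans (cong (Structure.fun N f) (evals-aut v ts)) (sym (pres-fun f (evals N v ts)))

          evals-aut : ∀ {n k} (v : Vec C n) (ts : Vec _ k) → evals N (map s v) ts ≡ map s (evals N v ts)
          evals-aut v []       = refl
          evals-aut v (t ∷ ts) = cong₂ _∷_ (eval-aut v t) (evals-aut v ts)

        ⊨-aut : ∀ {n} (φ : Form L n) v → N ⊨ φ [ v ] ⇔ N ⊨ φ [ map s v ]
        ⊨-aut ⊥′          v = ⇔-refl
        ⊨-aut (a ≈′ b)    v = mk⇔ (λ e → trans (eval-aut v a) (trans (cong s e) (sym (eval-aut v b))))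
          (λ e → trans (sym (Inverse.strictlyInverseʳ bij _)) (trans (cong (Inverse.from bij) (trans (sym (eval-aut v a)) (trans e (eval-aut v b)))) (Inverse.strictlyInverseʳ bij _)))
        ⊨-aut (rel′ P ts) v = ⇔-trans (pres-rel P (evals N v ts)) (≡⇒⇔ (cong (Structure.rel N P) (sym (evals-aut v ts))))
        ⊨-aut (φ ⇒′ ψ)    v = mk⇔ (λ h → to (⊨-aut ψ v) ∘ h ∘ from (⊨-aut φ v)) (λ h → from (⊨-aut ψ v) ∘ h ∘ to (⊨-aut φ v))
        ⊨-aut (∀′ φ)      v = mk⇔
          (λ h x → subst (λ y → N ⊨ φ [ y ∷ map s v ]) (Inverse.strictlyInverseˡ bij x) (to (⊨-aut φ (Inverse.from bij x ∷ v)) (h (Inverse.from bij x))))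
          (λ h x → from (⊨-aut φ (x ∷ v)) (h (s x)))

    module _ (N : Structure L) where
      private C = ∣ N ∣

      Env : List ℕ → Set ℓ
      Env []       = ⊤
      Env (m ∷ ms) = Vec C m × Env ms

      flat : ∀ {ms} → Env ms → Vec C (size ms)
      flat {[]}     _       = []
      flat {m ∷ ms} (y , e) = y ++ flat {ms} e

      unflat : ∀ ms (w : Vec C (size ms)) → ∃ λ e → flat {ms} e ≡ w
      unflat []       []  = tt , refl
      unflat (m ∷ ms) w = (take m w , proj₁ rest) , trans (cong (take m w ++_) (proj₂ rest)) (Vec.take++drop≡id m w)
        where rest = unflat ms (drop m w)

      entry : ∀ {ms m} → m ∈ ms → Env ms → Vec C m
      entry (here refl) (y , _) = y
      entry (there i)   (_ , e) = entry i e

    module _ (N : Structure L) {A : Set ℓ} (p : A → ∣ N ∣) where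
      private C = ∣ N ∣

      -- The coordinates of a vector of length m, each taken from an n-tuple of
      -- variables or from finitely many parameters.
      record Src (n m : ℕ) : Set ℓ where
        field
          {k}    : ℕ
          params : Vec A k
          src    : Fin m → Fin n ⊎ Fin k

        Den : Vec C n → Vec C m → Set ℓ
        Den w v = ∀ i → lookup v i ≡ [ lookup w , lookup (map p params) ]′ (src i)
      open Src

      place : ∀ {n m} → Form L m → Src n m → FormOver A n
      place φ s = k s , rename (join _ _ ∘ src s) φ , params s

      Sat-place : ∀ {n m} (φ : Form L m) (s : Src n m) {w v} → Den s w v → Sat N p w (place φ s) ⇔ N ⊨ φ [ v ]
      Sat-place {n} φ s {w} den = ⊨-rename N φ (join _ _ ∘ src s) λ i → trans (den i)
        (trans (cong [ lookup w , lookup (map p (params s)) ]′ (sym (Fin.splitAt-join n _ (src s i)))) (sym (lookup-splitAt w _ (join n _ (src s i)))))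

      parˢ : ∀ {n m} → Vec A m → Src n m
      parˢ as = record { params = as ; src = inj₂ }

      infixr 5 _⊕_
      _⊕_ : ∀ {n m m′} → Src n m → Src n m′ → Src n (m + m′)
      _⊕_ {m = m} s t = record { params = params s ++ params t ; src = λ i →
        [ Sum.map₂ (_↑ˡ k t) ∘ src s , Sum.map₂ (k s ↑ʳ_) ∘ src t ]′ (splitAt m i) }

      private
        lookup-map-++ˡ : ∀ {k k′} (as : Vec A k) (bs : Vec A k′) i → lookup (map p (as ++ bs)) (i ↑ˡ k′) ≡ lookup (map p as) i
        lookup-map-++ˡ as bs i = trans (Vec.lookup-map _ p (as ++ bs)) (trans (cong p (Vec.lookup-++ˡ as bs i)) (sym (Vec.lookup-map i p as)))
        lookup-map-++ʳ : ∀ {k k′} (as : Vec A k) (bs : Vec A k′) i → lookup (map p (as ++ bs)) (k ↑ʳ i) ≡ lookup (map p bs) i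
        lookup-map-++ʳ as bs i = trans (Vec.lookup-map _ p (as ++ bs)) (trans (cong p (Vec.lookup-++ʳ as bs i)) (sym (Vec.lookup-map i p bs)))

      Den-⊕ : ∀ {n m m′} (s : Src n m) (t : Src n m′) {w v v′} → Den s w v → Den t w v′ → Den (s ⊕ t) w (v ++ v′)
      Den-⊕ {m = m} s t {w} {v} {v′} ds dt i = trans (lookup-splitAt v v′ i) (cases (splitAt m i))
        where
          left : ∀ x → [ lookup w , lookup (map p (params s)) ]′ x ≡ [ lookup w , lookup (map p (params s ++ params t)) ]′ (Sum.map₂ (_↑ˡ k t) x)
          left (inj₁ _) = refl
          left (inj₂ j) = sym (lookup-map-++ˡ (params s) (params t) j)
          right : ∀ x → [ lookup w , lookup (map p (params t)) ]′ x ≡ [ lookup w , lookup (map p (params s ++ params t)) ]′ (Sum.map₂ (k s ↑ʳ_) x)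
          right (inj₁ _) = refl
          right (inj₂ j) = sym (lookup-map-++ʳ (params s) (params t) j)
          cases : ∀ x → [ lookup v , lookup v′ ]′ x ≡ [ lookup w , lookup (map p (params s ++ params t)) ]′ ([ Sum.map₂ (_↑ˡ k t) ∘ src s , Sum.map₂ (k s ↑ʳ_) ∘ src t ]′ x)
          cases (inj₁ i) = trans (ds i) (left (src s i))
          cases (inj₂ i) = trans (dt i) (right (src t i))

      implies : ∀ {n} → FormOver A n → FormOver A n → FormOver A n
      implies {n} (k , φ , a) (k′ , ψ , b) = k + k′ , rename (left ∘ splitAt n) φ ⇒′ rename (right ∘ splitAt n) ψ , a ++ b
        where
          left : Fin n ⊎ Fin k → Fin (n + (k + k′))
          left = join n (k + k′) ∘ Sum.map₂ (_↑ˡ k′)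
          right : Fin n ⊎ Fin k′ → Fin (n + (k + k′))
          right = join n (k + k′) ∘ Sum.map₂ (k ↑ʳ_)

      Sat-implies : ∀ {n} (θ θ′ : FormOver A n) w → Sat N p w (implies θ θ′) ⇔ (Sat N p w θ → Sat N p w θ′)
      Sat-implies {n} (k , φ , a) (k′ , ψ , b) w = mk⇔ (λ h → to e′ ∘ h ∘ from e) (λ h → from e′ ∘ h ∘ to e)
        where
          ps = map p (a ++ b)
          e = ⊨-rename N φ _ {w ++ map p a} λ i → trans (lookup-splitAt w (map p a) i) (go (splitAt n i))
            where
              go : ∀ x → [ lookup w , lookup (map p a) ]′ x ≡ lookup (w ++ ps) (join n (k + k′) (Sum.map₂ (_↑ˡ k′) x))
              go (inj₁ j) = sym (Vec.lookup-++ˡ w ps j)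
              go (inj₂ j) = sym (trans (Vec.lookup-++ʳ w ps (j ↑ˡ k′)) (lookup-map-++ˡ a b j))
          e′ = ⊨-rename N ψ _ {w ++ map p b} λ i → trans (lookup-splitAt w (map p b) i) (go (splitAt n i))
            where
              go : ∀ x → [ lookup w , lookup (map p b) ]′ x ≡ lookup (w ++ ps) (join n (k + k′) (Sum.map₂ (k ↑ʳ_) x))
              go (inj₁ j) = sym (Vec.lookup-++ˡ w ps j)
              go (inj₂ j) = sym (trans (Vec.lookup-++ʳ w ps (k ↑ʳ j)) (lookup-map-++ʳ a b j))

      reassociate : ∀ m n k → Fin (m + n) ⊎ Fin k → Fin (m + (n + k))
      reassociate m n k (inj₁ i) = join m (n + k) (Sum.map₂ (_↑ˡ k) (splitAt m i))
      reassociate m n k (inj₂ j) = m ↑ʳ (n ↑ʳ j)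

      universal : ∀ m {n} → FormOver A (m + n) → FormOver A n
      universal m {n} (k , φ , a) = k , ∀^ m (rename (reassociate m n k ∘ splitAt (m + n)) φ) , a

      Sat-universal : ∀ m {n} (θ : FormOver A (m + n)) w → Sat N p w (universal m θ) ⇔ (∀ y → Sat N p (y ++ w) θ)
      Sat-universal m {n} (k , φ , a) w = ⇔-trans (⊨-∀^ N m _ (w ++ ps)) (mk⇔ (λ h y → to (e y) (h y)) (λ h y → from (e y) (h y)))
        where
          ps = map p a
          e : ∀ y → _ ⇔ N ⊨ φ [ (y ++ w) ++ ps ]
          e y = ⊨-rename N φ _ λ i → trans (lookup-splitAt (y ++ w) ps i) (go (splitAt (m + n) i))
            where
              inner : ∀ x → [ lookup y , lookup w ]′ x ≡ lookup (y ++ (w ++ ps)) (join m (n + k) (Sum.map₂ (_↑ˡ k) x))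
              inner (inj₁ j) = sym (Vec.lookup-++ˡ y _ j)
              inner (inj₂ j) = sym (trans (Vec.lookup-++ʳ y _ (j ↑ˡ k)) (Vec.lookup-++ˡ w ps j))
              go : ∀ x → [ lookup (y ++ w) , lookup ps ]′ x ≡ lookup (y ++ (w ++ ps)) (reassociate m n k x)
              go (inj₁ i) = trans (lookup-splitAt y w i) (inner (splitAt m i))
              go (inj₂ j) = sym (trans (Vec.lookup-++ʳ y _ (n ↑ʳ j)) (Vec.lookup-++ʳ w ps j))

      record Arg (ms : List ℕ) (m : ℕ) : Set ℓ where
        field
          source : Src (size ms) m
          val    : Env N ms → Vec C m
          den    : ∀ e → Den source (flat N {ms} e) (val e)
      open Arg

      variable′ : ∀ {ms m} → m ∈ ms → Arg ms m
      variable′ {ms} i = record { source = record { params = [] ; src = inj₁ ∘ position i } ; val = entry N i ; den = λ e → lookup-position i e }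
        where
          position : ∀ {ms m} → m ∈ ms → Fin m → Fin (size ms)
          position {m ∷ ms} (here refl) j = j ↑ˡ size ms
          position {m ∷ ms} (there i)   j = m ↑ʳ position i j
          lookup-position : ∀ {ms m} (i : m ∈ ms) e j → lookup (entry N i e) j ≡ lookup (flat N {ms} e) (position i j)
          lookup-position {m ∷ ms} (here refl) (y , e) j = sym (Vec.lookup-++ˡ y (flat N {ms} e) j)
          lookup-position {m ∷ ms} (there i)   (y , e) j = trans (lookup-position i e j) (sym (Vec.lookup-++ʳ y (flat N {ms} e) (position i j)))

      parameter : ∀ {ms m} → Vec A m → Arg ms m
      parameter as = record { source = parˢ as ; val = λ _ → map p as ; den = λ _ _ → refl }

      infixr 5 _⊞_
      _⊞_ : ∀ {ms m m′} → Arg ms m → Arg ms m′ → Arg ms (m + m′)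
      _⊞_ {ms} s t = record { source = source s ⊕ source t ; val = λ e → val s e ++ val t e
                     ; den = λ e → Den-⊕ (source s) (source t) {flat N {ms} e} {val s e} {val t e} (den s e) (den t e) }

      -- Pairs a relation, stated as a predicate on tuples of lengths `ms`, with a formula for it.
      -- Definability proofs then follow the shape of the predicate, and variable positions are
      -- handled once and for all by the closure lemmas below.
      record Def (ms : List ℕ) (S : Env N ms → Set ℓ) : Set ℓ where
        constructor def
        field
          formula : FormOver A (size ms)
          sat     : ∀ e → S e ⇔ Sat N p (flat N {ms} e) formula
      open Def

      Def-⇔ : ∀ {ms S S′} → (∀ e → S e ⇔ S′ e) → Def ms S → Def ms S′
      Def-⇔ h (def θ s) = def θ λ e → ⇔-trans (⇔-sym (h e)) (s e)

      Def-form : ∀ {ms m} (φ : Form L m) (s : Arg ms m) → Def ms (λ e → N ⊨ φ [ val s e ])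
      Def-form {ms} φ s = def (place φ (source s)) λ e → ⇔-sym (Sat-place φ (source s) {flat N {ms} e} {val s e} (den s e))

      Def-→ : ∀ {ms S S′} → Def ms S → Def ms S′ → Def ms (λ e → S e → S′ e)
      Def-→ {ms} (def θ s) (def θ′ s′) = def (implies θ θ′) λ e → ⇔-sym (⇔-trans (Sat-implies θ θ′ (flat N {ms} e))
        (mk⇔ (λ h → from (s′ e) ∘ h ∘ to (s e)) (λ h → to (s′ e) ∘ h ∘ from (s e))))

      Def-∀ : ∀ {ms} m {S : Env N (m ∷ ms) → Set ℓ} → Def (m ∷ ms) S → Def ms (λ e → ∀ y → S (y , e))
      Def-∀ {ms} m (def θ s) = def (universal m θ) λ e → ⇔-sym (⇔-trans (Sat-universal m θ (flat N {ms} e))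
        (mk⇔ (λ h y → from (s (y , e)) (h y)) (λ h y → to (s (y , e)) (h y))))

      Def-⊥ : ∀ {ms} → Def ms (λ _ → ⊥)
      Def-⊥ = def (0 , ⊥′ , []) λ _ → ⇔-refl

      Def-⊤ : ∀ {ms} → Def ms (λ _ → ⊤)
      Def-⊤ = Def-⇔ (λ _ → mk⇔ (λ _ → tt) (λ _ h → h)) (Def-→ Def-⊥ Def-⊥)

      args : ∀ {ms ms′} → All (Arg ms′) ms → Env N ms′ → Env N ms
      args []      e = tt
      args (a ∷ σ) e = val a e , args σ e

      private
        flatten : ∀ {ms ms′} → All (Arg ms′) ms → Arg ms′ (size ms)
        flatten []      = parameter []
        flatten (a ∷ σ) = a ⊞ flatten σ

        val-flatten : ∀ {ms ms′} (σ : All (Arg ms′) ms) e → val (flatten σ) e ≡ flat N {ms} (args σ e)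
        val-flatten []      e = refl
        val-flatten (a ∷ σ) e = cong (val a e ++_) (val-flatten σ e)

      Def-subst : ∀ {ms ms′ S} → Def ms S → (σ : All (Arg ms′) ms) → Def ms′ (λ e → S (args σ e))
      Def-subst (def (k , φ , a) s) σ = Def-⇔ (λ e → ⇔-sym (⇔-trans (s (args σ e)) (≡⇒⇔ (cong (λ v → N ⊨ φ [ v ++ map p a ]) (sym (val-flatten σ e))))))
        (Def-form φ (flatten σ ⊞ parameter a))

      module _ (em : ∀ {a} → ExcludedMiddle a) where

        private
          lower′ : ∀ {a} → ⊥ {a} → Empty₀.⊥
          lower′ ()

        Def-× : ∀ {ms S S′} → Def ms S → Def ms S′ → Def ms (λ e → S e × S′ e)
        Def-× d d′ = Def-⇔ (λ e → mk⇔
            (λ h → decidable-stable em (λ n → lower′ (h λ x y → Empty₀.⊥-elim (n (x , y))))) (λ (x , y) h → h x y))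
          (Def-→ (Def-→ d (Def-→ d′ Def-⊥)) Def-⊥)

        Def-∃ : ∀ {ms} m {S : Env N (m ∷ ms) → Set ℓ} → Def (m ∷ ms) S → Def ms (λ e → ∃ λ y → S (y , e))
        Def-∃ m d = Def-⇔ (λ e → mk⇔ (λ h → decidable-stable em (λ n → lower′ (h λ y s → Empty₀.⊥-elim (n (y , s))))) (λ (y , s) h → h y s))
          (Def-→ (Def-∀ m (Def-→ d Def-⊥)) Def-⊥)

        Def-⊎ : ∀ {ms S S′} → Def ms S → Def ms S′ → Def ms (λ e → S e ⊎ S′ e)
        Def-⊎ {S = S} d d′ = Def-⇔ (λ e → mk⇔ (λ h → decide h em) (λ { (inj₁ x) h → ⊥-elim (h x) ; (inj₂ y) _ → y }))
          (Def-→ (Def-→ d Def-⊥) d′)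
          where
            decide : ∀ {e} {T : Set ℓ} → ((S e → ⊥) → T) → Dec (S e) → S e ⊎ T
            decide h (yes x) = inj₁ x
            decide h (no ¬x) = inj₂ (h (λ x → Empty₀.⊥-elim (¬x x)))

        Def-All : ∀ {ms} {J : Set ℓ} {S : J → Env N ms → Set ℓ} → (∀ j → Def ms (S j)) → ∀ js → Def ms (λ e → All (λ j → S j e) js)
        Def-All d []       = Def-⇔ (λ e → mk⇔ (λ _ → []) (λ _ → tt)) Def-⊤
        Def-All d (j ∷ js) = Def-⇔ (λ e → mk⇔ (λ (x , xs) → x ∷ xs) (λ { (x ∷ xs) → x , xs })) (Def-× (d j) (Def-All d js))

      -- The type consists of the formulas picked by `d`. A finite part of it is pulled back to a
      -- list of indices, so that finite satisfiability can be checked on the relations `S j`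
      -- instead of on syntax.
      saturation : ∀ {κ} → Saturated κ N → Small κ A → ∀ {ms} {J : Set ℓ} (S : J → Env N ms → Set ℓ) → (∀ j → Def ms (S j)) →
                   (∀ js → ∃ λ e → All (λ j → S j e) js) → ∃ λ e → ∀ j → S j e
      saturation sat-N small {ms} {J} S d fin =
        let w , real = sat-N small p Φ fs
            e , eq = unflat N ms w
        in e , λ j → from (sat (d j) e) (subst (λ w → Sat N p w (formula (d j))) (sym eq) (real _ (lift (j , refl))))
        where
          Φ : FormOver A (size ms) → Set ℓ
          Φ θ = Lift ℓ (∃ λ j → θ ≡ formula (d j))
          indices : ∀ θs → All Φ θs → List J
          indices []       []             = []
          indices (θ ∷ θs) (lift (j , _) ∷ h) = j ∷ indices θs h
          back : ∀ e θs (h : All Φ θs) → All (λ j → S j e) (indices θs h) → All (Sat N p (flat N {ms} e)) θs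
          back e []       []                     []       = []
          back e (θ ∷ θs) (lift (j , refl) ∷ h) (s ∷ ss) = to (sat (d j) e) s ∷ back e θs h ss
          fs : FinitelySatisfiable N p Φ
          fs θs h = let e , ss = fin (indices θs h) in flat N {ms} e , back e θs h ss

      toFormOver : ∀ {m S} → Def (m ∷ []) S → ∃ λ (θ : FormOver A m) → ∀ x → S (x , tt) ⇔ Sat N p x θ
      toFormOver {m} (def (k , φ , a) s) = place φ (drop0 ⊕ parˢ a) , λ x → ⇔-trans (s (x , tt))
          (⇔-sym (Sat-place φ (drop0 ⊕ parˢ a) {x} (Den-⊕ drop0 (parˢ a) {x} {x ++ []} (den0 x) (λ _ → refl))))
        where
          ρ : Fin m ⊎ Fin 0 → Fin m ⊎ Fin 0
          ρ = id
          -- `size (m ∷ [])` is `m + 0`, and `flat` ends every environment with an empty vector;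
          -- this source re-addresses those positions by `Fin m`.
          drop0 : Src m (m + 0)
          drop0 = record { params = [] ; src = ρ ∘ splitAt m }
          den0 : ∀ x → Den drop0 x (x ++ [])
          den0 x i = trans (lookup-splitAt x [] i) (go (splitAt m i))
            where
              go : ∀ y → [ lookup x , lookup [] ]′ y ≡ [ lookup x , lookup [] ]′ y
              go y = refl

      fromFormOver : ∀ {m} (θ : FormOver A m) → Def (m ∷ []) (λ (x , _) → Sat N p x θ)
      fromFormOver (k , φ , a) = Def-form φ (variable′ (here refl) ⊞ parameter a)

    Def-params : ∀ (N : Structure L) {A B : Set ℓ} (p : A → ∣ N ∣) (q : B → ∣ N ∣) (f : A → B) → (∀ a → q (f a) ≡ p a) →
                 ∀ {ms} {S : Env N ms → Set ℓ} → Def N p ms S → Def N q ms S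
    Def-params N p q f qf≡p {ms} (def (k , φ , a) s) = def (k , φ , map f a) λ e →
      ⇔-trans (s e) (≡⇒⇔ (cong (λ b → N ⊨ φ [ flat N {ms} e ++ b ]) (trans (Vec.map-cong (λ x → sym (qf≡p x)) a) (Vec.map-∘ q f a))))

-- Cardinalities below κ

module SmallSets where

  open import Defs
  open import Axiom.ExcludedMiddle using (ExcludedMiddle)
  open import Data.Bool.Base using (Bool; true; false)
  open import Data.Empty using (⊥-elim) renaming (⊥ to ⊥₀)
  open import Data.List.Base using (List; []; _∷_)
  open import Data.Nat.Base using (ℕ; zero; suc)
  open import Data.Product.Base using (∃; ∃₂; _×_; _,_; proj₁; proj₂)
  open import Data.Sum.Base as Sum using (_⊎_; inj₁; inj₂)
  open import Data.Fin.Base as Fin using (Fin; toℕ)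
  import Data.Fin.Properties as Fin
  open import Data.Rational.Base as ℚ using (ℚ)
  import Data.Rational.Properties as ℚ
  open import Data.Integer.Base as ℤ using (ℤ)
  open import Data.Vec.Base using (Vec; []; _∷_)
  open import Function.Bundles using (Injection)
  open import Level using (Level; Lift; lift)
  open import Relation.Binary.PropositionalEquality using (_≡_; refl; sym; trans; cong; cong₂; setoid)
  open import Relation.Nullary using (¬_; Dec; yes; no; isYes)

  module _ {ℓ : Level} {L : Language ℓ} (em : ∀ {a} → ExcludedMiddle a) (κ : Set ℓ) {M : Structure L}
           (large : SufficientlyLarge κ M) where

    Formulas : Set ℓ
    Formulas = FormOver {L = L} ∣ M ∣ 0

    -- Being of size at most |L| + |M| + ℵ₀. As κ is an arbitrary type, sums of small sets are hard
    -- to control directly; subsets of `Formulas` can be tagged and united inside `Formulas`.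
    Tame : ∀ {a} → Set a → Set _
    Tame A = ∃ λ (f : A → Formulas) → ∀ {x y} → f x ≡ f y → x ≡ y

    -- Formulas act here as mere codes, never interpreted. Implications over `⊥′` exist in every
    -- language, so they can carry numerals and tags whatever the symbols of `L`.
    tower : ∀ {n} → ℕ → Form L n
    tower zero    = ⊥′
    tower (suc n) = ⊥′ ⇒′ tower n

    height : ∀ {n} → Form L n → ℕ
    height (_ ⇒′ φ) = suc (height φ)
    height _        = zero

    height-tower : ∀ {k} n → height (tower {k} n) ≡ n
    height-tower zero    = refl
    height-tower (suc n) = cong suc (height-tower n)

    tower-injective : ∀ {k m n} → tower {k} m ≡ tower n → m ≡ n
    tower-injective {m = m} {n} e = trans (sym (height-tower m)) (trans (cong height e) (height-tower n))

    numbered : ℕ → Formulas → Formulas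
    numbered n (k , φ , a) = k , tower n ⇒′ φ , a

    numbered-injective : ∀ {m n θ θ′} → numbered m θ ≡ numbered n θ′ → m ≡ n × θ ≡ θ′
    numbered-injective {m} {n} {k , φ , a} {k′ , φ′ , a′} e = trans (sym (height-tower m)) (trans (cong number e) (height-tower n)) , cong content e
      where
        number : Formulas → ℕ
        number (_ , ψ ⇒′ _ , _) = height ψ
        number _                = zero
        content : Formulas → Formulas
        content (k , _ ⇒′ φ , a) = k , φ , a
        content θ                = θ

    Tame-⊎ : ∀ {a b} {A : Set a} {B : Set b} → Tame A → Tame B → Tame (A ⊎ B)
    Tame-⊎ {A = A} {B} (f , f-inj) (g , g-inj) = h , h-inj
      where
        h : A ⊎ B → Formulas
        h (inj₁ x) = numbered 0 (f x)
        h (inj₂ y) = numbered 1 (g y)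
        h-inj : ∀ {x y} → h x ≡ h y → x ≡ y
        h-inj {inj₁ x} {inj₁ y} e = cong inj₁ (f-inj (proj₂ (numbered-injective {0} {0} e)))
        h-inj {inj₂ x} {inj₂ y} e = cong inj₂ (g-inj (proj₂ (numbered-injective {1} {1} e)))
        h-inj {inj₁ x} {inj₂ y} e with numbered-injective {0} {1} e
        ... | () , _
        h-inj {inj₂ x} {inj₁ y} e with numbered-injective {1} {0} e
        ... | () , _

    Tame-model : Tame ∣ M ∣
    Tame-model = (λ m → 1 , ⊥′ , m ∷ []) , λ { refl → refl }

    Tame-Fin : ∀ n → Tame (Lift ℓ (Fin n))
    Tame-Fin n = (λ (lift i) → 0 , tower (toℕ i) , []) , λ {x} {y} e → cong lift (Fin.toℕ-injective (tower-injective (formula e)))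
      where
        formula : ∀ {φ ψ : Form L 0} → _≡_ {A = Formulas} (0 , φ , []) (0 , ψ , []) → φ ≡ ψ
        formula refl = refl

    -- A real-valued function of (n , p) is determined by the comparisons of its
    -- values with the rationals q.
    Tame-samples : Tame (ℕ × List Bool × ℚ)
    Tame-samples = (λ (n , p , q) → 0 , tower n ⇒′ (bits p ⇒′ rational q) , []) , inj
      where
        bit : Bool → Form L 0
        bit false = ⊥′
        bit true  = ⊥′ ⇒′ ⊥′
        bits : List Bool → Form L 0
        bits []      = ⊥′
        bits (b ∷ p) = bit b ⇒′ bits p
        integer : ℤ → Form L 0
        integer (ℤ.+ n)      = ⊥′ ⇒′ tower n
        integer (ℤ.-[1+ n ]) = (⊥′ ⇒′ ⊥′) ⇒′ tower n
        rational : ℚ → Form L 0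
        rational q = integer (ℚ.↥ q) ⇒′ tower (ℚ.↧ₙ q)
        split : ∀ {φ ψ φ′ ψ′ : Form L 0} → φ ⇒′ ψ ≡ φ′ ⇒′ ψ′ → φ ≡ φ′ × ψ ≡ ψ′
        split refl = refl , refl
        formula : ∀ {φ ψ : Form L 0} → _≡_ {A = Formulas} (0 , φ , []) (0 , ψ , []) → φ ≡ ψ
        formula refl = refl
        bit-inj : ∀ {b c} → bit b ≡ bit c → b ≡ c
        bit-inj {false} {false} _ = refl
        bit-inj {true}  {true}  _ = refl
        bits-inj : ∀ {p q} → bits p ≡ bits q → p ≡ q
        bits-inj {[]}    {[]}    _ = refl
        bits-inj {b ∷ p} {c ∷ q} e = let e₁ , e₂ = split e in cong₂ _∷_ (bit-inj e₁) (bits-inj e₂)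
        integer-inj : ∀ {i j} → integer i ≡ integer j → i ≡ j
        integer-inj {ℤ.+ m}      {ℤ.+ n}      e = cong ℤ.+_ (tower-injective (proj₂ (split e)))
        integer-inj {ℤ.-[1+ m ]} {ℤ.-[1+ n ]} e = cong ℤ.-[1+_] (tower-injective (proj₂ (split e)))
        integer-inj {ℤ.+ m}      {ℤ.-[1+ n ]} e with proj₁ (split e)
        ... | ()
        integer-inj {ℤ.-[1+ m ]} {ℤ.+ n}      e with proj₁ (split e)
        ... | ()
        rational-inj : ∀ {p q} → rational p ≡ rational q → p ≡ q
        rational-inj {p} {q} e = let e₁ , e₂ = split e in
          ℚ.≃⇒≡ (ℚ.*≡* (cong₂ ℤ._*_ (integer-inj e₁) (cong ℤ.+_ (sym (tower-injective e₂)))))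
        inj : ∀ {x y} → _≡_ {A = Formulas} _ _ → x ≡ y
        inj {n , p , q} {n′ , p′ , q′} e =
          let e₁ , e₂ = split (formula e) ; e₃ , e₄ = split e₂ in
          cong₂ _,_ (tower-injective e₁) (cong₂ _,_ (bits-inj e₃) (rational-inj e₄))

    truth : ∀ {a} (P : Set a) → Bool
    truth P = isYes (em {P = P})

    truth-true : ∀ {a} {P : Set a} → P → truth P ≡ true
    truth-true {P = P} p with em {P = P}
    ... | yes _ = refl
    ... | no ¬p = ⊥-elim (¬p p)

    truth-false : ∀ {a} {P : Set a} → ¬ P → truth P ≡ false
    truth-false {P = P} ¬p with em {P = P}
    ... | yes p = ⊥-elim (¬p p)
    ... | no _  = refl

    true-truth : ∀ {a} {P : Set a} → truth P ≡ true → P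
    true-truth {P = P} e with em {P = P}
    ... | yes p = p
    true-truth {P = P} () | no _

    private
      true≢false : true ≡ false → ⊥₀
      true≢false ()

      -- The diagonal function `d` is true at `x` when some `u` coded by `x` is false at `x`; its
      -- value at its own code is then contradictory. Injectivity is up to pointwise equality, in
      -- the absence of function extensionality.
      cantor : ∀ (h : (Formulas → Bool) → Formulas) → (∀ {u v} → h u ≡ h v → ∀ x → u x ≡ v x) → ⊥₀
      cantor h h-inj = cases (d (h d)) refl
        where
          d : Formulas → Bool
          d x = truth (∃ λ u → h u ≡ x × u x ≡ false)
          cases : ∀ b → d (h d) ≡ b → ⊥₀
          cases true  e = let u , hu≡ , ux≡false = true-truth e in
            true≢false (trans (sym e) (trans (sym (h-inj hu≡ (h d))) ux≡false))
          cases false e = true≢false (trans (sym (truth-true {P = ∃ λ u → h u ≡ h d × u (h d) ≡ false} (d , refl , e))) e)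

      big : (Formulas → Bool) → κ
      big = Injection.to (proj₁ large)

      big-inj : ∀ {u v} → big u ≡ big v → ∀ x → u x ≡ v x
      big-inj = Injection.injective (proj₁ large)

      point : Formulas → Formulas → Bool
      point x y = truth (x ≡ y)

      point-inj : ∀ {x y} → (∀ z → point x z ≡ point y z) → x ≡ y
      point-inj {x} {y} e = sym (true-truth (trans (sym (e x)) (truth-true refl)))

      -- The disjoint union of two subsets of `Formulas`, made disjoint by the tags 0 and 1. It
      -- embeds the square of the power set in the power set.
      couple : (Formulas → Bool) → (Formulas → Bool) → Formulas → Bool
      couple u v x = truth ((∃ λ y → x ≡ numbered 0 y × u y ≡ true) ⊎ (∃ λ y → x ≡ numbered 1 y × v y ≡ true))

      couple-0 : ∀ u v y → couple u v (numbered 0 y) ≡ u y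
      couple-0 u v y = cases (u y) refl
        where
          cases : ∀ b → u y ≡ b → couple u v (numbered 0 y) ≡ b
          cases true  e = truth-true (inj₁ (y , refl , e))
          cases false e = truth-false λ
            { (inj₁ (z , eq , t)) → true≢false (trans (sym t) (trans (cong u (sym (proj₂ (numbered-injective {0} {0} eq)))) e))
            ; (inj₂ (z , eq , t)) → zero≢one (proj₁ (numbered-injective {0} {1} eq)) }
            where
              zero≢one : 0 ≡ 1 → ⊥₀
              zero≢one ()

      couple-1 : ∀ u v y → couple u v (numbered 1 y) ≡ v y
      couple-1 u v y = cases (v y) refl
        where
          cases : ∀ b → v y ≡ b → couple u v (numbered 1 y) ≡ b
          cases true  e = truth-true (inj₂ (y , refl , e))
          cases false e = truth-false λ
            { (inj₂ (z , eq , t)) → true≢false (trans (sym t) (trans (cong v (sym (proj₂ (numbered-injective {1} {1} eq)))) e))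
            ; (inj₁ (z , eq , t)) → one≢zero (proj₁ (numbered-injective {1} {0} eq)) }
            where
              one≢zero : 1 ≡ 0 → ⊥₀
              one≢zero ()

      couple-inj : ∀ {u v u′ v′} → (∀ x → couple u v x ≡ couple u′ v′ x) → (∀ y → u y ≡ u′ y) × (∀ y → v y ≡ v′ y)
      couple-inj {u} {v} {u′} {v′} e =
        (λ y → trans (sym (couple-0 u v y)) (trans (e _) (couple-0 u′ v′ y))) ,
        (λ y → trans (sym (couple-1 u v y)) (trans (e _) (couple-1 u′ v′ y)))

    -- κ contains the power set of `Formulas`, so an embedding of κ in `A` would embed that power
    -- set in `Formulas`.
    Small-tame : ∀ {A : Set ℓ} → Tame A → Small κ A
    Small-tame (f , f-inj) =
      record { to = λ x → big (point (f x)) ; cong = λ { refl → refl } ; injective = λ e → f-inj (point-inj (big-inj e)) } ,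
      λ j → cantor (λ u → f (Injection.to j (big u))) λ e → big-inj (Injection.injective j (f-inj e))

    -- Hilbert's hotel.
    module _ {A B : Set ℓ} (room : ℕ → A → B) (room-inj : ∀ {m n x y} → room m x ≡ room n y → m ≡ n × x ≡ y) where
      private
        data View : A ⊎ B → Set ℓ where
          guest    : ∀ x → View (inj₁ x)
          occupant : ∀ n x → View (inj₂ (room n x))
          outsider : ∀ y → (∀ n x → ¬ y ≡ room n x) → View (inj₂ y)

        view : ∀ z → View z
        view (inj₁ x) = guest x
        view (inj₂ y) = decide em
          where
            decide : Dec (∃₂ λ n x → y ≡ room n x) → View (inj₂ y)
            decide (yes (n , x , refl)) = occupant n x
            decide (no none)            = outsider y λ n x e → none (n , x , e)

        move : ∀ {z} → View z → B
        move (guest x)      = room 0 x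
        move (occupant n x) = room (suc n) x
        move (outsider y _) = y

        move-inj : ∀ {z z′} (v : View z) (v′ : View z′) → move v ≡ move v′ → z ≡ z′
        move-inj (guest x)      (guest y)      e = cong inj₁ (proj₂ (room-inj e))
        move-inj (guest x)      (occupant n y) e with proj₁ (room-inj e)
        ... | ()
        move-inj (guest x)      (outsider y h) e = ⊥-elim (h 0 x (sym e))
        move-inj (occupant m x) (guest y)      e with proj₁ (room-inj e)
        ... | ()
        move-inj (occupant m x) (occupant n y) e with room-inj e
        ... | refl , refl = refl
        move-inj (occupant m x) (outsider y h) e = ⊥-elim (h (suc m) x (sym e))
        move-inj (outsider x h) (guest y)      e = ⊥-elim (h 0 y e)
        move-inj (outsider x h) (occupant n y) e = ⊥-elim (h (suc n) y e)
        move-inj (outsider x _) (outsider y _) e = cong inj₂ e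

      hotel : Injection (setoid (A ⊎ B)) (setoid B)
      hotel = record { to = λ z → move (view z) ; cong = λ { refl → refl } ; injective = λ {z} {z′} → move-inj (view z) (view z′) }

    -- Suppose κ embeds in `A ⊎ B`. For some `u` all the codes `couple u v` land in `B`, which gives
    -- `B` room for ℕ disjoint copies of `A`; the hotel then absorbs `A` into `B`, and κ would embed
    -- in `B`.
    Small-⊎ : ∀ {A B : Set ℓ} → Tame A → Small κ B → Small κ (A ⊎ B)
    Small-⊎ {A} {B} (f , f-inj) (j , ¬j) =
      record { to = λ z → Injection.to (hotel room room-inj) (Sum.map₂ (Injection.to j) z) ; cong = λ { refl → refl }
             ; injective = λ {x} {y} e → sum-inj x y (Injection.injective (hotel room room-inj) e) } ,
      λ i → absorb i (free i em)
      where
        room : ℕ → A → κ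
        room n x = big (point (numbered n (f x)))
        room-inj : ∀ {m n x y} → room m x ≡ room n y → m ≡ n × x ≡ y
        room-inj e = let m≡n , eq = numbered-injective (point-inj (big-inj e)) in m≡n , f-inj eq
        sum-inj : ∀ x y → Sum.map₂ (Injection.to j) x ≡ Sum.map₂ {A = A} (Injection.to j) y → x ≡ y
        sum-inj (inj₁ x) (inj₁ y) refl = refl
        sum-inj (inj₂ x) (inj₂ y) e = cong inj₂ (Injection.injective j (inj₂-inj e))
          where
            inj₂-inj : ∀ {p q : κ} → _≡_ {A = A ⊎ κ} (inj₂ p) (inj₂ q) → p ≡ q
            inj₂-inj refl = refl
        Free : Injection (setoid κ) (setoid (A ⊎ B)) → Set ℓ
        Free i = ∃ λ u → ∀ v → ∃ λ y → Injection.to i (big (couple u v)) ≡ inj₂ y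
        -- Otherwise u ↦ (the element of A hit by u and some v) would embed 2^Formulas in Formulas.
        free : ∀ i → Dec (Free i) → Free i
        free i (yes h) = h
        free i (no ¬h) = ⊥-elim (cantor (λ u → f (proj₁ (proj₂ (hit u)))) λ {u} {u′} e →
            proj₁ (couple-inj (big-inj (Injection.injective i (trans (proj₂ (proj₂ (hit u))) (trans (cong inj₁ (f-inj e)) (sym (proj₂ (proj₂ (hit u′))))))))))
          where
            hit : ∀ u → ∃₂ λ v x → Injection.to i (big (couple u v)) ≡ inj₁ x
            hit u = decide em
              where
                decide : Dec (∃₂ λ v x → Injection.to i (big (couple u v)) ≡ inj₁ x) → ∃₂ λ v x → Injection.to i (big (couple u v)) ≡ inj₁ x
                decide (yes h) = h
                decide (no ¬k) = ⊥-elim (¬h (u , λ v → side v (Injection.to i (big (couple u v))) refl))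
                  where
                    side : ∀ v z → Injection.to i (big (couple u v)) ≡ z → ∃ λ y → Injection.to i (big (couple u v)) ≡ inj₂ y
                    side v (inj₁ x) e = ⊥-elim (¬k (v , x , e))
                    side v (inj₂ y) e = y , e
        absorb : ∀ i → Free i → ⊥₀
        absorb i (u , right) = ¬j (record { to = λ k → Injection.to h (Injection.to i k) ; cong = λ { refl → refl }
                                          ; injective = λ e → Injection.injective i (Injection.injective h e) })
          where
            room′ : ℕ → A → B
            room′ n x = proj₁ (right (point (numbered n (f x))))
            room′-inj : ∀ {m n x y} → room′ m x ≡ room′ n y → m ≡ n × x ≡ y
            room′-inj {m} {n} {x} {y} e =
              let eq = Injection.injective i (trans (proj₂ (right (point (numbered m (f x))))) (trans (cong inj₂ e) (sym (proj₂ (right (point (numbered n (f y))))))))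
                  m≡n , eq′ = numbered-injective (point-inj (proj₂ (couple-inj {u} {_} {u} (big-inj eq))))
              in m≡n , f-inj eq′
            h = hotel room′ room′-inj

    -- A set whose points are separated by Formulas-many yes-no questions is small;
    -- it is replaced by a subset of κ.
    module _ {a} {X : Set a} (question : X → Formulas → Bool) where
      Answers : Set ℓ
      Answers = ∃ λ k → truth (∃ λ x → big (question x) ≡ k) ≡ true

      answer : X → Answers
      answer x = big (question x) , truth-true (x , refl)

      representative : Answers → X
      representative (k , e) = proj₁ (true-truth e)

      representative-answer : ∀ x y → question (representative (answer x)) y ≡ question x y
      representative-answer x = big-inj (proj₂ (true-truth (proj₂ (answer x))))

      -- Such a set may be as large as the power set of `Formulas`, so this rests on κ being
      -- strictly larger than that power set.
      Small-Answers : Small κ Answers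
      Small-Answers = record { to = proj₁ ; cong = λ { refl → refl } ; injective = λ {x} {y} → proj₁-inj x y } , no-injection
        where
          bool-uip : ∀ {b} (p q : b ≡ true) → p ≡ q
          bool-uip refl refl = refl
          proj₁-inj : ∀ (x y : Answers) → proj₁ x ≡ proj₁ y → x ≡ y
          proj₁-inj (k , p) (.k , q) refl = cong (k ,_) (bool-uip p q)
          no-injection : ¬ Injection (setoid κ) (setoid Answers)
          no-injection i = proj₂ large (record
            { to = λ k → question (representative (Injection.to i k))
            ; cong = λ { refl _ → refl }
            ; injective = λ {k} {k′} e → Injection.injective i (proj₁-inj _ _ (trans (sym (proj₂ (true-truth (proj₂ (Injection.to i k)))))
                (trans (Injection.cong (proj₁ large) e) (proj₂ (true-truth (proj₂ (Injection.to i k′)))))))  })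

-- Rational identities and the interface of a real field

module Reals where

  open import Defs using (ℝ)
  open import Axiom.ExcludedMiddle using (ExcludedMiddle)
  open import Algebra.Bundles using (CommutativeRing; RawRing)
  import Algebra.Solver.Ring
  import Algebra.Solver.Ring.AlmostCommutativeRing as ACR
  open import Data.Maybe.Base using (Maybe; just; nothing)
  open import Data.Nat.Base using (ℕ; zero; suc)
  open import Data.Product.Base using (∃; _×_; _,_)
  open import Data.Rational.Base as ℚ using (ℚ; 0ℚ; 1ℚ; ½)
  import Data.Rational.Properties as ℚ
  open import Data.Sum.Base using (_⊎_; inj₁; inj₂)
  open import Level using (0ℓ)
  open import Relation.Binary.PropositionalEquality.Core as ≡ using (_≡_; refl)
  open import Relation.Nullary using (yes; no)
  open import Relation.Unary using (_∈_; _∉_)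

  record ℚAlgebra : Set₁ where
    field
      commutativeRing : CommutativeRing 0ℓ 0ℓ
    open CommutativeRing commutativeRing public
      renaming (Carrier to R; refl to ≈-refl; sym to ≈-sym; trans to ≈-trans; reflexive to ≈-reflexive)
    field
      fromℚ       : ℚ → R
      fromℚ-0     : fromℚ 0ℚ ≈ 0#
      fromℚ-1     : fromℚ 1ℚ ≈ 1#
      fromℚ-+     : ∀ p q → fromℚ (p ℚ.+ q) ≈ fromℚ p + fromℚ q
      fromℚ-*     : ∀ p q → fromℚ (p ℚ.* q) ≈ fromℚ p * fromℚ q
      fromℚ-neg   : ∀ p → fromℚ (ℚ.- p) ≈ - fromℚ p

    private
      almostCommutativeRing = ACR.fromCommutativeRing commutativeRing

      ℚ-rawRing : RawRing 0ℓ 0ℓ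
      ℚ-rawRing = CommutativeRing.rawRing ℚ.+-*-commutativeRing

      morphism : ℚ-rawRing ACR.-Raw-AlmostCommutative⟶ almostCommutativeRing
      morphism = record
        { ⟦_⟧ = fromℚ ; +-homo = fromℚ-+ ; *-homo = fromℚ-* ; -‿homo = fromℚ-neg
        ; 0-homo = fromℚ-0 ; 1-homo = fromℚ-1 }

      fromℚ-≟ : ∀ p q → Maybe (fromℚ p ≈ fromℚ q)
      fromℚ-≟ p q with p ℚ.≟ q
      ... | yes p≡q = just (≈-reflexive (≡.cong fromℚ p≡q))
      ... | no  _   = nothing

    open Algebra.Solver.Ring ℚ-rawRing almostCommutativeRing morphism fromℚ-≟ public
      using (solve; _:=_; _:+_; _:*_; _:-_; :-_; con)

  ℚ-algebra : ℚAlgebra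
  ℚ-algebra = record
    { commutativeRing = ℚ.+-*-commutativeRing ; fromℚ = λ q → q ; fromℚ-0 = refl ; fromℚ-1 = refl
    ; fromℚ-+ = λ _ _ → refl ; fromℚ-* = λ _ _ → refl ; fromℚ-neg = λ _ → refl }

  -- Identities are checked in an arbitrary algebra, where the operations do not
  -- unfold, and then used for the rationals.  Those named …-gap equate two
  -- differences b − a and d − c, whereby ≤-by derives c ≤ d from a ≤ b.
  module Identities (A : ℚAlgebra) where
    open ℚAlgebra A
    #0 = fromℚ 0ℚ
    #1 = fromℚ 1ℚ
    #½ = fromℚ ½
    [x-x]+y≈y : ∀ a c → (a - a) + c ≈ c
    [x-x]+y≈y = solve 2 (λ a c → (a :- a) :+ c := c) ≈-refl
    [x-y]+y≈x : ∀ d c → (d - c) + c ≈ d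
    [x-y]+y≈x = solve 2 (λ d c → (d :- c) :+ c := d) ≈-refl
    ½x+½x≈x : ∀ e → #½ * e + #½ * e ≈ e
    ½x+½x≈x = solve 1 (λ e → con ½ :* e :+ con ½ :* e := e) ≈-refl
    -x*-x≈x*x : ∀ a → (- a) * (- a) ≈ a * a
    -x*-x≈x*x = solve 1 (λ a → (:- a) :* (:- a) := a :* a) ≈-refl
    +ε-gap : ∀ p e → e - #0 ≈ (p + e) - p
    +ε-gap = solve 2 (λ p e → e :- con 0ℚ := (p :+ e) :- p) ≈-refl
    ≲-trans-gap : ∀ x y z h → ((y + h) + (z + h)) - (x + y) ≈ (z + (h + h)) - x
    ≲-trans-gap = solve 4 (λ x y z h → ((y :+ h) :+ (z :+ h)) :- (x :+ y) := (z :+ (h :+ h)) :- x) ≈-refl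
    ≲-+-gap : ∀ x y u v h → ((y + h) + (v + h)) - (x + u) ≈ ((y + v) + (h + h)) - (x + u)
    ≲-+-gap = solve 5 (λ x y u v h → ((y :+ h) :+ (v :+ h)) :- (x :+ u) := ((y :+ v) :+ (h :+ h)) :- (x :+ u)) ≈-refl
    ≲-neg-gap : ∀ x y e → (y + e) - x ≈ ((- x) + e) - (- y)
    ≲-neg-gap = solve 3 (λ x y e → (y :+ e) :- x := ((:- x) :+ e) :- (:- y)) ≈-refl
    0<b-gap : ∀ u v → (u + v) - (#0 + #0) ≈ (#1 + (u + v)) - #1
    0<b-gap = solve 2 (λ u v → (u :+ v) :- (con 0ℚ :+ con 0ℚ) := (con 1ℚ :+ (u :+ v)) :- con 1ℚ) ≈-refl
    *-nonneg-gap : ∀ x y d e u v → ((x + d) * (y + d) + (e + d * (((#1 - d) + ((u - x) + (v - y)))))) - (#0 + (d * (#1 + (u + v)) + #0)) ≈ (x * y + e) - #0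
    *-nonneg-gap = solve 6 (λ x y d e u v → ((x :+ d) :* (y :+ d) :+ (e :+ d :* (((con 1ℚ :- d) :+ ((u :- x) :+ (v :- y)))))) :- (con 0ℚ :+ (d :* (con 1ℚ :+ (u :+ v)) :+ con 0ℚ)) := (x :* y :+ e) :- con 0ℚ) ≈-refl
    0≤y-x-gap : ∀ a b → b - a ≈ (b - a) - #0
    0≤y-x-gap = solve 2 (λ a b → b :- a := (b :- a) :- con 0ℚ) ≈-refl
    0+[0+0]-gap : ∀ t → t - (#0 + (#0 + #0)) ≈ t - #0
    0+[0+0]-gap = solve 1 (λ t → t :- (con 0ℚ :+ (con 0ℚ :+ con 0ℚ)) := t :- con 0ℚ) ≈-refl
    [a-b]+[c-d]≈[a+c]-[b+d] : ∀ a b c d → (a - b) + (c - d) ≈ (a + c) - (b + d)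
    [a-b]+[c-d]≈[a+c]-[b+d] = solve 4 (λ a b c d → (a :- b) :+ (c :- d) := (a :+ c) :- (b :+ d)) ≈-refl
    [a-b]*c+b*[c-d]≈a*c-b*d : ∀ a b c d → (a - b) * c + b * (c - d) ≈ a * c - b * d
    [a-b]*c+b*[c-d]≈a*c-b*d = solve 4 (λ a b c d → (a :- b) :* c :+ b :* (c :- d) := a :* c :- b :* d) ≈-refl
    *-cauchy-gap : ∀ d e u v → (e + d) - (d * (#1 + (u + v)) + #0) ≈ e - (d * v + u * d)
    *-cauchy-gap = solve 4 (λ d e u v → (e :+ d) :- (d :* (con 1ℚ :+ (u :+ v)) :+ con 0ℚ) := e :- (d :* v :+ u :* d)) ≈-refl
    -[a-b]≈-a-[-b] : ∀ a b → - (a - b) ≈ (- a) - (- b)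
    -[a-b]≈-a-[-b] = solve 2 (λ a b → :- (a :- b) := (:- a) :- (:- b)) ≈-refl
    *-mono-gap : ∀ x x′ z e → ((x′ + (- x)) * z + e) - #0 ≈ (x′ * z + e) - x * z
    *-mono-gap = solve 4 (λ x x′ z e → ((x′ :+ (:- x)) :* z :+ e) :- con 0ℚ := (x′ :* z :+ e) :- x :* z) ≈-refl
    difference-gap : ∀ x x′ e → (x′ + e) - x ≈ (x′ + (- x)) + e - #0
    difference-gap = solve 3 (λ x x′ e → (x′ :+ e) :- x := (x′ :+ (:- x)) :+ e :- con 0ℚ) ≈-refl
    0≤y+c-gap : ∀ y c e → (c + e) - ((- y) + #0) ≈ ((y + c) + e) - #0
    0≤y+c-gap = solve 3 (λ y c e → (c :+ e) :- ((:- y) :+ con 0ℚ) := ((y :+ c) :+ e) :- con 0ℚ) ≈-refl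
    x*y≈x*[y+c]-x*c : ∀ x y c → x * y ≈ x * (y + c) + (- (x * c))
    x*y≈x*[y+c]-x*c = solve 3 (λ x y c → x :* y := x :* (y :+ c) :+ (:- (x :* c))) ≈-refl
    x*[y+c]-x*c≈x*y : ∀ x y c → x * (y + c) + (- (x * c)) ≈ x * y
    x*[y+c]-x*c≈x*y = solve 3 (λ x y c → x :* (y :+ c) :+ (:- (x :* c)) := x :* y) ≈-refl
    ∣∣⇒≤-gap : ∀ a b e → e - (a - b) ≈ (b + e) - a
    ∣∣⇒≤-gap = solve 3 (λ a b e → e :- (a :- b) := (b :+ e) :- a) ≈-refl
    approximation-gap : ∀ a b h → (b + h) - a ≈ (b + (h + h)) - (a + h)
    approximation-gap = solve 3 (λ a b h → (b :+ h) :- a := (b :+ (h :+ h)) :- (a :+ h)) ≈-refl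
    q+[r-q]≈r : ∀ q r → q + (r - q) ≈ r
    q+[r-q]≈r = solve 2 (λ q r → q :+ (r :- q) := r) ≈-refl
    dyadic-mono-gap : ∀ h → h - #0 ≈ (h + h) - h
    dyadic-mono-gap = solve 1 (λ h → h :- con 0ℚ := (h :+ h) :- h) ≈-refl
    dyadic*n-gap : ∀ d n → #½ * (#1 + #1) - #½ * (d + d * n) ≈ #1 - (#½ * d) * (#1 + n)
    dyadic*n-gap = solve 2 (λ d n → con ½ :* (con 1ℚ :+ con 1ℚ) :- con ½ :* (d :+ d :* n) := con 1ℚ :- (con ½ :* d) :* (con 1ℚ :+ n)) ≈-refl
    ≲-total-gap : ∀ xm ym xn yn h e → (xm + ((xn + h) + (ym + h))) - ((ym + e) + (xm + yn)) ≈ (xn + ((h + h) - e)) - yn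
    ≲-total-gap = solve 6 (λ xm ym xn yn h e → (xm :+ ((xn :+ h) :+ (ym :+ h))) :- ((ym :+ e) :+ (xm :+ yn)) := (xn :+ ((h :+ h) :- e)) :- yn) ≈-refl
    [a+[e-e]]-b≈a-b : ∀ a b e → (a + (e - e)) - b ≈ a - b
    [a+[e-e]]-b≈a-b = solve 3 (λ a b e → (a :+ (e :- e)) :- b := a :- b) ≈-refl
    a≈a+0*e : ∀ a e → a ≈ a + #0 * e
    a≈a+0*e = solve 2 (λ a e → a := a :+ con 0ℚ :* e) ≈-refl
    [a+n*e]+e≈a+[1+n]*e : ∀ a n e → (a + n * e) + e ≈ a + (#1 + n) * e
    [a+n*e]+e≈a+[1+n]*e = solve 3 (λ a n e → (a :+ n :* e) :+ e := a :+ (con 1ℚ :+ n) :* e) ≈-refl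
    archimedean-gap : ∀ a b t → t - (b - a) ≈ (a + t) - b
    archimedean-gap = solve 3 (λ a b t → t :- (b :- a) := (a :+ t) :- b) ≈-refl
    ∣a-b∣-gap : ∀ a b e → (b + e) - a ≈ e - (a - b)
    ∣a-b∣-gap = solve 3 (λ a b e → (b :+ e) :- a := e :- (a :- b)) ≈-refl
    ∣b-a∣-gap : ∀ a b e → (a + e) - b ≈ e - (- (a - b))
    ∣b-a∣-gap = solve 3 (λ a b e → (a :+ e) :- b := e :- (:- (a :- b))) ≈-refl

  module Rational where
    open Identities ℚ-algebra

    ≤-by : ∀ {a b c d} → a ℚ.≤ b → b ℚ.- a ≡ d ℚ.- c → c ℚ.≤ d
    ≤-by {a} {b} {c} {d} a≤b eq = ≡.subst₂ ℚ._≤_ (e₁ a c) (≡.trans (≡.cong (ℚ._+ c) eq) (e₂ d c))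
      (ℚ.+-monoˡ-≤ c (ℚ.+-monoˡ-≤ (ℚ.- a) a≤b))
      where
        e₁ : ∀ a c → (a ℚ.- a) ℚ.+ c ≡ c
        e₁ = [x-x]+y≈y
        e₂ : ∀ d c → (d ℚ.- c) ℚ.+ c ≡ d
        e₂ = [x-y]+y≈x

    half-pos : ∀ {ε} → 0ℚ ℚ.< ε → 0ℚ ℚ.< ½ ℚ.* ε
    half-pos {ε} 0<ε = ≡.subst (ℚ._< ½ ℚ.* ε) (ℚ.*-zeroʳ ½) (ℚ.*-monoʳ-<-pos ½ 0<ε)

    halves : ∀ ε → ½ ℚ.* ε ℚ.+ ½ ℚ.* ε ≡ ε
    halves = ½x+½x≈x

    *-nonneg : ∀ {a b} → 0ℚ ℚ.≤ a → 0ℚ ℚ.≤ b → 0ℚ ℚ.≤ a ℚ.* b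
    *-nonneg {a} {b} 0≤a 0≤b = ≡.subst (ℚ._≤ a ℚ.* b) (ℚ.*-zeroʳ a)
      (ℚ.*-monoˡ-≤-nonNeg a {{ℚ.nonNegative 0≤a}} 0≤b)

    sq-nonneg : ∀ a → 0ℚ ℚ.≤ a ℚ.* a
    sq-nonneg a with ℚ.≤-total 0ℚ a
    ... | inj₁ 0≤a = *-nonneg 0≤a 0≤a
    ... | inj₂ a≤0 = ≡.subst (0ℚ ℚ.≤_) (e a) (*-nonneg (ℚ.neg-antimono-≤ a≤0) (ℚ.neg-antimono-≤ a≤0))
      where
        e : ∀ a → (ℚ.- a) ℚ.* (ℚ.- a) ≡ a ℚ.* a
        e = -x*-x≈x*x

    shrink : ∀ {b ε} → 0ℚ ℚ.< b → 0ℚ ℚ.< ε → ∃ λ δ → 0ℚ ℚ.< δ × δ ℚ.≤ 1ℚ × δ ℚ.* b ℚ.≤ ε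
    shrink {b} {ε} 0<b 0<ε = δ , 0<δ , ℚ.p⊓q≤q r 1ℚ , ℚ.≤-trans δb≤rb (ℚ.≤-reflexive rb≡ε)
      where
        instance
          b⁺ : ℚ.Positive b
          b⁺ = ℚ.positive 0<b
          b≠0 : ℚ.NonZero b
          b≠0 = ℚ.pos⇒nonZero b
          b⁻¹⁺ : ℚ.Positive (ℚ.1/ b)
          b⁻¹⁺ = ℚ.1/pos⇒pos b
        r = ε ℚ.* (ℚ.1/ b)
        δ = r ℚ.⊓ 1ℚ
        0<r : 0ℚ ℚ.< r
        0<r = ≡.subst (ℚ._< r) (ℚ.*-zeroˡ (ℚ.1/ b)) (ℚ.*-monoˡ-<-pos (ℚ.1/ b) 0<ε)
        0<δ : 0ℚ ℚ.< δ
        0<δ with ℚ.≤-total r 1ℚ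
        ... | inj₁ r≤1 = ≡.subst (0ℚ ℚ.<_) (≡.sym (ℚ.p≤q⇒p⊓q≡p r≤1)) 0<r
        ... | inj₂ 1≤r = ≡.subst (0ℚ ℚ.<_) (≡.sym (ℚ.p≥q⇒p⊓q≡q 1≤r)) (ℚ.positive⁻¹ 1ℚ)
        δb≤rb : δ ℚ.* b ℚ.≤ r ℚ.* b
        δb≤rb = ℚ.*-monoʳ-≤-nonNeg b {{ℚ.pos⇒nonNeg b}} (ℚ.p⊓q≤p r 1ℚ)
        rb≡ε : r ℚ.* b ≡ ε
        rb≡ε = ≡.trans (ℚ.*-assoc ε (ℚ.1/ b) b)
                 (≡.trans (≡.cong (ε ℚ.*_) (ℚ.*-inverseˡ b)) (ℚ.*-identityʳ ε))

    fromℕ : ℕ → ℚ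
    fromℕ zero    = 0ℚ
    fromℕ (suc n) = 1ℚ ℚ.+ fromℕ n

  -- Completeness takes the form of `fromCut`, through which the values of the mean enter;
  -- `≤-closed` and `approx` express that the rationals are dense. The carrier lies in `Set`, unlike
  -- the cuts, which keeps weighted combinations of points at the level of the points.
  record RealField : Set₁ where
    field
      algebra : ℚAlgebra
    open ℚAlgebra algebra public
    infix 4 _≤_
    field
      _≤_         : R → R → Set
      ≤-reflexive : ∀ {x y} → x ≈ y → x ≤ y
      ≤-trans     : ∀ {x y z} → x ≤ y → y ≤ z → x ≤ z
      ≤-antisym   : ∀ {x y} → x ≤ y → y ≤ x → x ≈ y
      ≤-total     : ∀ x y → x ≤ y ⊎ y ≤ x
      +-mono-≤    : ∀ {x y u v} → x ≤ y → u ≤ v → x + u ≤ y + v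
      *-nonneg    : ∀ {x y} → 0# ≤ x → 0# ≤ y → 0# ≤ x * y
      fromℚ-mono  : ∀ {p q} → p ℚ.≤ q → fromℚ p ≤ fromℚ q
      fromℚ-cancel : ∀ {p q} → fromℚ p ≤ fromℚ q → p ℚ.≤ q
      ≤-closed    : ∀ {x y} → (∀ ε → 0ℚ ℚ.< ε → x ≤ y + fromℚ ε) → x ≤ y
      approx      : ∀ x ε → 0ℚ ℚ.< ε → ∃ λ q → x ≤ fromℚ q × fromℚ q ≤ x + fromℚ ε
      fromCut     : ∀ (c : ℝ) → ∃ λ x → (∀ {q} → q ∈ ℝ.lower c → fromℚ q ≤ x) ×
                                        (∀ {q} → q ∉ ℝ.lower c → x ≤ fromℚ q)

open Reals using (RealField)

-- The real field of Cauchy sequences of rationals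

module Cauchy where

  open import Defs using (ℝ)
  open import Axiom.ExcludedMiddle using (ExcludedMiddle)
  open import Algebra.Bundles using (CommutativeRing)
  open import Data.Empty using (⊥-elim)
  open import Data.Nat.Base as ℕ using (ℕ; zero; suc)
  import Data.Nat.Properties as ℕ
  import Data.Integer.Base as ℤ
  import Data.Integer.Properties as ℤ
  import Data.Nat.Coprimality as C
  import Data.Rational.Unnormalised.Base as ℚᵘ
  import Data.Rational.Unnormalised.Properties as ℚᵘ
  open import Data.Product.Base using (∃; _×_; _,_; proj₁; proj₂)
  open import Data.Rational.Base as ℚ using (ℚ; 0ℚ; 1ℚ; ½)
  import Data.Rational.Properties as ℚ
  open import Data.Sum.Base using (_⊎_; inj₁; inj₂)
  open import Level using (0ℓ)
  open import Relation.Binary.Definitions using (tri<; tri≈; tri>)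
  open import Relation.Binary.PropositionalEquality.Core as ≡ using (_≡_; refl)
  open import Relation.Nullary using (¬_; Dec; yes; no)
  open import Relation.Unary using (_∈_; _∉_)
  open Reals
  open Rational
  open Identities ℚ-algebra

  Eventually : (ℕ → Set) → Set
  Eventually P = ∃ λ N → ∀ n → N ℕ.≤ n → P n

  always : ∀ {P} → (∀ n → P n) → Eventually P
  always p = 0 , λ n _ → p n

  map₂ : ∀ {P Q S : ℕ → Set} → (∀ n → P n → Q n → S n) → Eventually P → Eventually Q → Eventually S
  map₂ f (M , p) (N , q) = M ℕ.⊔ N , λ n le →
    f n (p n (ℕ.≤-trans (ℕ.m≤m⊔n M N) le)) (q n (ℕ.≤-trans (ℕ.m≤n⊔m M N) le))

  infix 4 _≲_
  record _≲_ (x y : ℕ → ℚ) : Set where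
    constructor lim
    field at : ∀ ε → 0ℚ ℚ.< ε → Eventually λ n → x n ℚ.≤ y n ℚ.+ ε
  open _≲_

  ε-add : ∀ {p ε} → 0ℚ ℚ.< ε → p ℚ.≤ p ℚ.+ ε
  ε-add {p} {ε} 0<ε = ≤-by (ℚ.<⇒≤ 0<ε) (+ε-gap p ε)

  ≤⇒≲ : ∀ {x y} → (∀ n → x n ℚ.≤ y n) → x ≲ y
  ≤⇒≲ le = lim λ ε 0<ε → always λ n → ℚ.≤-trans (le n) (ε-add 0<ε)

  ≡⇒≲ : ∀ {x y} → (∀ n → x n ≡ y n) → x ≲ y
  ≡⇒≲ e = ≤⇒≲ λ n → ℚ.≤-reflexive (e n)

  ≲-trans : ∀ {x y z} → x ≲ y → y ≲ z → x ≲ z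
  ≲-trans {x} {y} {z} (lim p) (lim q) = lim λ ε 0<ε → map₂ (λ n a b → ≤-by (ℚ.+-mono-≤ a b)
      (≡.trans (≲-trans-gap (x n) (y n) (z n) (½ ℚ.* ε))
        (≡.cong (λ t → (z n ℚ.+ t) ℚ.- x n) (halves ε))))
    (p (½ ℚ.* ε) (half-pos 0<ε)) (q (½ ℚ.* ε) (half-pos 0<ε))

  ≲-+ : ∀ {x y u v} → x ≲ y → u ≲ v → (λ n → x n ℚ.+ u n) ≲ (λ n → y n ℚ.+ v n)
  ≲-+ {x} {y} {u} {v} (lim p) (lim q) = lim λ ε 0<ε → map₂ (λ n a b → ≤-by (ℚ.+-mono-≤ a b)
      (≡.trans (≲-+-gap (x n) (y n) (u n) (v n) (½ ℚ.* ε))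
        (≡.cong (λ t → ((y n ℚ.+ v n) ℚ.+ t) ℚ.- (x n ℚ.+ u n)) (halves ε))))
    (p (½ ℚ.* ε) (half-pos 0<ε)) (q (½ ℚ.* ε) (half-pos 0<ε))

  ≲-neg : ∀ {x y} → x ≲ y → (λ n → ℚ.- y n) ≲ (λ n → ℚ.- x n)
  ≲-neg {x} {y} (lim p) = lim λ ε 0<ε → let N , h = p ε 0<ε in N , λ n le → ≤-by (h n le)
    (≲-neg-gap (x n) (y n) ε)

  BoundedBy : ℚ → (ℕ → ℚ) → Set
  BoundedBy B x = Eventually λ n → ℚ.∣ x n ∣ ℚ.≤ B

  ≤∣∣ : ∀ a → a ℚ.≤ ℚ.∣ a ∣
  ≤∣∣ a with ℚ.≤-total 0ℚ a
  ... | inj₁ 0≤a = ℚ.≤-reflexive (≡.sym (ℚ.0≤p⇒∣p∣≡p 0≤a))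
  ... | inj₂ a≤0 = ℚ.≤-trans a≤0 (ℚ.0≤∣p∣ a)

  ∣∣≤ : ∀ {a b} → a ℚ.≤ b → ℚ.- a ℚ.≤ b → ℚ.∣ a ∣ ℚ.≤ b
  ∣∣≤ {a} {b} p q with ℚ.∣p∣≡p∨∣p∣≡-p a
  ... | inj₁ e = ≡.subst (ℚ._≤ b) (≡.sym e) p
  ... | inj₂ e = ≡.subst (ℚ._≤ b) (≡.sym e) q

  ∣*∣≤ : ∀ {a b c d} → ℚ.∣ a ∣ ℚ.≤ c → ℚ.∣ b ∣ ℚ.≤ d → ℚ.∣ a ℚ.* b ∣ ℚ.≤ c ℚ.* d
  ∣*∣≤ {a} {b} {c} {d} p q = ≡.subst (ℚ._≤ c ℚ.* d) (≡.sym (ℚ.∣p*q∣≡∣p∣*∣q∣ a b))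
    (ℚ.≤-trans (ℚ.*-monoʳ-≤-nonNeg ℚ.∣ b ∣ {{ℚ.nonNegative (ℚ.0≤∣p∣ b)}} p)
               (ℚ.*-monoˡ-≤-nonNeg c {{ℚ.nonNegative (ℚ.≤-trans (ℚ.0≤∣p∣ a) p)}} q))

  ≲-*-nonneg : ∀ {x y B C} → BoundedBy B x → BoundedBy C y → (λ _ → 0ℚ) ≲ x → (λ _ → 0ℚ) ≲ y →
               (λ _ → 0ℚ) ≲ (λ n → x n ℚ.* y n)
  ≲-*-nonneg {x} {y} {B} {C} bx by (lim p) (lim q) = lim λ ε 0<ε → result ε 0<ε
    where
    module _ (ε : ℚ) (0<ε : 0ℚ ℚ.< ε) where
      b = 1ℚ ℚ.+ (ℚ.∣ B ∣ ℚ.+ ℚ.∣ C ∣)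
      0<b : 0ℚ ℚ.< b
      0<b = ℚ.<-≤-trans (ℚ.positive⁻¹ 1ℚ) (≤-by (ℚ.+-mono-≤ (ℚ.0≤∣p∣ B) (ℚ.0≤∣p∣ C))
        (0<b-gap ℚ.∣ B ∣ ℚ.∣ C ∣))
      δs = shrink 0<b 0<ε
      δ = proj₁ δs
      0<δ = proj₁ (proj₂ δs)
      δ≤1 = proj₁ (proj₂ (proj₂ δs))
      δb≤ε = proj₂ (proj₂ (proj₂ δs))
      -- (x + δ)(y + δ) ≥ 0, and δ(x + y + δ) ≤ ε.
      step : ∀ n → (ℚ.∣ x n ∣ ℚ.≤ B) × (ℚ.∣ y n ∣ ℚ.≤ C) →
             (0ℚ ℚ.≤ x n ℚ.+ δ) × (0ℚ ℚ.≤ y n ℚ.+ δ) → 0ℚ ℚ.≤ x n ℚ.* y n ℚ.+ ε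
      step n (xB , yC) (x≥ , y≥) = ≤-by (ℚ.+-mono-≤ (*-nonneg x≥ y≥) (ℚ.+-mono-≤ δb≤ε (*-nonneg (ℚ.<⇒≤ 0<δ) gap)))
        (*-nonneg-gap
           (x n) (y n) δ ε ℚ.∣ B ∣ ℚ.∣ C ∣)
        where
          sub : ∀ {a b} → a ℚ.≤ b → 0ℚ ℚ.≤ b ℚ.- a
          sub {a} {b} h = ≤-by h (0≤y-x-gap a b)
          gap : 0ℚ ℚ.≤ (1ℚ ℚ.- δ) ℚ.+ ((ℚ.∣ B ∣ ℚ.- x n) ℚ.+ (ℚ.∣ C ∣ ℚ.- y n))
          gap = ≤-by (ℚ.+-mono-≤ (sub δ≤1) (ℚ.+-mono-≤ (sub (ℚ.≤-trans (≤∣∣ _) (ℚ.≤-trans xB (≤∣∣ B))))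
                                                       (sub (ℚ.≤-trans (≤∣∣ _) (ℚ.≤-trans yC (≤∣∣ C))))))
            (0+[0+0]-gap ((1ℚ ℚ.- δ) ℚ.+ ((ℚ.∣ B ∣ ℚ.- x n) ℚ.+ (ℚ.∣ C ∣ ℚ.- y n))))
      result = map₂ step (map₂ (λ _ → _,_) bx by) (map₂ (λ _ → _,_) (p δ 0<δ) (q δ 0<δ))

  record Real : Set where
    no-eta-equality
    constructor mk
    field
      seq    : ℕ → ℚ
      cauchy : ∀ ε → 0ℚ ℚ.< ε → ∃ λ N → ∀ m n → N ℕ.≤ m → N ℕ.≤ n → ℚ.∣ seq m ℚ.- seq n ∣ ℚ.≤ ε
  open Real

  ∣∣-triangle : ∀ {a b c ε δ} → ℚ.∣ a ℚ.- b ∣ ℚ.≤ ε → ℚ.∣ c ∣ ℚ.≤ δ → ℚ.∣ (a ℚ.- b) ℚ.+ c ∣ ℚ.≤ ε ℚ.+ δ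
  ∣∣-triangle {a} {b} {c} p q = ℚ.≤-trans (ℚ.∣p+q∣≤∣p∣+∣q∣ (a ℚ.- b) c) (ℚ.+-mono-≤ p q)

  bounded : ∀ x → ∃ λ B → BoundedBy B (seq x)
  bounded x = let N , h = cauchy x 1ℚ (ℚ.positive⁻¹ 1ℚ) in
    1ℚ ℚ.+ ℚ.∣ seq x N ∣ , N , λ n le → ≡.subst (λ t → ℚ.∣ t ∣ ℚ.≤ 1ℚ ℚ.+ ℚ.∣ seq x N ∣)
      ([x-y]+y≈x (seq x n) (seq x N))
      (∣∣-triangle {seq x n} {seq x N} (h n N le ℕ.≤-refl) ℚ.≤-refl)

  const : ℚ → Real
  const q = mk (λ _ → q) λ ε 0<ε → 0 , λ _ _ _ _ →
    ≡.subst (λ t → ℚ.∣ t ∣ ℚ.≤ ε) (≡.sym (ℚ.+-inverseʳ q)) (ℚ.<⇒≤ 0<ε)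

  private
    both : ∀ {M N n} → M ℕ.⊔ N ℕ.≤ n → M ℕ.≤ n × N ℕ.≤ n
    both {M} {N} le = ℕ.≤-trans (ℕ.m≤m⊔n M N) le , ℕ.≤-trans (ℕ.m≤n⊔m M N) le

  _+′_ _*′_ : Real → Real → Real
  x +′ y = mk (λ n → seq x n ℚ.+ seq y n) λ ε 0<ε →
    let M , p = cauchy x (½ ℚ.* ε) (half-pos 0<ε) ; N , q = cauchy y (½ ℚ.* ε) (half-pos 0<ε) in
    M ℕ.⊔ N , λ m n lm ln →
      ≡.subst₂ (λ t e → ℚ.∣ t ∣ ℚ.≤ e)
        ([a-b]+[c-d]≈[a+c]-[b+d] (seq x m) (seq x n) (seq y m) (seq y n))
        (halves ε)
        (∣∣-triangle {seq x m} {seq x n} (p m n (proj₁ (both lm)) (proj₁ (both ln)))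
                     (q m n (proj₂ (both {M} lm)) (proj₂ (both {M} ln))))
  x *′ y = mk (λ n → seq x n ℚ.* seq y n) λ ε 0<ε →
    let B , M , p = bounded x
        C , N , q = bounded y
        0<b : 0ℚ ℚ.< 1ℚ ℚ.+ (ℚ.∣ B ∣ ℚ.+ ℚ.∣ C ∣)
        0<b = ℚ.<-≤-trans (ℚ.positive⁻¹ 1ℚ) (≤-by (ℚ.+-mono-≤ (ℚ.0≤∣p∣ B) (ℚ.0≤∣p∣ C))
          (0<b-gap ℚ.∣ B ∣ ℚ.∣ C ∣))
        δ , 0<δ , _ , δb≤ε = shrink 0<b 0<ε
        M′ , p′ = cauchy x δ 0<δ
        N′ , q′ = cauchy y δ 0<δ
    in (M ℕ.⊔ N) ℕ.⊔ (M′ ℕ.⊔ N′) , λ m n lm ln →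
      let lm₁ = proj₁ (both {M ℕ.⊔ N} lm) ; lm₂ = proj₂ (both {M ℕ.⊔ N} lm)
          ln₁ = proj₁ (both {M ℕ.⊔ N} ln) ; ln₂ = proj₂ (both {M ℕ.⊔ N} ln)
          u = ∣*∣≤ {seq x m ℚ.- seq x n} {seq y m} (p′ m n (proj₁ (both lm₂)) (proj₁ (both ln₂)))
                (ℚ.≤-trans (q m (proj₂ (both {M} lm₁))) (≤∣∣ C))
          v = ∣*∣≤ {seq x n} {seq y m ℚ.- seq y n} (ℚ.≤-trans (p n (proj₁ (both ln₁))) (≤∣∣ B))
                (q′ m n (proj₂ (both {M′} lm₂)) (proj₂ (both {M′} ln₂)))
      in ℚ.≤-trans (≡.subst (λ t → ℚ.∣ t ∣ ℚ.≤ δ ℚ.* ℚ.∣ C ∣ ℚ.+ ℚ.∣ B ∣ ℚ.* δ)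
            ([a-b]*c+b*[c-d]≈a*c-b*d (seq x m) (seq x n) (seq y m) (seq y n))
            (ℚ.≤-trans (ℚ.∣p+q∣≤∣p∣+∣q∣ ((seq x m ℚ.- seq x n) ℚ.* seq y m) (seq x n ℚ.* (seq y m ℚ.- seq y n))) (ℚ.+-mono-≤ u v)))
          (≤-by (ℚ.+-mono-≤ δb≤ε (ℚ.<⇒≤ 0<δ))
            (*-cauchy-gap δ ε ℚ.∣ B ∣ ℚ.∣ C ∣))

  -′_ : Real → Real
  -′ x = mk (λ n → ℚ.- seq x n) λ ε 0<ε → let N , h = cauchy x ε 0<ε in
    N , λ m n lm ln → ≡.subst (ℚ._≤ ε)
      (≡.trans (≡.sym (ℚ.∣-p∣≡∣p∣ (seq x m ℚ.- seq x n)))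
        (≡.cong ℚ.∣_∣ (-[a-b]≈-a-[-b] (seq x m) (seq x n)))) (h m n lm ln)

  infix 4 _≃_
  record _≃_ (x y : Real) : Set where
    constructor squeeze
    field
      below : seq x ≲ seq y
      above : seq y ≲ seq x
  open _≃_

  ≡⇒≃ : ∀ {x y} → (∀ n → seq x n ≡ seq y n) → x ≃ y
  ≡⇒≃ e = squeeze (≡⇒≲ e) (≡⇒≲ (λ n → ≡.sym (e n)))

  *′-mono : ∀ {x x′} z → (λ _ → 0ℚ) ≲ seq z → seq x ≲ seq x′ → seq (x *′ z) ≲ seq (x′ *′ z)
  *′-mono {x} {x′} z 0≤z x≤x′ = lim λ ε 0<ε →
    let N , h = at (≲-*-nonneg (proj₂ (bounded (x′ +′ (-′ x)))) (proj₂ (bounded z)) diff 0≤z) ε 0<ε in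
    N , λ n le → ≤-by (h n le)
      (*-mono-gap (seq x n) (seq x′ n) (seq z n) ε)
    where
      diff : (λ _ → 0ℚ) ≲ seq (x′ +′ (-′ x))
      diff = lim λ ε 0<ε → let N , h = at x≤x′ ε 0<ε in N , λ n le → ≤-by (h n le)
        (difference-gap (seq x n) (seq x′ n) ε)

  -- Monotonicity is available for nonnegative factors only, so `y` is written as (y + c) - c, where
  -- c is a bound for |y| and both parts are nonnegative.
  *′-congʳ : ∀ {x x′} y → x ≃ x′ → (x *′ y) ≃ (x′ *′ y)
  *′-congʳ {x} {x′} y (squeeze p q) = squeeze (half {x} {x′} p q) (half {x′} {x} q p)
    where
      C = proj₁ (bounded y)
      c = const ℚ.∣ C ∣
      0≤y+c : (λ _ → 0ℚ) ≲ seq (y +′ c)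
      0≤y+c = lim λ ε 0<ε → let N , h = proj₂ (bounded y) in N , λ n le →
        ≤-by (ℚ.+-mono-≤ (ℚ.≤-trans (ℚ.≤-trans (≤∣∣ (ℚ.- seq y n)) (ℚ.≤-reflexive (ℚ.∣-p∣≡∣p∣ (seq y n)))) (ℚ.≤-trans (h n le) (≤∣∣ C))) (ℚ.<⇒≤ 0<ε))
          (0≤y+c-gap (seq y n) ℚ.∣ C ∣ ε)
      half : ∀ {x x′} → seq x ≲ seq x′ → seq x′ ≲ seq x → seq (x *′ y) ≲ seq (x′ *′ y)
      half {x} {x′} p q = ≲-trans {y = step x} (≡⇒≲ λ n → x*y≈x*[y+c]-x*c (seq x n) (seq y n) ℚ.∣ C ∣)
        (≲-trans {y = step x′} (≲-+ (*′-mono {x} {x′} (y +′ c) 0≤y+c p) (≲-neg (*′-mono {x′} {x} c (≤⇒≲ λ _ → ℚ.0≤∣p∣ C) q)))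
          (≡⇒≲ λ n → x*[y+c]-x*c≈x*y (seq x′ n) (seq y n) ℚ.∣ C ∣))
        where
          step : Real → ℕ → ℚ
          step x n = seq (x *′ (y +′ c)) n ℚ.+ (ℚ.- seq (x *′ c) n)

  ≃-trans : ∀ {x y z} → x ≃ y → y ≃ z → x ≃ z
  ≃-trans (squeeze p q) (squeeze r s) = squeeze (≲-trans p r) (≲-trans s q)

  *′-cong : ∀ {x x′ y y′} → x ≃ x′ → y ≃ y′ → (x *′ y) ≃ (x′ *′ y′)
  *′-cong {x} {x′} {y} {y′} p q = ≃-trans {x *′ y} {x′ *′ y} {x′ *′ y′} (*′-congʳ {x} {x′} y p)
    (≃-trans {x′ *′ y} {y *′ x′} {x′ *′ y′} (≡⇒≃ {x′ *′ y} {y *′ x′} λ n → ℚ.*-comm (seq x′ n) (seq y n))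
      (≃-trans {y *′ x′} {y′ *′ x′} {x′ *′ y′} (*′-congʳ {y} {y′} x′ q) (≡⇒≃ {y′ *′ x′} {x′ *′ y′} λ n → ℚ.*-comm (seq y′ n) (seq x′ n))))

  real-commutativeRing : CommutativeRing 0ℓ 0ℓ
  real-commutativeRing = record
    { Carrier = Real ; _≈_ = _≃_ ; _+_ = _+′_ ; _*_ = _*′_ ; -_ = -′_ ; 0# = const 0ℚ ; 1# = const 1ℚ
    ; isCommutativeRing = record
      { isRing = record
        { +-isAbelianGroup = record
          { isGroup = record
            { isMonoid = record
              { isSemigroup = record
                { isMagma = record
                  { isEquivalence = record
                    { refl = ≡⇒≃ λ _ → refl ; sym = λ (squeeze p q) → squeeze q p ; trans = λ {x} {y} {z} → ≃-trans {x} {y} {z} }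
                  ; ∙-cong = λ (squeeze p q) (squeeze r s) → squeeze (≲-+ p r) (≲-+ q s) }
                ; assoc = λ x y z → ≡⇒≃ λ n → ℚ.+-assoc (seq x n) (seq y n) (seq z n) }
              ; identity = (λ x → ≡⇒≃ λ n → ℚ.+-identityˡ (seq x n)) , (λ x → ≡⇒≃ λ n → ℚ.+-identityʳ (seq x n)) }
            ; inverse = (λ x → ≡⇒≃ λ n → ℚ.+-inverseˡ (seq x n)) , (λ x → ≡⇒≃ λ n → ℚ.+-inverseʳ (seq x n))
            ; ⁻¹-cong = λ (squeeze p q) → squeeze (≲-neg q) (≲-neg p) }
          ; comm = λ x y → ≡⇒≃ λ n → ℚ.+-comm (seq x n) (seq y n) }
        ; *-cong = λ {x} {x′} {y} {y′} → *′-cong {x} {x′} {y} {y′}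
        ; *-assoc = λ x y z → ≡⇒≃ λ n → ℚ.*-assoc (seq x n) (seq y n) (seq z n)
        ; *-identity = (λ x → ≡⇒≃ λ n → ℚ.*-identityˡ (seq x n)) , (λ x → ≡⇒≃ λ n → ℚ.*-identityʳ (seq x n))
        ; distrib = (λ x y z → ≡⇒≃ λ n → ℚ.*-distribˡ-+ (seq x n) (seq y n) (seq z n))
                  , (λ x y z → ≡⇒≃ λ n → ℚ.*-distribʳ-+ (seq x n) (seq y n) (seq z n)) }
      ; *-comm = λ x y → ≡⇒≃ λ n → ℚ.*-comm (seq x n) (seq y n) } }

  ∣∣⇒≤ : ∀ {a b ε} → ℚ.∣ a ℚ.- b ∣ ℚ.≤ ε → a ℚ.≤ b ℚ.+ ε
  ∣∣⇒≤ {a} {b} {ε} h = ≤-by (ℚ.≤-trans (≤∣∣ (a ℚ.- b)) h) (∣∣⇒≤-gap a b ε)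

  approximation : ∀ x ε → 0ℚ ℚ.< ε → ∃ λ q → seq x ≲ seq (const q) × seq (const q) ≲ seq (x +′ const ε)
  approximation x ε 0<ε = let N , h = cauchy x (½ ℚ.* ε) (half-pos 0<ε) in
    seq x N ℚ.+ ½ ℚ.* ε ,
    lim (λ δ 0<δ → N , λ n le → ℚ.≤-trans (∣∣⇒≤ {seq x n} {seq x N} (h n N le ℕ.≤-refl)) (ε-add 0<δ)) ,
    lim (λ δ 0<δ → N , λ n le → ℚ.≤-trans (≤-by {c = seq x N ℚ.+ ½ ℚ.* ε} {d = seq x n ℚ.+ ε} (∣∣⇒≤ {seq x N} {seq x n} (h N n ℕ.≤-refl le))
      (≡.trans (approximation-gap (seq x N) (seq x n) (½ ℚ.* ε))
        (≡.cong (λ t → (seq x n ℚ.+ t) ℚ.- (seq x N ℚ.+ ½ ℚ.* ε)) (halves ε)))) (ε-add 0<δ))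

  ≲-closed : ∀ {x y} → (∀ ε → 0ℚ ℚ.< ε → x ≲ (λ n → y n ℚ.+ ε)) → x ≲ y
  ≲-closed {x} {y} h = lim λ ε 0<ε →
    let N , k = at (h (½ ℚ.* ε) (half-pos 0<ε)) (½ ℚ.* ε) (half-pos 0<ε) in
    N , λ n le → ≡.subst (x n ℚ.≤_) (≡.trans (ℚ.+-assoc (y n) _ _) (≡.cong (y n ℚ.+_) (halves ε))) (k n le)

  const-cancel : ∀ {p q} → (λ _ → p) ≲ (λ _ → q) → p ℚ.≤ q
  const-cancel {p} {q} (lim h) = ℚ.≮⇒≥ λ q<p →
    let r , q<r , r<p = ℚ.<-dense q<p
        N , k = h (r ℚ.- q) (≡.subst (ℚ._< r ℚ.- q) (ℚ.+-inverseʳ q) (ℚ.+-monoˡ-< (ℚ.- q) q<r))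
    in ℚ.<-irrefl refl (ℚ.<-≤-trans r<p (≡.subst (p ℚ.≤_) (q+[r-q]≈r q r) (k N ℕ.≤-refl)))

  private
    nat : ℕ → ℚ
    nat n = ℚ.mkℚ (ℤ.+ n) 0 (C.sym (C.1-coprimeTo n))

    nat-suc : ∀ n → nat (suc n) ≡ 1ℚ ℚ.+ nat n
    nat-suc n = ℚ.toℚᵘ-injective (ℚᵘ.≃-sym (ℚᵘ.≃-trans (ℚ.toℚᵘ-homo-+ 1ℚ (nat n))
      (ℚᵘ.*≡* (≡.cong (ℤ._* ℤ.1ℤ) (≡.cong (ℤ._+_ ℤ.1ℤ) (ℤ.*-identityʳ (ℤ.+ n)))))))

    fromℕ≡nat : ∀ n → fromℕ n ≡ nat n
    fromℕ≡nat zero    = ℚ.≃⇒≡ (ℚ.*≡* refl)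
    fromℕ≡nat (suc n) = ≡.trans (≡.cong (1ℚ ℚ.+_) (fromℕ≡nat n)) (≡.sym (nat-suc n))

  ≤-fromℕ : ∀ q → ∃ λ n → q ℚ.≤ fromℕ n
  ≤-fromℕ q = n , ≡.subst (q ℚ.≤_) (≡.sym (fromℕ≡nat n)) (ℚ.*≤* (ℤ.≤-trans
      (ℤ.≤-reflexive (ℤ.*-identityʳ (ℚ.↥ q)))
      (ℤ.≤-trans (≤+∣∣ (ℚ.↥ q)) (≡.subst (ℤ.+ n ℤ.≤_) (ℤ.pos-* n (ℚ.↧ₙ q)) (ℤ.+≤+ (ℕ.m≤m*n n (ℚ.↧ₙ q)))))))
    where
      n = ℤ.∣ ℚ.↥ q ∣
      ≤+∣∣ : ∀ i → i ℤ.≤ ℤ.+ ℤ.∣ i ∣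
      ≤+∣∣ (ℤ.+ _)      = ℤ.≤-refl
      ≤+∣∣ (ℤ.-[1+ _ ]) = ℤ.-≤+

  archimedean : ∀ {ε} b → 0ℚ ℚ.< ε → ∃ λ n → b ℚ.≤ fromℕ n ℚ.* ε
  archimedean {ε} b 0<ε = let n , h = ≤-fromℕ (b ℚ.* ℚ.1/ ε) in
    n , ≡.subst (ℚ._≤ fromℕ n ℚ.* ε)
          (≡.trans (ℚ.*-assoc b (ℚ.1/ ε) ε) (≡.trans (≡.cong (b ℚ.*_) (ℚ.*-inverseˡ ε)) (ℚ.*-identityʳ b)))
          (ℚ.*-monoʳ-≤-nonNeg ε {{ℚ.pos⇒nonNeg ε}} h)
    where
      instance
        ε⁺ : ℚ.Positive ε
        ε⁺ = ℚ.positive 0<ε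
        ε≠0 : ℚ.NonZero ε
        ε≠0 = ℚ.pos⇒nonZero ε

  dyadic : ℕ → ℚ
  dyadic zero    = 1ℚ
  dyadic (suc n) = ½ ℚ.* dyadic n

  0<dyadic : ∀ n → 0ℚ ℚ.< dyadic n
  0<dyadic zero    = ℚ.positive⁻¹ 1ℚ
  0<dyadic (suc n) = half-pos (0<dyadic n)

  dyadic-mono : ∀ {m n} → m ℕ.≤ n → dyadic n ℚ.≤ dyadic m
  dyadic-mono {m} le = go (ℕ.≤⇒≤′ le)
    where
      go : ∀ {n} → m ℕ.≤′ n → dyadic n ℚ.≤ dyadic m
      go ℕ.≤′-refl = ℚ.≤-refl
      go {suc n} (ℕ.≤′-step h) = ℚ.≤-trans
        (≤-by (ℚ.<⇒≤ (half-pos (0<dyadic n)))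
          (≡.trans (dyadic-mono-gap (½ ℚ.* dyadic n)) (≡.cong (ℚ._- ½ ℚ.* dyadic n) (halves (dyadic n))))) (go h)

  dyadic-small : ∀ {ε} → 0ℚ ℚ.< ε → ∃ λ n → dyadic n ℚ.≤ ε
  dyadic-small {ε} 0<ε = let n , h = archimedean 1ℚ 0<ε in n , ℚ.≤-trans (stretch n h) (contract n)
    where
      dn≤1 : ∀ n → dyadic n ℚ.* fromℕ n ℚ.≤ 1ℚ
      dn≤1 zero    = ≡.subst (ℚ._≤ 1ℚ) (≡.sym (ℚ.*-zeroʳ 1ℚ)) (ℚ.<⇒≤ (ℚ.positive⁻¹ 1ℚ))
      dn≤1 (suc n) = ≤-by (ℚ.*-monoˡ-≤-nonNeg ½ (ℚ.+-mono-≤ (dyadic-mono {zero} {n} ℕ.z≤n) (dn≤1 n)))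
        (dyadic*n-gap (dyadic n) (fromℕ n))
      stretch : ∀ n → 1ℚ ℚ.≤ fromℕ n ℚ.* ε → dyadic n ℚ.≤ dyadic n ℚ.* (fromℕ n ℚ.* ε)
      stretch n h = ≡.subst (ℚ._≤ dyadic n ℚ.* (fromℕ n ℚ.* ε)) (ℚ.*-identityʳ (dyadic n))
        (ℚ.*-monoˡ-≤-nonNeg (dyadic n) {{ℚ.nonNegative (ℚ.<⇒≤ (0<dyadic n))}} h)
      contract : ∀ n → dyadic n ℚ.* (fromℕ n ℚ.* ε) ℚ.≤ ε
      contract n = ≡.subst₂ ℚ._≤_ (ℚ.*-assoc (dyadic n) (fromℕ n) ε) (ℚ.*-identityˡ ε)
        (ℚ.*-monoʳ-≤-nonNeg ε {{ℚ.nonNegative (ℚ.<⇒≤ 0<ε)}} (dn≤1 n))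

  module _ (em : ∀ {a} → ExcludedMiddle a) where

    -- If x ≲ y fails by ε, then x exceeds y by ε at arbitrarily late indices. Past the point where
    -- each sequence varies by at most ε/2, one such index forces y ≤ x at all later ones.
    ≲-total : ∀ x y → seq x ≲ seq y ⊎ seq y ≲ seq x
    ≲-total x y with em {P = ∃ λ ε → 0ℚ ℚ.< ε × ¬ Eventually λ n → seq x n ℚ.≤ seq y n ℚ.+ ε}
    ... | no  none = inj₁ (lim λ ε 0<ε → dec ε 0<ε em)
      where
        dec : ∀ ε → 0ℚ ℚ.< ε → Dec (Eventually λ n → seq x n ℚ.≤ seq y n ℚ.+ ε) → Eventually λ n → seq x n ℚ.≤ seq y n ℚ.+ ε
        dec ε 0<ε (yes p) = p
        dec ε 0<ε (no ¬p) = ⊥-elim (none (ε , 0<ε , ¬p))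
    ... | yes (ε , 0<ε , often) = inj₂ (lim λ δ 0<δ → N , λ n le → ℚ.≤-trans (y≤x n le) (ε-add 0<δ))
      where
        cx = cauchy x (½ ℚ.* ε) (half-pos 0<ε)
        cy = cauchy y (½ ℚ.* ε) (half-pos 0<ε)
        N = proj₁ cx ℕ.⊔ proj₁ cy
        find : Dec (∃ λ m → N ℕ.≤ m × seq y m ℚ.+ ε ℚ.< seq x m) → ∃ λ m → N ℕ.≤ m × seq y m ℚ.+ ε ℚ.< seq x m
        find (yes p) = p
        find (no ¬p) = ⊥-elim (often (N , λ n le → ℚ.≮⇒≥ λ lt → ¬p (n , le , lt)))
        m = proj₁ (find em)
        N≤m = proj₁ (proj₂ (find em))
        y≤x : ∀ n → N ℕ.≤ n → seq y n ℚ.≤ seq x n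
        y≤x n le = ≤-by {c = seq y n} {d = seq x n} (ℚ.+-mono-≤ (ℚ.<⇒≤ (proj₂ (proj₂ (find em))))
            (ℚ.+-mono-≤ (∣∣⇒≤ {seq x m} {seq x n} (proj₂ cx m n (proj₁ (both N≤m)) (proj₁ (both le))))
                        (∣∣⇒≤ {seq y n} {seq y m} (proj₂ cy n m (proj₂ (both {proj₁ cx} le)) (proj₂ (both {proj₁ cx} N≤m))))))
          (≡.trans (≲-total-gap
                     (seq x m) (seq y m) (seq x n) (seq y n) (½ ℚ.* ε) ε)
            (≡.trans (≡.cong (λ t → (seq x n ℚ.+ (t ℚ.- ε)) ℚ.- seq y n) (halves ε))
              ([a+[e-e]]-b≈a-b (seq x n) (seq y n) ε)))

    -- The points a + kε start inside the cut and, by the Archimedean property, end outside it, so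
    -- two neighbours among them lie on different sides.
    straddle : ∀ (c : ℝ) ε → 0ℚ ℚ.< ε → ∃ λ q → q ∈ ℝ.lower c × (q ℚ.+ ε) ∉ ℝ.lower c
    straddle c ε 0<ε = search n top
      where
        a = proj₁ (ℝ.nonempty c)
        b = proj₁ (ℝ.bounded c)
        n = proj₁ (archimedean (b ℚ.- a) 0<ε)
        search : ∀ n → (a ℚ.+ fromℕ n ℚ.* ε) ∉ ℝ.lower c → ∃ λ q → q ∈ ℝ.lower c × (q ℚ.+ ε) ∉ ℝ.lower c
        search zero    ∉c = ⊥-elim (∉c (≡.subst (_∈ ℝ.lower c) (a≈a+0*e a ε) (proj₂ (ℝ.nonempty c))))
        search (suc n) ∉c with em {P = (a ℚ.+ fromℕ n ℚ.* ε) ∈ ℝ.lower c}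
        ... | yes ∈c = a ℚ.+ fromℕ n ℚ.* ε , ∈c , λ h → ∉c (≡.subst (_∈ ℝ.lower c)
                ([a+n*e]+e≈a+[1+n]*e a (fromℕ n) ε) h)
        ... | no  ∉′ = search n ∉′
        top : (a ℚ.+ fromℕ n ℚ.* ε) ∉ ℝ.lower c
        top h with ℚ.<-cmp b (a ℚ.+ fromℕ n ℚ.* ε)
        ... | tri< lt _ _ = proj₂ (ℝ.bounded c) (ℝ.down c lt h)
        ... | tri≈ _ e _  = proj₂ (ℝ.bounded c) (≡.subst (_∈ ℝ.lower c) (≡.sym e) h)
        ... | tri> _ _ gt = ℚ.<-irrefl refl (ℚ.<-≤-trans gt
                (≤-by (proj₂ (archimedean (b ℚ.- a) 0<ε)) (archimedean-gap a b (fromℕ n ℚ.* ε))))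

    cut-≤ : ∀ (c : ℝ) {p q} → p ∈ ℝ.lower c → q ∉ ℝ.lower c → p ℚ.≤ q
    cut-≤ c p∈ q∉ = ℚ.≮⇒≥ λ q<p → q∉ (ℝ.down c q<p p∈)

    real-fromCut : ∀ (c : ℝ) → ∃ λ x → (∀ {q} → q ∈ ℝ.lower c → (λ _ → q) ≲ seq x) ×
                                        (∀ {q} → q ∉ ℝ.lower c → seq x ≲ (λ _ → q))
    real-fromCut c = mk s s-cauchy , (λ q∈ → lower q∈) , (λ q∉ → ≤⇒≲ λ n → cut-≤ c (s∈ n) q∉)
      where
        s : ℕ → ℚ
        s n = proj₁ (straddle c (dyadic n) (0<dyadic n))
        s∈ : ∀ n → s n ∈ ℝ.lower c
        s∈ n = proj₁ (proj₂ (straddle c (dyadic n) (0<dyadic n)))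
        s∉ : ∀ n → (s n ℚ.+ dyadic n) ∉ ℝ.lower c
        s∉ n = proj₂ (proj₂ (straddle c (dyadic n) (0<dyadic n)))
        close : ∀ m n → s m ℚ.≤ s n ℚ.+ dyadic n
        close m n = cut-≤ c (s∈ m) (s∉ n)
        within : ∀ {k ε} → dyadic k ℚ.≤ ε → ∀ n → k ℕ.≤ n → ∀ {p} → p ∈ ℝ.lower c → p ℚ.≤ s n ℚ.+ ε
        within h n le p∈ = ℚ.≤-trans (cut-≤ c p∈ (s∉ n)) (ℚ.+-monoʳ-≤ (s n) (ℚ.≤-trans (dyadic-mono le) h))
        s-cauchy : ∀ ε → 0ℚ ℚ.< ε → ∃ λ N → ∀ m n → N ℕ.≤ m → N ℕ.≤ n → ℚ.∣ s m ℚ.- s n ∣ ℚ.≤ ε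
        s-cauchy ε 0<ε = let k , h = dyadic-small 0<ε in k , λ m n lm ln →
          ∣∣≤ (≤-by (within h n ln (s∈ m)) (∣a-b∣-gap (s m) (s n) ε))
              (≤-by (within h m lm (s∈ n)) (∣b-a∣-gap (s m) (s n) ε))
        lower : ∀ {q} → q ∈ ℝ.lower c → (λ _ → q) ≲ s
        lower q∈ = lim λ ε 0<ε → let k , h = dyadic-small 0<ε in k , λ n le → within h n le q∈

    realField : RealField
    realField = record
      { algebra = record
        { commutativeRing = real-commutativeRing ; fromℚ = const
        ; fromℚ-0 = ≡⇒≃ λ _ → refl ; fromℚ-1 = ≡⇒≃ λ _ → refl
        ; fromℚ-+ = λ _ _ → ≡⇒≃ λ _ → refl ; fromℚ-* = λ _ _ → ≡⇒≃ λ _ → refl ; fromℚ-neg = λ _ → ≡⇒≃ λ _ → refl }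
      ; _≤_ = λ x y → seq x ≲ seq y
      ; ≤-reflexive = below
      ; ≤-trans = ≲-trans
      ; ≤-antisym = squeeze
      ; ≤-total = ≲-total
      ; +-mono-≤ = ≲-+
      ; *-nonneg = λ {x} {y} → ≲-*-nonneg (proj₂ (bounded x)) (proj₂ (bounded y))
      ; fromℚ-mono = λ p≤q → ≤⇒≲ λ _ → p≤q
      ; fromℚ-cancel = const-cancel
      ; ≤-closed = ≲-closed
      ; approx = approximation
      ; fromCut = real-fromCut }

-- Order estimates, finite averages and positive semidefinite kernels

module Averages where

  open Reals
  open Cauchy using (archimedean)
  open import Axiom.ExcludedMiddle using (ExcludedMiddle)
  open import Data.Empty using (⊥-elim)
  open import Data.List.Base using (List; []; _∷_; _++_)
  open import Data.Nat.Base using (ℕ; zero; suc)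
  open import Data.Product.Base using (∃; _×_; _,_; proj₁; proj₂)
  open import Data.Rational.Base as ℚ using (ℚ; 0ℚ; 1ℚ; ½)
  import Data.Rational.Properties as ℚ
  open import Data.Sum.Base using (inj₁; inj₂)
  open import Level using (Level)
  open import Relation.Binary.PropositionalEquality.Core as ≡ using (_≡_; refl)
  open import Relation.Nullary using (¬_; yes; no)

  module Order (ℱ : RealField) where
    open RealField ℱ

    half quarter : R
    half = fromℚ ½
    quarter = fromℚ (½ ℚ.* ½)

    ≤-refl : ∀ {x} → x ≤ x
    ≤-refl = ≤-reflexive ≈-refl

    ≤-respʳ : ∀ {x y z} → y ≈ z → x ≤ y → x ≤ z
    ≤-respʳ y≈z x≤y = ≤-trans x≤y (≤-reflexive y≈z)

    ≤-respˡ : ∀ {x y z} → x ≈ z → x ≤ y → z ≤ y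
    ≤-respˡ x≈z x≤y = ≤-trans (≤-reflexive (≈-sym x≈z)) x≤y

    ≤-by : ∀ {a b c d} → a ≤ b → b - a ≈ d - c → c ≤ d
    ≤-by {a} {b} {c} {d} a≤b eq =
      ≤-respˡ (solve 2 (λ a c → (a :+ (:- a)) :+ c := c) ≈-refl a c)
        (≤-respʳ (≈-trans (+-cong eq ≈-refl) (solve 2 (λ d c → (d :- c) :+ c := d) ≈-refl d c))
          (+-mono-≤ (+-mono-≤ a≤b ≤-refl) ≤-refl))

    0≤⇒≤ : ∀ {x y} → 0# ≤ y - x → x ≤ y
    0≤⇒≤ {x} {y} h = ≤-by h (≈-trans (+-cong ≈-refl (≈-sym neg0)) (solve 2 (λ x y → (y :- x) :+ con 0ℚ := y :- x) ≈-refl x y))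
      where
        neg0 : fromℚ 0ℚ ≈ - 0#
        neg0 = ≈-trans (solve 0 (con 0ℚ := :- con 0ℚ) ≈-refl) (-‿cong fromℚ-0)

    ≤⇒0≤ : ∀ {x y} → x ≤ y → 0# ≤ y - x
    ≤⇒0≤ {x} {y} h = ≤-respˡ (-‿inverseʳ x) (+-mono-≤ h ≤-refl)

    *-monoˡ : ∀ {a x y} → 0# ≤ a → x ≤ y → a * x ≤ a * y
    *-monoˡ {a} {x} {y} 0≤a x≤y = 0≤⇒≤ (≤-respʳ (solve 3 (λ a x y → a :* (y :- x) := a :* y :- a :* x) ≈-refl a x y)
      (*-nonneg 0≤a (≤⇒0≤ x≤y)))

    neg-nonneg : ∀ {x} → x ≤ 0# → 0# ≤ - x
    neg-nonneg {x} h = ≤-respʳ (+-identityˡ (- x)) (≤⇒0≤ h)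

    sq : R → R
    sq x = x * x

    sq-cong : ∀ {x y} → x ≈ y → sq x ≈ sq y
    sq-cong e = *-cong e e

    sq-nonneg : ∀ x → 0# ≤ sq x
    sq-nonneg x with ≤-total 0# x
    ... | inj₁ 0≤x = *-nonneg 0≤x 0≤x
    ... | inj₂ x≤0 = ≤-respʳ (solve 1 (λ x → (:- x) :* (:- x) := x :* x) ≈-refl x)
                       (*-nonneg (neg-nonneg x≤0) (neg-nonneg x≤0))

    fromℚ-nonneg : ∀ {q} → 0ℚ ℚ.≤ q → 0# ≤ fromℚ q
    fromℚ-nonneg h = ≤-respˡ fromℚ-0 (fromℚ-mono h)

    0≤1 : 0# ≤ 1#
    0≤1 = ≤-respʳ fromℚ-1 (fromℚ-nonneg (ℚ.<⇒≤ (ℚ.positive⁻¹ 1ℚ)))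

    0≤half : 0# ≤ half
    0≤half = fromℚ-nonneg (ℚ.<⇒≤ (ℚ.positive⁻¹ ½))

    fromℚ-cancel-* : ∀ {ε x y} → 0ℚ ℚ.< ε → fromℚ ε * x ≤ fromℚ ε * y → x ≤ y
    fromℚ-cancel-* {ε} {x} {y} 0<ε h = ≤-respˡ (inv x) (≤-respʳ (inv y) (*-monoˡ (fromℚ-nonneg 0≤ε⁻¹) h))
      where
        instance
          ε⁺ : ℚ.Positive ε
          ε⁺ = ℚ.positive 0<ε
          ε≠0 : ℚ.NonZero ε
          ε≠0 = ℚ.pos⇒nonZero ε
        0≤ε⁻¹ : 0ℚ ℚ.≤ ℚ.1/ ε
        0≤ε⁻¹ = ℚ.<⇒≤ (ℚ.positive⁻¹ (ℚ.1/ ε) {{ℚ.1/pos⇒pos ε}})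
        inv : ∀ z → fromℚ (ℚ.1/ ε) * (fromℚ ε * z) ≈ z
        inv z = ≈-trans (≈-sym (*-assoc _ _ _)) (≈-trans (*-cong (≈-trans (≈-sym (fromℚ-* (ℚ.1/ ε) ε))
          (≈-trans (≈-reflexive (≡.cong fromℚ (ℚ.*-inverseˡ ε))) fromℚ-1)) ≈-refl) (*-identityˡ z))

    sq≤1 : ∀ {x} → 0# ≤ x → x ≤ 1# → sq x ≤ 1#
    sq≤1 {x} 0≤x x≤1 = ≤-trans (*-monoˡ 0≤x x≤1) (≤-respˡ (≈-sym (*-identityʳ x)) x≤1)

    -- Strict positivity, witnessed by a rational because the interface has only the weak order.
    record Pos (x : R) : Set where
      constructor pos
      field
        bound   : ℚ
        0<bound : 0ℚ ℚ.< bound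
        bound≤  : fromℚ bound ≤ x

    Pos-fromℚ : ∀ {q} → 0ℚ ℚ.< q → Pos (fromℚ q)
    Pos-fromℚ {q} 0<q = pos q 0<q ≤-refl

    Pos-mono : ∀ {x y} → x ≤ y → Pos x → Pos y
    Pos-mono x≤y (pos q 0<q h) = pos q 0<q (≤-trans h x≤y)

    Pos⇒0≤ : ∀ {x} → Pos x → 0# ≤ x
    Pos⇒0≤ (pos q 0<q h) = ≤-trans (fromℚ-nonneg (ℚ.<⇒≤ 0<q)) h

    ¬Pos-0 : ¬ Pos 0#
    ¬Pos-0 (pos q 0<q h) = ℚ.<-irrefl refl (ℚ.<-≤-trans 0<q (fromℚ-cancel (≤-respʳ (≈-sym fromℚ-0) h)))

    Pos-* : ∀ {x y} → Pos x → Pos y → Pos (x * y)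
    Pos-* {x} {y} px@(pos p 0<p hp) py@(pos q 0<q hq) = pos (p ℚ.* q)
      (ℚ.positive⁻¹ (p ℚ.* q) {{ℚ.pos*pos⇒pos p {{ℚ.positive 0<p}} q {{ℚ.positive 0<q}}}})
      (≤-respˡ (≈-sym (fromℚ-* p q)) (≤-trans (*-monoˡ (Pos⇒0≤ (Pos-fromℚ 0<p)) hq)
        (≤-respˡ (*-comm y (fromℚ p)) (≤-respʳ (*-comm y x) (*-monoˡ (Pos⇒0≤ py) hp)))))

    Pos-half : Pos half
    Pos-half = Pos-fromℚ (ℚ.positive⁻¹ ½)

    *-cancel : ∀ {t x y} → Pos t → t * x ≤ t * y → x ≤ y
    *-cancel {t} {x} {y} (pos q 0<q h) tx≤ty with ≤-total x y
    ... | inj₁ x≤y = x≤y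
    ... | inj₂ y≤x = fromℚ-cancel-* 0<q (≤-by (+-mono-≤ tx≤ty (*-monoˡ (≤⇒0≤ y≤x) h))
        (solve 4 (λ t q x y → (t :* y :+ (x :- y) :* t) :- (t :* x :+ (x :- y) :* q) := q :* y :- q :* x) ≈-refl t (fromℚ q) x y))

    ≤-closed⁺ : ∀ {x y} → (∀ e → Pos e → x ≤ y + e) → x ≤ y
    ≤-closed⁺ h = ≤-closed λ ε 0<ε → h (fromℚ ε) (Pos-fromℚ 0<ε)

    -- An infimum up to δ. Steps of length δ downwards from a member of `A` become negative after
    -- finitely many, where `A` fails; so some step leaves `A`, and `q` is the point where it lands.
    nearMinimum-ℚ : (∀ {a} → ExcludedMiddle a) → ∀ {a} (A : R → Set a) →
                  (∀ {r s} → r ≈ s → A r → A s) → (∀ r → A r → 0# ≤ r) → ∃ A →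
                  ∀ δ → 0ℚ ℚ.< δ → ∃ λ q → A (q + fromℚ δ) × ¬ A q
    nearMinimum-ℚ em A resp nonneg (r , Ar) δ 0<δ = search (suc n) top
      where
        b = proj₁ (approx r 1ℚ (ℚ.positive⁻¹ 1ℚ))
        n = proj₁ (archimedean b 0<δ)
        step : ℕ → R
        step k = r - fromℚ (Rational.fromℕ k ℚ.* δ)
        search : ∀ k → ¬ A (step k) → ∃ λ q → A (q + fromℚ δ) × ¬ A q
        search zero ¬A = ⊥-elim (¬A (resp (≈-trans (solve 1 (λ r → r := r :- con 0ℚ) ≈-refl r)
          (+-cong ≈-refl (-‿cong (≈-reflexive (≡.cong fromℚ (≡.sym (ℚ.*-zeroˡ δ))))))) Ar))
        search (suc k) ¬A with em {P = A (step k)}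
        ... | yes Ak = step (suc k) , resp eq Ak , ¬A
          where
            eq : step k ≈ step (suc k) + fromℚ δ
            eq = ≈-trans (solve 3 (λ r t d → r :- t := (r :- (d :+ t)) :+ d) ≈-refl r (fromℚ (Rational.fromℕ k ℚ.* δ)) (fromℚ δ))
              (+-cong (+-cong ≈-refl (-‿cong (≈-trans (≈-sym (fromℚ-+ _ _)) (≈-reflexive (≡.cong fromℚ
                (≡.sym (≡.trans (ℚ.*-distribʳ-+ δ 1ℚ (Rational.fromℕ k)) (≡.cong (ℚ._+ Rational.fromℕ k ℚ.* δ) (ℚ.*-identityˡ δ))))))))) ≈-refl)
        ... | no ¬Ak = search k ¬Ak
        top : ¬ A (step (suc n))
        top h = ℚ.<-irrefl refl (ℚ.<-≤-trans 0<δ (fromℚ-cancel (≤-by (+-mono-≤ (nonneg _ h) (+-mono-≤ (proj₁ (proj₂ (approx r 1ℚ (ℚ.positive⁻¹ 1ℚ)))) (fromℚ-mono (proj₂ (archimedean b 0<δ)))))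
          (≈-trans (+-cong (+-cong (+-cong ≈-refl (-‿cong (≈-trans (≈-reflexive (≡.cong fromℚ (≡.trans (ℚ.*-distribʳ-+ δ 1ℚ (Rational.fromℕ n)) (≡.cong (ℚ._+ Rational.fromℕ n ℚ.* δ) (ℚ.*-identityˡ δ))))) (fromℚ-+ _ _)))) ≈-refl) (-‿cong (+-cong (≈-sym fromℚ-0) ≈-refl)))
            (solve 4 (λ r b t d → ((r :- (d :+ t)) :+ (b :+ t)) :- (con 0ℚ :+ (r :+ b)) := con 0ℚ :- d) ≈-refl r (fromℚ b) (fromℚ (Rational.fromℕ n ℚ.* δ)) (fromℚ δ))))))

    abstract
      nearMinimum : (∀ {a} → ExcludedMiddle a) → ∀ {a} (A : R → Set a) →
                    (∀ {r s} → r ≤ s → A r → A s) → (∀ r → A r → 0# ≤ r) → ∃ A →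
                    ∀ {δ} → Pos δ → ∃ λ q → A (q + δ) × ¬ A q
      nearMinimum em A mono nonneg ∃A (pos d 0<d d≤δ) =
        let q , Aq , ¬Aq = nearMinimum-ℚ em A (λ r≈s → mono (≤-reflexive r≈s)) nonneg ∃A d 0<d
        in q , mono (+-mono-≤ ≤-refl d≤δ) Aq , ¬Aq

  -- Probability measures with finite support and dyadic weights.
  data Mix {a} (A : Set a) : Set a where
    leaf : A → Mix A
    mid  : Mix A → Mix A → Mix A

  mapᴹ : ∀ {a b} {A : Set a} {B : Set b} → (A → B) → Mix A → Mix B
  mapᴹ f (leaf x)  = leaf (f x)
  mapᴹ f (mid μ ν) = mid (mapᴹ f μ) (mapᴹ f ν)

  module Averaging (ℱ : RealField) where
    open RealField ℱ
    open Order ℱ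

    private
      variable
        a b : Level
        A B : Set a

    Comb : Set a → Set a
    Comb A = List (R × A)

    I : Comb A → (A → R) → R
    I []            φ = 0#
    I ((r , x) ∷ α) φ = r * φ x + I α φ

    I-cong : ∀ (α : Comb A) {φ ψ} → (∀ x → φ x ≈ ψ x) → I α φ ≈ I α ψ
    I-cong []            e = ≈-refl
    I-cong ((r , x) ∷ α) e = +-cong (*-cong ≈-refl (e x)) (I-cong α e)

    I-++ : ∀ (α β : Comb A) φ → I (α ++ β) φ ≈ I α φ + I β φ
    I-++ []            β φ = ≈-sym (+-identityˡ _)
    I-++ ((r , x) ∷ α) β φ = ≈-trans (+-cong ≈-refl (I-++ α β φ)) (≈-sym (+-assoc _ _ _))

    I-+ : ∀ (α : Comb A) φ ψ → I α (λ x → φ x + ψ x) ≈ I α φ + I α ψ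
    I-+ []            φ ψ = ≈-sym (+-identityˡ _)
    I-+ ((r , x) ∷ α) φ ψ = ≈-trans (+-cong ≈-refl (I-+ α φ ψ))
      (solve 5 (λ r p q s t → r :* (p :+ q) :+ (s :+ t) := (r :* p :+ s) :+ (r :* q :+ t)) ≈-refl r (φ x) (ψ x) (I α φ) (I α ψ))

    I-* : ∀ (α : Comb A) c φ → I α (λ x → c * φ x) ≈ c * I α φ
    I-* []            c φ = ≈-sym (zeroʳ c)
    I-* ((r , x) ∷ α) c φ = ≈-trans (+-cong ≈-refl (I-* α c φ))
      (solve 4 (λ r c p s → r :* (c :* p) :+ c :* s := c :* (r :* p :+ s)) ≈-refl r c (φ x) (I α φ))

    reweight : (R → A → R × B) → Comb A → Comb B
    reweight f []            = []
    reweight f ((r , x) ∷ α) = f r x ∷ reweight f α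

    I-reweight : ∀ (w : A → R) (f : A → B) α φ →
                 I (reweight (λ r x → r * w x , f x) α) φ ≈ I α (λ x → w x * φ (f x))
    I-reweight w f []            φ = ≈-refl
    I-reweight w f ((r , x) ∷ α) φ = +-cong (*-assoc _ _ _) (I-reweight w f α φ)

    PSD : (A → A → R) → Set _
    PSD {A = A} ϑ = ∀ (α : Comb A) → 0# ≤ I α (λ s → I α (λ t → ϑ s t))

    PSD-weighted : ∀ {ϑ : B → B → R} (w : A → R) (f : A → B) → PSD ϑ → PSD (λ s t → w s * (w t * ϑ (f s) (f t)))
    PSD-weighted {ϑ = ϑ} w f psd α = ≤-respʳ
      (≈-trans (I-reweight w f α _) (I-cong α λ s → ≈-trans (*-cong ≈-refl (I-reweight w f α _)) (≈-sym (I-* α (w s) _))))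
      (psd (reweight (λ r x → r * w x , f x) α))

    PSD-+ : ∀ {ϑ ϑ′ : A → A → R} → PSD ϑ → PSD ϑ′ → PSD (λ s t → ϑ s t + ϑ′ s t)
    PSD-+ p q α = ≤-respˡ (+-identityˡ 0#) (≤-respʳ (≈-sym (≈-trans (I-cong α λ s → I-+ α _ _) (I-+ α _ _))) (+-mono-≤ (p α) (q α)))

    PSD-* : ∀ {ϑ : A → A → R} c → 0# ≤ c → PSD ϑ → PSD (λ s t → c * ϑ s t)
    PSD-* c 0≤c p α = ≤-respʳ (≈-sym (≈-trans (I-cong α λ s → I-* α c _) (I-* α c _))) (*-nonneg 0≤c (p α))

    PSD-cong : ∀ {ϑ ϑ′ : A → A → R} → (∀ s t → ϑ s t ≈ ϑ′ s t) → PSD ϑ → PSD ϑ′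
    PSD-cong e p α = ≤-respʳ (I-cong α λ s → I-cong α λ t → e s t) (p α)

    PSD-1 : PSD {A = A} (λ _ _ → 1#)
    PSD-1 α = ≤-respʳ (≈-sym (≈-trans (I-cong α λ _ → ≈-sym (*-identityʳ s)) (I-* α s (λ _ → 1#)))) (sq-nonneg s)
      where
        s = I α (λ _ → 1#)

    E : Mix A → (A → R) → R
    E (leaf x)  φ = φ x
    E (mid μ ν) φ = half * (E μ φ + E ν φ)

    E-cong : ∀ (μ : Mix A) {φ ψ} → (∀ x → φ x ≈ ψ x) → E μ φ ≈ E μ ψ
    E-cong (leaf x)  e = e x
    E-cong (mid μ ν) e = *-cong ≈-refl (+-cong (E-cong μ e) (E-cong ν e))

    E-mono : ∀ (μ : Mix A) {φ ψ} → (∀ x → φ x ≤ ψ x) → E μ φ ≤ E μ ψ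
    E-mono (leaf x)  e = e x
    E-mono (mid μ ν) e = *-monoˡ 0≤half (+-mono-≤ (E-mono μ e) (E-mono ν e))

    E-const : ∀ (μ : Mix A) c → E μ (λ _ → c) ≈ c
    E-const (leaf x)  c = ≈-refl
    E-const (mid μ ν) c = ≈-trans (*-cong ≈-refl (+-cong (E-const μ c) (E-const ν c)))
      (solve 1 (λ c → con ½ :* (c :+ c) := c) ≈-refl c)

    E-+ : ∀ (μ : Mix A) φ ψ → E μ (λ x → φ x + ψ x) ≈ E μ φ + E μ ψ
    E-+ (leaf x)  φ ψ = ≈-refl
    E-+ (mid μ ν) φ ψ = ≈-trans (*-cong ≈-refl (+-cong (E-+ μ φ ψ) (E-+ ν φ ψ)))
      (solve 4 (λ p q r s → con ½ :* ((p :+ q) :+ (r :+ s)) := con ½ :* (p :+ r) :+ con ½ :* (q :+ s)) ≈-refl _ _ _ _)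

    E-* : ∀ (μ : Mix A) c φ → E μ (λ x → c * φ x) ≈ c * E μ φ
    E-* (leaf x)  c φ = ≈-refl
    E-* (mid μ ν) c φ = ≈-trans (*-cong ≈-refl (+-cong (E-* μ c φ) (E-* ν c φ)))
      (solve 3 (λ c p q → con ½ :* (c :* p :+ c :* q) := c :* (con ½ :* (p :+ q))) ≈-refl _ _ _)

    E-swap : ∀ (μ : Mix A) (ν : Mix B) (φ : A → B → R) → E μ (λ x → E ν (φ x)) ≈ E ν (λ y → E μ (λ x → φ x y))
    E-swap (leaf x)  ν φ = ≈-refl
    E-swap (mid μ μ′) ν φ = ≈-trans (*-cong ≈-refl (≈-trans (+-cong (E-swap μ ν φ) (E-swap μ′ ν φ)) (≈-sym (E-+ ν _ _)))) (≈-sym (E-* ν half _))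

    E-map : ∀ (f : A → B) μ φ → E (mapᴹ f μ) φ ≈ E μ (λ x → φ (f x))
    E-map f (leaf x)  φ = ≈-refl
    E-map f (mid μ ν) φ = *-cong ≈-refl (+-cong (E-map f μ φ) (E-map f ν φ))

    toComb : Mix A → Comb A
    toComb (leaf x)  = (1# , x) ∷ []
    toComb (mid μ ν) = reweight (λ r x → r * half , x) (toComb μ ++ toComb ν)

    I-toComb : ∀ (μ : Mix A) φ → I (toComb μ) φ ≈ E μ φ
    I-toComb (leaf x)  φ = ≈-trans (+-identityʳ _) (*-identityˡ _)
    I-toComb (mid μ ν) φ = ≈-trans (I-reweight (λ _ → half) (λ x → x) (toComb μ ++ toComb ν) φ)
      (≈-trans (I-* (toComb μ ++ toComb ν) half φ) (*-cong ≈-refl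
        (≈-trans (I-++ (toComb μ) (toComb ν) φ) (+-cong (I-toComb μ φ) (I-toComb ν φ)))))

    -- ‖ μ - ν - t u ‖² ≥ 0, expanded.
    PSD-difference : ∀ {K : A → A → R} → PSD K → (∀ s t → K s t ≈ K t s) → ∀ μ ν t u →
      0# ≤ (E μ (λ x → E μ (K x)) - (E μ (λ x → E ν (K x)) + E μ (λ x → E ν (K x))) + E ν (λ x → E ν (K x)))
           - (t + t) * (E μ (λ x → K x u) - E ν (λ x → K x u)) + sq t * K u u
    PSD-difference {A = A} {K} psd symm μ ν t u = ≤-respʳ expand (psd α)
      where
        α : Comb A
        α = toComb μ ++ (reweight (λ r x → r * (- 1#) , x) (toComb ν) ++ ((- t , u) ∷ []))
        Λ : (A → R) → R
        Λ φ = E μ φ + ((- 1#) * E ν φ + (- t) * φ u)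
        I-α : ∀ φ → I α φ ≈ Λ φ
        I-α φ = ≈-trans (I-++ (toComb μ) _ φ) (+-cong (I-toComb μ φ)
          (≈-trans (I-++ (reweight (λ r x → r * (- 1#) , x) (toComb ν)) _ φ) (+-cong
            (≈-trans (I-reweight (λ _ → - 1#) (λ x → x) (toComb ν) φ) (≈-trans (I-* (toComb ν) (- 1#) φ) (*-cong ≈-refl (I-toComb ν φ))))
            (+-identityʳ _))))
        E-Λ : ∀ ρ → E ρ (λ s → Λ (K s)) ≈ E ρ (λ s → E μ (K s)) + ((- 1#) * E ρ (λ s → E ν (K s)) + (- t) * E ρ (λ s → K s u))
        E-Λ ρ = ≈-trans (E-+ ρ _ _) (+-cong ≈-refl (≈-trans (E-+ ρ _ _) (+-cong (E-* ρ _ _) (E-* ρ _ _))))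
        flip : E ν (λ x → E μ (K x)) ≈ E μ (λ x → E ν (K x))
        flip = ≈-trans (E-swap ν μ K) (E-cong μ λ x → E-cong ν λ y → symm y x)
        expand : I α (λ s → I α (K s)) ≈ _
        expand = ≈-trans (I-cong α λ s → I-α (K s)) (≈-trans (I-α _)
          (≈-trans (+-cong (E-Λ μ) (+-cong (*-cong ≈-refl (≈-trans (E-Λ ν) (+-cong flip ≈-refl)))
              (*-cong ≈-refl (+-cong (E-cong μ λ x → symm u x) (+-cong (*-cong ≈-refl (E-cong ν λ x → symm u x)) ≈-refl)))))
            (≈-trans (+-cong (+-cong ≈-refl (+-cong (*-cong neg1 ≈-refl) ≈-refl)) (+-cong (*-cong neg1 (+-cong ≈-refl (+-cong (*-cong neg1 ≈-refl) ≈-refl))) (*-cong ≈-refl (+-cong ≈-refl (+-cong (*-cong neg1 ≈-refl) ≈-refl)))))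
            (solve 7 (λ mm mn nn mu nu uu t →
              (mm :+ ((:- con 1ℚ) :* mn :+ (:- t) :* mu)) :+ ((:- con 1ℚ) :* (mn :+ ((:- con 1ℚ) :* nn :+ (:- t) :* nu)) :+ (:- t) :* (mu :+ ((:- con 1ℚ) :* nu :+ (:- t) :* uu)))
              := ((mm :- (mn :+ mn)) :+ nn) :- (t :+ t) :* (mu :- nu) :+ (t :* t) :* uu) ≈-refl
              (E μ (λ x → E μ (K x))) (E μ (λ x → E ν (K x))) (E ν (λ x → E ν (K x))) (E μ (λ x → K x u)) (E ν (λ x → K x u)) (K u u) t))))
          where
            neg1 : - 1# ≈ - fromℚ 1ℚ
            neg1 = -‿cong (≈-sym fromℚ-1)

-- Gram kernels and nearly invariant averages

module Kernel (em : ∀ {a} → ExcludedMiddle a) (ℱ : RealField) {c} (G : Group c c) where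

  open Reals
  open Averages
  import Algebra.Properties.Group as GroupProperties
  open import Data.Bool.Base using (Bool; true; false)
  open import Data.Empty using (⊥-elim)
  open import Data.List.Base using ([]; _∷_)
  open import Data.Nat.Base using (suc)
  open import Data.Product.Base using (∃; _×_; _,_)
  open import Data.Rational.Base using (ℚ; 0ℚ; ½)
  open import Data.Sum.Base using (inj₁; inj₂)
  open import Level using (Level) renaming (suc to lsuc)
  open import Relation.Nullary using (¬_)

  open RealField ℱ
  open Order ℱ
  open Averaging ℱ
  module 𝔾 = Group G
  module 𝔾P = GroupProperties G
  open 𝔾 using (_∙_; ε) renaming (Carrier to Γ; _≈_ to _∼_)

  -- (false , x) stands for the translate x ξ and (true , g) for g η, where ξ and
  -- η are two vectors of a unitary representation of G.
  𝒮 : Set c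
  𝒮 = Bool × Γ

  pattern ξ x = (false , x)
  pattern η x = (true , x)

  _⊙_ : Γ → 𝒮 → 𝒮
  g ⊙ (i , x) = i , g ∙ x

  -- The Gram kernel of such vectors.  Positivity is required in the stronger form
  -- of Schur's product theorem, as it will be applied to squares of kernels.
  record Ker : Set (lsuc c) where
    field
      κ       : 𝒮 → 𝒮 → R
      schur   : ∀ {A : Set c} (ϑ : A → A → R) → PSD ϑ → (s : A → 𝒮) → PSD (λ a b → κ (s a) (s b) * ϑ a b)
      κ-sym   : ∀ s t → κ s t ≈ κ t s
      κ-inv   : ∀ g s t → κ (g ⊙ s) (g ⊙ t) ≈ κ s t
      κ-cong  : ∀ {i x y} → x ∼ y → ∀ t → κ (i , x) t ≈ κ (i , y) t
      κ-diag  : ∀ s → κ s s ≤ 1#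

    κ-cong₂ : ∀ {i j x y u v} → x ∼ y → u ∼ v → κ (i , x) (j , u) ≈ κ (i , y) (j , v)
    κ-cong₂ p q = ≈-trans (κ-cong p _) (≈-trans (κ-sym _ _) (≈-trans (κ-cong q _) (κ-sym _ _)))

    psd : PSD κ
    psd = PSD-cong (λ s t → *-identityʳ (κ s t)) (schur (λ _ _ → 1#) PSD-1 (λ s → s))

    psd-sq : PSD (λ s t → sq (κ s t))
    psd-sq = schur κ psd (λ s → s)

    0≤κ-diag : ∀ s → 0# ≤ κ s s
    0≤κ-diag s = ≤-respʳ (≈-trans (≈-trans (+-identityʳ _) (≈-trans (*-identityˡ _) (+-identityʳ _))) (*-identityˡ _)) (psd ((1# , s) ∷ []))

    coef : Γ → R
    coef x = κ (ξ x) (η ε)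

    coef-cong : ∀ {x y} → x ∼ y → coef x ≈ coef y
    coef-cong p = κ-cong p _

  open Ker

  -- The two kernels share the vector ξ up to isometry and may differ in η. A measure adapted to ξ
  -- serves all of them at once.
  SameSource : Ker → Ker → Set c
  SameSource k k′ = ∀ x y → κ k (ξ x) (ξ y) ≈ κ k′ (ξ x) (ξ y)

  module _ (k : Ker) where
    private
      -- The inner product of the averages of xξ ⊗ xξ over μ and over ν: inner products of tensor
      -- squares are squares of inner products.
      energy : Mix Γ → Mix Γ → R
      energy μ ν = E μ (λ x → E ν (λ y → sq (κ k (ξ x) (ξ y))))

      energy-sym : ∀ μ ν → energy μ ν ≈ energy ν μ
      energy-sym μ ν = ≈-trans (E-swap μ ν _) (E-cong ν λ x → E-cong μ λ y → sq-cong (κ-sym k _ _))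

      energy-translate : ∀ g μ → energy (mapᴹ (g ∙_) μ) (mapᴹ (g ∙_) μ) ≈ energy μ μ
      energy-translate g μ = ≈-trans (E-map (g ∙_) μ _) (E-cong μ λ x →
        ≈-trans (E-map (g ∙_) μ _) (E-cong μ λ y → sq-cong (κ-inv k g (ξ x) (ξ y))))

      distance : Mix Γ → Mix Γ → R
      distance μ ν = energy μ μ - (energy μ ν + energy μ ν) + energy ν ν

      -- The parallelogram law ‖a - b‖² = 2‖a‖² + 2‖b‖² - 4‖(a + b)/2‖²: the midpoint of two
      -- averages is the average over `mid μ ν`, whose energy is at least q.
      distance-near : ∀ {q d} → (∀ ρ → q ≤ energy ρ ρ) → ∀ μ ν → energy μ μ ≤ q + d → energy ν ν ≤ q + d →
                      distance μ ν ≤ (d + d) + (d + d)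
      distance-near {q} {d} min μ ν hμ hν = ≤-by (+-mono-≤ (+-mono-≤ hμ hμ) (+-mono-≤ (+-mono-≤ hν hν) (+-mono-≤ (+-mono-≤ (min ρ) (min ρ)) (+-mono-≤ (min ρ) (min ρ)))))
        (≈-trans (+-cong (+-cong ≈-refl (+-cong ≈-refl (+-cong (+-cong e e) (+-cong e e)))) ≈-refl)
          (solve 5 (λ m c n q d →
            ((((q :+ d) :+ (q :+ d)) :+ (((q :+ d) :+ (q :+ d)) :+ ((z m c n :+ z m c n) :+ (z m c n :+ z m c n))))
              :- ((m :+ m) :+ ((n :+ n) :+ ((q :+ q) :+ (q :+ q)))))
            := ((d :+ d) :+ (d :+ d)) :- ((m :- (c :+ c)) :+ n)) ≈-refl (energy μ μ) (energy μ ν) (energy ν ν) q d))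
        where
          ρ = mid μ ν
          z = λ m c n → con ½ :* (con ½ :* (m :+ c) :+ con ½ :* (c :+ n))
          e : energy ρ ρ ≈ half * (half * (energy μ μ + energy μ ν) + half * (energy μ ν + energy ν ν))
          e = *-cong ≈-refl (+-cong (≈-trans (E-* μ half _) (*-cong ≈-refl (E-+ μ _ _)))
                (≈-trans (E-* ν half _) (*-cong ≈-refl (≈-trans (E-+ ν _ _) (+-cong (energy-sym ν μ) ≈-refl)))))

      -- Cauchy-Schwarz for the difference a - b of two averages of ξ ⊗ ξ against η ⊗ η, in the form
      -- ‖a - b - t(η ⊗ η)‖² ≥ 0. As ‖a - b‖ ≤ t and ‖η‖ ≤ 1, it gives 2t(X - Y) ≤ 2t².
      compare : ∀ k′ → SameSource k′ k → ∀ {t} → Pos t → ∀ μ ν → distance μ ν ≤ sq t →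
                E μ (λ x → sq (coef k′ x)) ≤ E ν (λ x → sq (coef k′ x)) + t
      compare k′ same {t} 0<t μ ν near = ≤-by (*-monoˡ 0≤half (*-cancel 0<t scaled))
          (solve 3 (λ X Y t → con ½ :* (t :+ t) :- con ½ :* ((X :- Y) :+ (X :- Y)) := (Y :+ t) :- X) ≈-refl X Y t)
        where
          X = E μ (λ x → sq (coef k′ x))
          Y = E ν (λ x → sq (coef k′ x))
          w = sq (κ k′ (η ε) (η ε))
          ι : Γ → 𝒮
          ι x = ξ x
          K : 𝒮 → 𝒮 → R
          K s t = sq (κ k′ s t)
          block : ∀ μ ν → E (mapᴹ ι μ) (λ s → E (mapᴹ ι ν) (K s)) ≈ energy μ ν
          block μ ν = ≈-trans (E-map ι μ _) (E-cong μ λ x → ≈-trans (E-map ι ν _) (E-cong ν λ y → sq-cong (same x y)))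
          expanded : 0# ≤ distance μ ν - (t + t) * (X - Y) + sq t * w
          expanded = ≤-respʳ
            (+-cong (+-cong (+-cong (+-cong (block μ μ) (-‿cong (+-cong (block μ ν) (block μ ν)))) (block ν ν))
              (-‿cong (*-cong ≈-refl (+-cong (E-map ι μ (λ s → K s (η ε))) (-‿cong (E-map ι ν (λ s → K s (η ε)))))))) ≈-refl)
            (PSD-difference {K = K} (psd-sq k′) (λ s t → sq-cong (κ-sym k′ s t)) (mapᴹ ι μ) (mapᴹ ι ν) t (η ε))
          small : sq t * w ≤ sq t
          small = ≤-respʳ (*-identityʳ (sq t)) (*-monoˡ (sq-nonneg t) (sq≤1 (0≤κ-diag k′ (η ε)) (κ-diag k′ (η ε))))
          scaled : t * ((X - Y) + (X - Y)) ≤ t * (t + t)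
          scaled = ≤-by (+-mono-≤ expanded (+-mono-≤ near small))
            (≈-trans (+-cong ≈-refl (-‿cong (+-cong (≈-sym fromℚ-0) ≈-refl)))
              (solve 5 (λ D X Y w t → ((D :- (t :+ t) :* (X :- Y) :+ (t :* t) :* w) :+ ((t :* t) :+ (t :* t))) :- (con 0ℚ :+ (D :+ (t :* t) :* w))
                := t :* (t :+ t) :- t :* ((X :- Y) :+ (X :- Y))) ≈-refl (distance μ ν) X Y w t))

    -- A measure μ nearly minimising ∬ ⟨xξ , yξ⟩² is nearly G-invariant on the
    -- squares of all coefficients of ξ, because ξ ⊗ ξ averaged over μ is then close
    -- to the vector of least norm in the closed convex hull of the orbit of ξ ⊗ ξ.
    nearlyInvariant : ∀ {e} → Pos e → ∃ λ (μ : Mix Γ) → ∀ k′ → SameSource k′ k → ∀ g →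
      E μ (λ x → sq (coef k′ (g ∙ x))) ≤ E μ (λ x → sq (coef k′ x)) + e ×
      E μ (λ x → sq (coef k′ x)) ≤ E μ (λ x → sq (coef k′ (g ∙ x))) + e
    nearlyInvariant {e} 0<e = build (nearMinimum em A (λ r≤s (μ , h) → μ , ≤-trans h r≤s)
        (λ r (μ , h) → ≤-trans (0≤energy μ) h) (energy (leaf ε) (leaf ε) , leaf ε , ≤-refl)
        (Pos-* (Pos-* Pos-half 0<e) (Pos-* Pos-half 0<e)))
      where
        -- `distance-near` then bounds the squared distance by 4δ = e², as `compare` requires with t
        -- = e.
        δ = (half * e) * (half * e)
        A : R → Set c
        A r = ∃ λ μ → energy μ μ ≤ r
        0≤energy : ∀ μ → 0# ≤ energy μ μ
        0≤energy μ = ≤-respˡ (E-const μ 0#) (E-mono μ λ x → ≤-respˡ (E-const μ 0#) (E-mono μ λ y → sq-nonneg (κ k (ξ x) (ξ y))))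
        build : (∃ λ q → A (q + δ) × ¬ A q) → _
        build (q , (μ , hμ) , ¬A) = μ , λ k′ same g →
          let ν = mapᴹ (g ∙_) μ
              hν = ≤-respˡ (≈-sym (energy-translate g μ)) hμ
              mv = E-map (g ∙_) μ (λ x → sq (coef k′ x))
          in ≤-respˡ mv (compare k′ same 0<e ν μ (bound ν μ hν hμ)) ,
             ≤-respʳ (+-cong mv ≈-refl) (compare k′ same 0<e μ ν (bound μ ν hμ hν))
          where
            min : ∀ ρ → q ≤ energy ρ ρ
            min ρ with ≤-total q (energy ρ ρ)
            ... | inj₁ h = h
            ... | inj₂ h = ⊥-elim (¬A (ρ , h))
            bound : ∀ μ ν → energy μ μ ≤ q + δ → energy ν ν ≤ q + δ → distance μ ν ≤ sq e
            bound μ ν hμ hν = ≤-respʳ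
              (solve 1 (λ e → ((con ½ :* e) :* (con ½ :* e) :+ (con ½ :* e) :* (con ½ :* e)) :+ ((con ½ :* e) :* (con ½ :* e) :+ (con ½ :* e) :* (con ½ :* e)) := e :* e) ≈-refl e)
              (distance-near min μ ν hμ hν)

    abstract
      -- Kept opaque because comparing its unfolded uses is intractable.
      rightMean : ∀ {e} → Pos e → ∃ λ (μ : Mix Γ) → ∀ k′ → SameSource k′ k → ∀ g →
        E μ (λ x → sq (coef k′ (g ∙ x))) ≤ E μ (λ x → sq (coef k′ x)) + e ×
        E μ (λ x → sq (coef k′ x)) ≤ E μ (λ x → sq (coef k′ (g ∙ x))) + e
      rightMean = nearlyInvariant

-- Operations on kernels and the mean of a squared coefficient

module Upper (em : ∀ {a} → ExcludedMiddle a) (ℱ : RealField) {c} (G : Group c c) where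

  open Reals
  open Averages
  open Kernel em ℱ G
  open import Data.Bool.Base using (Bool; true; false; not)
  open import Data.Empty using (⊥-elim)
  open import Data.Product.Base using (∃; _×_; _,_; proj₁; proj₂)
  open import Data.Rational.Base as ℚ using (ℚ; 0ℚ; 1ℚ; ½)
  import Data.Rational.Properties as ℚ
  open import Data.Sum.Base using (inj₁; inj₂)
  open import Function.Base using (_∘_)
  open import Relation.Nullary using (¬_)

  open RealField ℱ
  open Order ℱ
  open Averaging ℱ
  open 𝔾 using (_∙_; ε; _⁻¹) renaming (Carrier to Γ; _≈_ to _∼_)
  open Ker

  -- The Gram kernel of (ξ , ξ′)/√2 and (η , η′)/√2 in the direct sum of the two representations, so
  -- that coefficients can be averaged although ξ and ξ′ differ.
  average : Ker → Ker → Ker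
  average k l = record
    { κ      = λ s t → half * (κ k s t + κ l s t)
    ; schur  = λ ϑ p s → PSD-cong (λ a b → solve 4 (λ h x y z → h :* (x :* z :+ y :* z) := (h :* (x :+ y)) :* z) ≈-refl half _ _ _)
                           (PSD-* half 0≤half (PSD-+ (schur k ϑ p s) (schur l ϑ p s)))
    ; κ-sym  = λ s t → *-cong ≈-refl (+-cong (κ-sym k s t) (κ-sym l s t))
    ; κ-inv  = λ g s t → *-cong ≈-refl (+-cong (κ-inv k g s t) (κ-inv l g s t))
    ; κ-cong = λ p t → *-cong ≈-refl (+-cong (κ-cong k p t) (κ-cong l p t))
    ; κ-diag = λ s → ≤-respʳ (solve 1 (λ o → con ½ :* (o :+ o) := o) ≈-refl 1#) (*-monoˡ 0≤half (+-mono-≤ (κ-diag k s) (κ-diag l s))) }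

  weight : R → Bool → R
  weight w false = 1#
  weight w true  = w

  -- Replaces η by wη and keeps ξ; the bound on w keeps the norm at most 1. Signs and zeros are
  -- thereby introduced without changing the source.
  weigh : ∀ w → sq w ≤ 1# → Ker → Ker
  weigh w w≤1 k = record
    { κ      = λ s t → v s * (v t * κ k s t)
    ; schur  = λ ϑ p s → PSD-cong (λ a b → solve 4 (λ x y z u → x :* (y :* (z :* u)) := (x :* (y :* z)) :* u) ≈-refl _ _ _ _)
                           (PSD-weighted (v ∘ s) (λ a → a) (schur k ϑ p s))
    ; κ-sym  = λ s t → ≈-trans (*-cong ≈-refl (*-cong ≈-refl (κ-sym k s t)))
                        (solve 3 (λ x y z → x :* (y :* z) := y :* (x :* z)) ≈-refl (v s) (v t) (κ k t s))
    ; κ-inv  = λ g s t → *-cong ≈-refl (*-cong ≈-refl (κ-inv k g s t))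
    ; κ-cong = λ p t → *-cong ≈-refl (*-cong ≈-refl (κ-cong k p t))
    ; κ-diag = λ s → ≤-respˡ (*-assoc _ _ _) (≤-trans (*-monoˡ (sq-nonneg (v s)) (κ-diag k s)) (≤-respˡ (≈-sym (*-identityʳ _)) (v≤1 (proj₁ s)))) }
    where
      v : 𝒮 → R
      v s = weight w (proj₁ s)
      v≤1 : ∀ i → sq (weight w i) ≤ 1#
      v≤1 false = ≤-reflexive (*-identityʳ 1#)
      v≤1 true  = w≤1

  weigh-source : ∀ w w≤1 k → SameSource (weigh w w≤1 k) k
  weigh-source w w≤1 k x y = ≈-trans (*-identityˡ _) (*-identityˡ _)

  weigh-coef : ∀ w w≤1 k x → coef (weigh w w≤1 k) x ≈ w * coef k x
  weigh-coef w w≤1 k x = *-identityˡ _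

  sq-1≤1 : sq (- 1#) ≤ 1#
  sq-1≤1 = ≤-reflexive (≈-trans (*-cong e e) (≈-trans (solve 0 ((:- con 1ℚ) :* (:- con 1ℚ) := con 1ℚ) ≈-refl) fromℚ-1))
    where
      e : - 1# ≈ - fromℚ 1ℚ
      e = -‿cong (≈-sym fromℚ-1)

  sq0≤1 : sq 0# ≤ 1#
  sq0≤1 = ≤-respˡ (≈-sym (zeroˡ 0#)) 0≤1

  negate annihilate : Ker → Ker
  negate     = weigh (- 1#) sq-1≤1
  annihilate = weigh 0# sq0≤1

  negate-coef : ∀ k x → coef (negate k) x ≈ - coef k x
  negate-coef k x = ≈-trans (weigh-coef (- 1#) sq-1≤1 k x) (≈-trans (*-cong (-‿cong (≈-sym fromℚ-1)) ≈-refl) (solve 1 (λ x → (:- con 1ℚ) :* x := :- x) ≈-refl _))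

  annihilate-coef : ∀ k x → coef (annihilate k) x ≈ 0#
  annihilate-coef k x = ≈-trans (weigh-coef 0# sq0≤1 k x) (zeroˡ _)

  reindex : (ρ : 𝒮 → 𝒮) (k : Ker) → (∀ {i x y} → x ∼ y → ∀ t → κ k (ρ (i , x)) t ≈ κ k (ρ (i , y)) t) →
            (∀ g s t → κ k (ρ (g ⊙ s)) (ρ (g ⊙ t)) ≈ κ k (ρ s) (ρ t)) → Ker
  reindex ρ k ρ-cong ρ-inv = record
    { κ = λ s t → κ k (ρ s) (ρ t) ; schur = λ ϑ p s → schur k ϑ p (ρ ∘ s) ; κ-sym = λ s t → κ-sym k (ρ s) (ρ t)
    ; κ-inv = ρ-inv ; κ-cong = λ p t → ρ-cong p (ρ t) ; κ-diag = λ s → κ-diag k (ρ s) }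

  -- Replaces η by hη, which moves the translation of the coefficient away from ξ: the source is
  -- unchanged.
  translate : Γ → Ker → Ker
  translate h k = reindex ρ k ρ-cong ρ-inv
    where
      ρ : 𝒮 → 𝒮
      ρ (ξ x) = ξ x
      ρ (η g) = η (g ∙ h)
      ρ-cong : ∀ {i x y} → x ∼ y → ∀ t → κ k (ρ (i , x)) t ≈ κ k (ρ (i , y)) t
      ρ-cong {false} p t = κ-cong k p t
      ρ-cong {true}  p t = κ-cong k (𝔾.∙-congʳ p) t
      ρ-⊙ : ∀ g s t → κ k (ρ (g ⊙ s)) t ≈ κ k (g ⊙ ρ s) t
      ρ-⊙ g (ξ x) t = ≈-refl
      ρ-⊙ g (η x) t = κ-cong k (𝔾.assoc g x h) t
      ρ-inv : ∀ g s t → κ k (ρ (g ⊙ s)) (ρ (g ⊙ t)) ≈ κ k (ρ s) (ρ t)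
      ρ-inv g s t = ≈-trans (ρ-⊙ g s _) (≈-trans (κ-sym k _ _) (≈-trans (ρ-⊙ g t _) (≈-trans (κ-sym k _ _) (κ-inv k g _ _))))

  translate-coef : ∀ h k x → coef (translate h k) x ≈ coef k (h ⁻¹ ∙ x)
  translate-coef h k x = ≈-trans (≈-sym (κ-inv k (h ⁻¹) _ _))
    (κ-cong₂ k 𝔾.refl (𝔾.trans (𝔾.∙-congˡ (𝔾.identityˡ h)) (𝔾.inverseˡ h)))

  transpose : Ker → Ker
  transpose k = reindex (λ (i , x) → not i , x) k (λ p t → κ-cong k p t) (λ g (i , x) (j , y) → κ-inv k g (not i , x) (not j , y))

  transpose-coef : ∀ k x → coef (transpose k) x ≈ coef k (x ⁻¹)
  transpose-coef k x = ≈-trans (κ-sym k _ _) (≈-trans (≈-sym (κ-inv k (x ⁻¹) _ _)) (κ-cong₂ k (𝔾.identityʳ _) (𝔾.inverseˡ x)))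

  record Automorphism : Set c where
    field
      to      : Γ → Γ
      from    : Γ → Γ
      to-cong : ∀ {x y} → x ∼ y → to x ∼ to y
      to-∙    : ∀ x y → to (x ∙ y) ∼ to x ∙ to y
      to-ε    : to ε ∼ ε
      to-from : ∀ x → to (from x) ∼ x

  module _ (τ : Automorphism) where
    open Automorphism τ

    to-⁻¹ : ∀ x → to (x ⁻¹) ∼ to x ⁻¹
    to-⁻¹ x = 𝔾P.inverseˡ-unique _ _ (𝔾.trans (𝔾.sym (to-∙ (x ⁻¹) x)) (𝔾.trans (to-cong (𝔾.inverseˡ x)) to-ε))

    twist : Ker → Ker
    twist k = reindex (λ (i , x) → i , to x) k (λ p t → κ-cong k (to-cong p) t)
      (λ g s t → ≈-trans (κ-cong₂ k (to-∙ g _) (to-∙ g _)) (κ-inv k (to g) _ _))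

    twist-coef : ∀ k x → coef (twist k) x ≈ coef k (to x)
    twist-coef k x = κ-cong₂ k 𝔾.refl to-ε

  -- The invariant mean of the squared coefficient is at most r, expressed through
  -- finite averages.
  Upper : Ker → R → Set c
  Upper k r = ∃ λ (μ : Mix Γ) → ∀ x → E μ (λ g → sq (coef k (g ⁻¹ ∙ x))) ≤ r

  Upper-mono : ∀ {k r s} → r ≤ s → Upper k r → Upper k s
  Upper-mono r≤s (μ , h) = μ , λ x → ≤-trans (h x) r≤s

  Upper-cong : ∀ k l {r} → (∀ x → sq (coef k x) ≈ sq (coef l x)) → Upper k r → Upper l r
  Upper-cong k l e (μ , h) = μ , λ x → ≤-respˡ (E-cong μ λ g → e (g ⁻¹ ∙ x)) (h x)

  Upper-nonneg : ∀ k {r} → Upper k r → 0# ≤ r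
  Upper-nonneg k (μ , h) = ≤-trans (≤-respˡ (E-const μ 0#) (E-mono μ λ g → sq-nonneg (coef k (g ⁻¹ ∙ ε)))) (h ε)

  -- The bound is uniform in x, so conjugating the support of μ by h turns the bound for `l` at x
  -- into the bound for `k` at hx.
  Upper-translate : ∀ k l h {r} → (∀ x → sq (coef l x) ≈ sq (coef k (h ∙ x))) → Upper k r → Upper l r
  Upper-translate k l h e (μ , u) = mapᴹ (h ⁻¹ ∙_) μ′ , λ x → ≤-respˡ
      (≈-sym (≈-trans (E-map (h ⁻¹ ∙_) μ′ _) (≈-trans (E-map (_∙ h) μ _) (E-cong μ λ g → ≈-trans (e _) (sq-cong (coef-cong k (shift g x))))))) (u (h ∙ x))
    where
      μ′ = mapᴹ (_∙ h) μ
      open import Relation.Binary.Reasoning.Setoid 𝔾.setoid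
      shift : ∀ g x → h ∙ ((h ⁻¹ ∙ (g ∙ h)) ⁻¹ ∙ x) ∼ g ⁻¹ ∙ (h ∙ x)
      shift g x = begin
        h ∙ ((h ⁻¹ ∙ (g ∙ h)) ⁻¹ ∙ x)          ≈⟨ 𝔾.assoc _ _ _ ⟨
        (h ∙ (h ⁻¹ ∙ (g ∙ h)) ⁻¹) ∙ x          ≈⟨ 𝔾.∙-congʳ (𝔾.∙-congˡ (𝔾P.⁻¹-anti-homo-∙ _ _)) ⟩
        (h ∙ ((g ∙ h) ⁻¹ ∙ (h ⁻¹) ⁻¹)) ∙ x     ≈⟨ 𝔾.∙-congʳ (𝔾.∙-congˡ (𝔾.∙-cong (𝔾P.⁻¹-anti-homo-∙ _ _) (𝔾P.⁻¹-involutive h))) ⟩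
        (h ∙ ((h ⁻¹ ∙ g ⁻¹) ∙ h)) ∙ x          ≈⟨ 𝔾.∙-congʳ (𝔾.trans (𝔾.sym (𝔾.assoc _ _ _)) (𝔾.∙-congʳ (𝔾P.\\-leftDividesˡ h (g ⁻¹)))) ⟩
        (g ⁻¹ ∙ h) ∙ x                          ≈⟨ 𝔾.assoc _ _ _ ⟩
        g ⁻¹ ∙ (h ∙ x)                          ∎

  Upper-twist : ∀ τ k l {r} → (∀ x → sq (coef k (Automorphism.to τ x)) ≈ sq (coef l x)) → Upper l r → Upper k r
  Upper-twist τ k l e (μ , u) = mapᴹ to μ , λ x → ≤-respˡ
      (≈-sym (≈-trans (E-map to μ _) (E-cong μ λ g → ≈-trans (sq-cong (coef-cong k (shift g x))) (e _)))) (u (from x))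
    where
      open Automorphism τ
      shift : ∀ g x → to g ⁻¹ ∙ x ∼ to (g ⁻¹ ∙ from x)
      shift g x = 𝔾.sym (𝔾.trans (to-∙ _ _) (𝔾.∙-cong (to-⁻¹ τ g) (to-from x)))

  -- `transpose k` has the coefficient x ↦ `coef k (x ⁻¹)`. Near invariance of its average under x
  -- therefore says that the averages of left translates for `k` are nearly constant in x.
  leftMean : ∀ k {e} → Pos e → ∃ λ (μ : Mix Γ) → ∀ x y →
             E μ (λ g → sq (coef k (g ⁻¹ ∙ x))) ≤ E μ (λ g → sq (coef k (g ⁻¹ ∙ y))) + (e + e)
  leftMean k {e} 0<e = build (rightMean (transpose k) 0<e)
    where
      build : (∃ λ (μ : Mix Γ) → _) → _
      build (μ , h) = μ , λ x y → ≤-by (+-mono-≤ (proj₁ (at x)) (proj₂ (at y)))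
          (solve 4 (λ x y m e → ((m :+ e) :+ (y :+ e)) :- (x :+ m) := (y :+ (e :+ e)) :- x) ≈-refl _ _ m e)
        where
          m = E μ (λ g → sq (coef (transpose k) g))
          flip : ∀ x g → sq (coef (transpose k) (x ⁻¹ ∙ g)) ≈ sq (coef k (g ⁻¹ ∙ x))
          flip x g = sq-cong (≈-trans (transpose-coef k _) (coef-cong k (𝔾.trans (𝔾P.⁻¹-anti-homo-∙ _ _) (𝔾.∙-congˡ (𝔾P.⁻¹-involutive x)))))
          at : ∀ x → E μ (λ g → sq (coef k (g ⁻¹ ∙ x))) ≤ m + e × m ≤ E μ (λ g → sq (coef k (g ⁻¹ ∙ x))) + e
          at x = ≤-respˡ (E-cong μ (flip x)) (proj₁ (h (transpose k) (λ _ _ → ≈-refl) (x ⁻¹))) ,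
                 ≤-respʳ (+-cong (E-cong μ (flip x)) ≈-refl) (proj₂ (h (transpose k) (λ _ _ → ≈-refl) (x ⁻¹)))

  NearlyInvariant : Mix Γ → R → Ker → Set c
  NearlyInvariant μ e k = ∀ g →
    E μ (λ x → sq (coef k (g ∙ x))) ≤ E μ (λ x → sq (coef k x)) + e ×
    E μ (λ x → sq (coef k x)) ≤ E μ (λ x → sq (coef k (g ∙ x))) + e

  -- Average the translates over both measures. In one order near invariance compares the result
  -- with the left-hand side; in the other it is at most r at every point.
  Upper⇒E≤ : ∀ k {μ e r} → NearlyInvariant μ e k → Upper k r → E μ (λ x → sq (coef k x)) ≤ r + e
  Upper⇒E≤ k {μ} {e} {r} inv (λ′ , u) = ≤-trans
    (≤-respˡ (E-const λ′ _) (≤-respʳ (≈-trans (E-+ λ′ _ _) (+-cong ≈-refl (E-const λ′ e))) (E-mono λ′ λ g → proj₂ (inv (g ⁻¹)))))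
    (+-mono-≤ (≤-respˡ (E-swap μ λ′ _) (≤-respʳ (E-const μ r) (E-mono μ u))) ≤-refl)

  -- The converse of `Upper⇒E≤` up to an error: the mean can be read off from any nearly invariant
  -- μ. One e comes from μ, two from `leftMean`.
  E≤⇒Upper : ∀ k {μ e r} → Pos e → NearlyInvariant μ e k → E μ (λ x → sq (coef k x)) ≤ r → Upper k (r + (e + (e + e)))
  E≤⇒Upper k {μ} {e} {r} 0<e inv h = build (leftMean k 0<e)
    where
      build : (∃ λ (μ : Mix Γ) → _) → _
      build (ν , flat) = ν , λ x → ≤-trans
          (≤-respˡ (E-const μ _) (≤-respʳ (≈-trans (E-+ μ _ _) (+-cong ≈-refl (E-const μ (e + e)))) (E-mono μ λ y → flat x y)))
          (≤-respʳ (+-assoc r e (e + e)) (+-mono-≤ (≤-respˡ (≈-sym (E-swap μ ν (λ y g → sq (coef k (g ⁻¹ ∙ y)))))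
            (≤-respʳ (≈-trans (E-const ν _) ≈-refl) (E-mono ν λ g → ≤-trans (proj₁ (inv (g ⁻¹))) (+-mono-≤ h ≤-refl)))) ≤-refl))

  difference : Ker → Ker → Ker
  difference k l = average k (negate l)

  difference-coef : ∀ k l x → coef (difference k l) x ≈ half * (coef k x - coef l x)
  difference-coef k l x = *-cong ≈-refl (+-cong ≈-refl (negate-coef l x))

  -- Under a single nearly invariant measure the means become numbers obeying the pointwise identity
  -- of squares. The failure of `Upper` for the average supplies the lower bound that has to be
  -- subtracted.
  parallelogram : ∀ k l {r s q e} → Pos e → Upper k r → Upper l s → ¬ Upper (average k l) q →
                  Upper (difference k l) (half * r + half * s - q + e)
  parallelogram k l {r} {s} {q} {e} 0<e uk ul ¬u = build (rightMean (average k l) 0<d)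
    where
      -- The errors are 4d from the bounds for `h₁` and `h₂`, 3d from the lower bound for the
      -- average and 3d from the return to `Upper`. Of e = 16d this leaves 6d, the slack `six`
      -- below.
      d = quarter * (quarter * e)
      0<d : Pos d
      0<d = Pos-* 0<quarter (Pos-* 0<quarter 0<e)
        where
          0<quarter : Pos quarter
          0<quarter = Pos-mono (≤-reflexive (≈-sym (fromℚ-* ½ ½))) (Pos-* Pos-half Pos-half)
      -- The coefficients k/2 and l/2, presented with the source of average k l so
      -- that a single measure μ serves all the coefficients of the law.
      h₁ = average k (annihilate l)
      h₂ = average (annihilate k) l
      Upper-half : ∀ h k → (∀ x → coef h x ≈ half * coef k x) → ∀ {r} → Upper k r → Upper h (quarter * r)
      Upper-half h k e (μ , u) = μ , λ x → ≤-respˡ (≈-trans (≈-sym (E-* μ quarter _)) (E-cong μ λ g →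
          ≈-trans (solve 1 (λ x → con (½ ℚ.* ½) :* (x :* x) := (con ½ :* x) :* (con ½ :* x)) ≈-refl _) (sq-cong (≈-sym (e (g ⁻¹ ∙ x))))))
        (*-monoˡ (≤-trans (Pos⇒0≤ (Pos-* Pos-half Pos-half)) (≤-reflexive (≈-sym (fromℚ-* ½ ½)))) (u x))
      e₁ : ∀ x → coef h₁ x ≈ half * coef k x
      e₁ x = *-cong ≈-refl (≈-trans (+-cong ≈-refl (annihilate-coef l x)) (+-identityʳ _))
      e₂ : ∀ x → coef h₂ x ≈ half * coef l x
      e₂ x = *-cong ≈-refl (≈-trans (+-cong (annihilate-coef k x) ≈-refl) (+-identityˡ _))
      build : (∃ λ (μ : Mix Γ) → ∀ k′ → SameSource k′ (average k l) → NearlyInvariant μ d k′) → _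
      build (μ , inv) = Upper-mono {difference k l} le (E≤⇒Upper (difference k l) {μ} 0<d i₋ ≤-refl)
        where
          S : Ker → R
          S k = E μ (λ x → sq (coef k x))
          i₊ = inv (average k l) (λ _ _ → ≈-refl)
          i₋ = inv (difference k l) (λ x y → *-cong ≈-refl (+-cong ≈-refl (weigh-source (- 1#) sq-1≤1 l x y)))
          i₁ = inv h₁ (λ x y → *-cong ≈-refl (+-cong ≈-refl (weigh-source 0# sq0≤1 l x y)))
          i₂ = inv h₂ (λ x y → *-cong ≈-refl (+-cong (weigh-source 0# sq0≤1 k x y) ≈-refl))
          law : S (average k l) + S (difference k l) ≈ (S h₁ + S h₁) + (S h₂ + S h₂)
          law = ≈-trans (≈-sym (E-+ μ _ _)) (≈-trans (E-cong μ λ x →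
              ≈-trans (+-cong ≈-refl (sq-cong (difference-coef k l x)))
              (≈-trans (solve 2 (λ f g → (con ½ :* (f :+ g)) :* (con ½ :* (f :+ g)) :+ (con ½ :* (f :- g)) :* (con ½ :* (f :- g))
                := ((con ½ :* f) :* (con ½ :* f) :+ (con ½ :* f) :* (con ½ :* f)) :+ ((con ½ :* g) :* (con ½ :* g) :+ (con ½ :* g) :* (con ½ :* g))) ≈-refl (coef k x) (coef l x))
                (+-cong (+-cong (sq-cong (≈-sym (e₁ x))) (sq-cong (≈-sym (e₁ x)))) (+-cong (sq-cong (≈-sym (e₂ x))) (sq-cong (≈-sym (e₂ x)))))))
            (≈-trans (E-+ μ _ _) (+-cong (E-+ μ _ _) (E-+ μ _ _))))
          b₁ : S h₁ ≤ quarter * r + d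
          b₁ = Upper⇒E≤ h₁ {μ} i₁ (Upper-half h₁ k e₁ uk)
          b₂ : S h₂ ≤ quarter * s + d
          b₂ = Upper⇒E≤ h₂ {μ} i₂ (Upper-half h₂ l e₂ ul)
          b₊ : q - (d + (d + d)) ≤ S (average k l)
          b₊ with ≤-total (q - (d + (d + d))) (S (average k l))
          ... | inj₁ h = h
          ... | inj₂ h = ⊥-elim (¬u (Upper-mono {average k l} (≤-reflexive (solve 2 (λ q d → (q :- d) :+ d := q) ≈-refl q (d + (d + d))))
                           (E≤⇒Upper (average k l) {μ} 0<d i₊ h)))
          le : S (difference k l) + (d + (d + d)) ≤ half * r + half * s - q + e
          le = ≤-by (+-mono-≤ (+-mono-≤ (+-mono-≤ b₁ b₁) (+-mono-≤ b₂ b₂)) (+-mono-≤ b₊ (Pos⇒0≤ (Pos-* 0<d (Pos-fromℚ (ℚ.positive⁻¹ six))))))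
            (≈-trans (+-cong ≈-refl (-‿cong (+-cong (≈-sym law) (+-cong ≈-refl (≈-sym fromℚ-0)))))
              (solve 6 (λ r s q e p m →
                let d = con (½ ℚ.* ½) :* (con (½ ℚ.* ½) :* e) in
                (((con (½ ℚ.* ½) :* r :+ d) :+ (con (½ ℚ.* ½) :* r :+ d)) :+ ((con (½ ℚ.* ½) :* s :+ d) :+ (con (½ ℚ.* ½) :* s :+ d)) :+ (p :+ d :* con six))
                :- ((p :+ m) :+ ((q :- (d :+ (d :+ d))) :+ con 0ℚ))
                := (con ½ :* r :+ con ½ :* s :- q :+ e) :- (m :+ (d :+ (d :+ d)))) ≈-refl r s q e (S (average k l)) (S (difference k l))))
            where
              six = 1ℚ ℚ.+ (1ℚ ℚ.+ (1ℚ ℚ.+ (1ℚ ℚ.+ (1ℚ ℚ.+ 1ℚ))))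

-- Dedekind cuts as elements of the field

module Cuts (em : ∀ {a} → ExcludedMiddle a) (ℱ : RealField) where

  open Reals
  import Defs
  open import Defs using (ℝ; _+ᴿ_; _-ᴿ_; _≤ᴿ_; _≃ᴿ_)
  open Cauchy using (straddle)
  open Averages
  open import Data.Product.Base using (∃; _×_; _,_; proj₁; proj₂)
  open import Data.Rational.Base as ℚ using (ℚ; 0ℚ; 1ℚ)
  import Data.Rational.Properties as ℚ
  open import Relation.Binary.PropositionalEquality.Core using (refl)
  open import Relation.Unary using (_∈_; _∉_)

  open RealField ℱ
  open Order ℱ

  value : ℝ → R
  value c = proj₁ (fromCut c)

  value-≥ : ∀ c {q} → q ∈ ℝ.lower c → fromℚ q ≤ value c
  value-≥ c = proj₁ (proj₂ (fromCut c))

  value-≤ : ∀ c {q} → q ∉ ℝ.lower c → value c ≤ fromℚ q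
  value-≤ c = proj₂ (proj₂ (fromCut c))

  value-least : ∀ c {x} → (∀ {q} → q ∈ ℝ.lower c → fromℚ q ≤ x) → value c ≤ x
  value-least c {x} h = ≤-closed λ e 0<e → near e (straddle em c e 0<e)
    where
      near : ∀ e → (∃ λ q → q ∈ ℝ.lower c × (q ℚ.+ e) ∉ ℝ.lower c) → value c ≤ x + fromℚ e
      near e (q , q∈ , q+e∉) = ≤-trans (value-≤ c q+e∉) (≤-respˡ (≈-sym (fromℚ-+ q e)) (+-mono-≤ (h q∈) ≤-refl))

  value-mono : ∀ c d → c ≤ᴿ d → value c ≤ value d
  value-mono c d c≤d = value-least c λ q∈ → value-≥ d (c≤d q∈)

  value-cong : ∀ c d → c ≃ᴿ d → value c ≈ value d
  value-cong c d (p , q) = ≤-antisym (value-mono c d p) (value-mono d c q)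

  private
    below : ∀ a {e} → 0ℚ ℚ.< e → a ℚ.- e ℚ.< a
    below a {e} 0<e = ℚ.<-respʳ-≡ (ℚ.+-identityʳ a) (ℚ.+-monoʳ-< a (ℚ.neg-antimono-< 0<e))

    fromℚ-- : ∀ a b → fromℚ (a ℚ.- b) ≈ fromℚ a - fromℚ b
    fromℚ-- a b = ≈-trans (fromℚ-+ a (ℚ.- b)) (+-cong ≈-refl (fromℚ-neg b))

  value-fromℚ : ∀ r → value (Defs.fromℚ r) ≈ fromℚ r
  value-fromℚ r = ≤-antisym (value-≤ (Defs.fromℚ r) (ℚ.<-irrefl refl)) (≤-closed λ e 0<e →
    ≤-by (value-≥ (Defs.fromℚ r) (below r 0<e)) (≈-trans (+-cong ≈-refl (-‿cong (fromℚ-- r e)))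
      (solve 3 (λ r e v → v :- (r :- e) := (v :+ e) :- r) ≈-refl (fromℚ r) (fromℚ e) (value (Defs.fromℚ r)))))

  value-modular : ∀ x y w → value (x +ᴿ y -ᴿ w) ≈ value x + value y - value w
  value-modular x y w = ≤-antisym (value-least z λ {q} → upper {q}) (≤-closed⁺ λ e 0<e → lower′ e 0<e)
    where
      z = x +ᴿ y -ᴿ w
      upper : ∀ {q} → q ∈ ℝ.lower z → fromℚ q ≤ value x + value y - value w
      upper {q} (a , b , (a₁ , a₂ , a₁∈ , a₂∈ , a<) , b∉ , q<) =
        ≤-by (+-mono-≤ (+-mono-≤ (value-≥ x a₁∈) (value-≥ y a₂∈)) (+-mono-≤ (value-≤ w b∉)
               (+-mono-≤ (≤-respʳ (fromℚ-+ a₁ a₂) (fromℚ-mono (ℚ.<⇒≤ a<))) (≤-respʳ (fromℚ-- a b) (fromℚ-mono (ℚ.<⇒≤ q<))))))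
          (solve 8 (λ vx vy vw a₁ a₂ b a q → ((vx :+ vy) :+ (b :+ ((a₁ :+ a₂) :+ (a :- b)))) :- ((a₁ :+ a₂) :+ (vw :+ (a :+ q))) := ((vx :+ vy) :- vw) :- q)
            ≈-refl (value x) (value y) (value w) (fromℚ a₁) (fromℚ a₂) (fromℚ b) (fromℚ a) (fromℚ q))
      -- Two t are lost in bounding the values of x and y from above. Three more are subtracted in
      -- `q`: two for the strict inequalities in the sum and the difference of cuts, one for leaving
      -- the cut of w.
      five = 1ℚ ℚ.+ (1ℚ ℚ.+ (1ℚ ℚ.+ (1ℚ ℚ.+ 1ℚ)))
      lower′ : ∀ e → Pos e → value x + value y - value w ≤ value z + e
      lower′ e (pos d 0<d d≤e) = build (Rational.shrink (ℚ.positive⁻¹ five) 0<d)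
        where
          build : (∃ λ t → 0ℚ ℚ.< t × t ℚ.≤ 1ℚ × t ℚ.* five ℚ.≤ d) → value x + value y - value w ≤ value z + e
          build (t , 0<t , _ , 5t≤d) = fill (straddle em x t 0<t) (straddle em y t 0<t) (straddle em w t 0<t)
            where
              fill : (∃ λ q → q ∈ ℝ.lower x × (q ℚ.+ t) ∉ ℝ.lower x) → (∃ λ q → q ∈ ℝ.lower y × (q ℚ.+ t) ∉ ℝ.lower y) →
                     (∃ λ q → q ∈ ℝ.lower w × (q ℚ.+ t) ∉ ℝ.lower w) → value x + value y - value w ≤ value z + e
              fill (a₁ , a₁∈ , a₁∉) (a₂ , a₂∈ , a₂∉) (b , b∈ , b∉) = ≤-by
                  (+-mono-≤ (+-mono-≤ (+-mono-≤ (value-≤ x a₁∉) (value-≤ y a₂∉)) (value-≥ w b∈))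
                    (+-mono-≤ (value-≥ z q∈) (≤-trans (≤-respˡ (fromℚ-* t five) (fromℚ-mono 5t≤d)) d≤e)))
                  (≈-trans (+-cong (+-cong (+-cong (+-cong (fromℚ-+ a₁ t) (fromℚ-+ a₂ t)) ≈-refl) ≈-refl)
                      (-‿cong (+-cong ≈-refl (+-cong eq ≈-refl))))
                    (solve 9 (λ vx vy vw vz a₁ a₂ b t e →
                       ((((a₁ :+ t) :+ (a₂ :+ t)) :+ vw) :+ (vz :+ e)) :- (((vx :+ vy) :+ b) :+ (((((a₁ :+ a₂) :- t) :- (b :+ t)) :- t) :+ t :* con five))
                       := (vz :+ e) :- ((vx :+ vy) :- vw))
                      ≈-refl (value x) (value y) (value w) (value z) (fromℚ a₁) (fromℚ a₂) (fromℚ b) (fromℚ t) e))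
                where
                  q = ((a₁ ℚ.+ a₂) ℚ.- t) ℚ.- (b ℚ.+ t) ℚ.- t
                  q∈ : q ∈ ℝ.lower z
                  q∈ = (a₁ ℚ.+ a₂) ℚ.- t , b ℚ.+ t , (a₁ , a₂ , a₁∈ , a₂∈ , below (a₁ ℚ.+ a₂) 0<t) , b∉ , below (((a₁ ℚ.+ a₂) ℚ.- t) ℚ.- (b ℚ.+ t)) 0<t
                  eq : fromℚ q ≈ ((fromℚ a₁ + fromℚ a₂) - fromℚ t) - (fromℚ b + fromℚ t) - fromℚ t
                  eq = ≈-trans (fromℚ-- _ t) (+-cong (≈-trans (fromℚ-- ((a₁ ℚ.+ a₂) ℚ.- t) (b ℚ.+ t)) (+-cong (≈-trans (fromℚ-- (a₁ ℚ.+ a₂) t) (+-cong (fromℚ-+ a₁ a₂) ≈-refl)) (-‿cong (fromℚ-+ b t)))) ≈-refl)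

open import Data.Product.Base using (∃; _×_; _,_)
open import Relation.Unary using (Pred; Empty; _∈_; _∉_; _⊆_; _≐_; _∩_; _∪_)

-- The stabiliser of the limit of near minimisers

module Stabiliser (em : ∀ {a} → ExcludedMiddle a) (ℱ : RealField) {c} (G : Group c c) where

  open Reals
  open Averages
  open Cauchy using (dyadic; 0<dyadic; dyadic-mono; dyadic-small)
  open Kernel em ℱ G
  open Upper em ℱ G
  open import Data.Bool.Base using (Bool; true; false)
  open import Data.List.Base using (List; []; _∷_)
  open import Data.Nat.Base as ℕ using (ℕ)
  import Data.Nat.Properties as ℕ
  import Data.Rational.Properties as ℚ
  open import Data.Product.Base using (∃; _×_; _,_; proj₁; proj₂)
  open import Data.Rational.Base as ℚ using (ℚ; 0ℚ; 1ℚ; ½)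
  open import Relation.Nullary using (¬_)
  open import Relation.Nullary.Decidable using (decidable-stable)

  open RealField ℱ
  open Order ℱ
  open Averaging ℱ
  open 𝔾 using (_∙_; ε; _⁻¹) renaming (Carrier to Γ; _≈_ to _∼_)
  open Ker

  sq-coef≤1 : ∀ k x → sq (coef k x) ≤ fromℚ 1ℚ
  sq-coef≤1 k x = ≤-by (*-nonneg (both (fromℚ 1ℚ) (≈-sym e₁)) (both (fromℚ (ℚ.- 1ℚ)) (≈-sym e₂)))
      (≈-trans (+-cong ≈-refl (-‿cong (≈-sym fromℚ-0)))
        (solve 1 (λ f → (con 1ℚ :+ con 1ℚ :* f) :* (con 1ℚ :+ con (ℚ.- 1ℚ) :* f) :- con 0ℚ := con 1ℚ :- f :* f) ≈-refl (coef k x)))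
    where
      s = ξ x
      t = η ε
      e₁ : fromℚ 1ℚ ≈ sq (fromℚ 1ℚ)
      e₁ = solve 0 (con 1ℚ := con 1ℚ :* con 1ℚ) ≈-refl
      e₂ : fromℚ 1ℚ ≈ sq (fromℚ (ℚ.- 1ℚ))
      e₂ = solve 0 (con 1ℚ := con (ℚ.- 1ℚ) :* con (ℚ.- 1ℚ)) ≈-refl
      -- Half of ‖ xξ + w η ‖² ≥ 0 for w = ±1.
      both : ∀ w → sq w ≈ fromℚ 1ℚ → 0# ≤ fromℚ 1ℚ + w * coef k x
      both w w²≈1 = ≤-by (*-monoˡ 0≤half (+-mono-≤ (psd k ((fromℚ 1ℚ , s) ∷ (w , t) ∷ [])) (+-mono-≤ (κ-diag k s) (*-monoˡ (sq-nonneg w) (κ-diag k t)))))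
        (≈-trans (+-cong (*-cong ≈-refl (+-cong expand (+-cong (≈-sym fromℚ-1) (*-cong ≈-refl (≈-sym fromℚ-1))))) (-‿cong (*-cong ≈-refl (+-cong (≈-sym fromℚ-0) ≈-refl))))
          (≈-trans (solve 5 (λ ss st tt w v → con ½ :* ((ss :+ (w :* st :+ w :* st) :+ v :* tt) :+ (con 1ℚ :+ v :* con 1ℚ)) :- con ½ :* (con 0ℚ :+ (ss :+ v :* tt)) := con ½ :* (con 1ℚ :+ v) :+ w :* st) ≈-refl (κ k s s) (κ k s t) (κ k t t) w (sq w))
            (≈-trans (+-cong (*-cong ≈-refl (+-cong ≈-refl w²≈1)) ≈-refl) (≈-trans (solve 1 (λ y → con ½ :* (con 1ℚ :+ con 1ℚ) :+ y := con 1ℚ :+ y :- con 0ℚ) ≈-refl _) (+-cong ≈-refl (-‿cong fromℚ-0))))))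
        where
          expand : I ((fromℚ 1ℚ , s) ∷ (w , t) ∷ []) (λ s′ → I ((fromℚ 1ℚ , s) ∷ (w , t) ∷ []) (κ k s′)) ≈ κ k s s + (w * κ k s t + w * κ k s t) + sq w * κ k t t
          expand = ≈-trans (+-cong (*-cong ≈-refl (+-cong ≈-refl (+-identityʳ _))) (≈-trans (+-identityʳ _) (*-cong ≈-refl (+-cong (*-cong ≈-refl (κ-sym k t s)) (+-identityʳ _)))))
            (solve 4 (λ ss st tt w → con 1ℚ :* (con 1ℚ :* ss :+ w :* st) :+ w :* (con 1ℚ :* st :+ w :* tt) := ss :+ (w :* st :+ w :* st) :+ (w :* w) :* tt) ≈-refl (κ k s s) (κ k s t) (κ k t t) w)

  Upper-double : ∀ c d {r} → (∀ x → coef c x ≈ coef d x + coef d x) → Upper d r → Upper c ((r + r) + (r + r))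
  Upper-double c d {r} e (μ , u) = μ , λ x → ≤-respˡ
    (≈-trans (+-cong (≈-sym (E-+ μ _ _)) (≈-sym (E-+ μ _ _))) (≈-trans (≈-sym (E-+ μ _ _)) (E-cong μ λ g →
      ≈-trans (solve 1 (λ x → (x :* x :+ x :* x) :+ (x :* x :+ x :* x) := (x :+ x) :* (x :+ x)) ≈-refl (coef d (g ⁻¹ ∙ x))) (sq-cong (≈-sym (e _))))))
    (+-mono-≤ (+-mono-≤ (u x) (u x)) (+-mono-≤ (u x) (u x)))

  -- The two bounds are witnessed by different measures, so (a + b)² ≤ 2a² + 2b² cannot be averaged
  -- directly. Instead a + b is twice the half difference of a and -b, to which `parallelogram`
  -- applies with a negative q, attained by no kernel.
  Upper-+ : ∀ a b c {r s e} → (∀ x → coef c x ≈ coef a x + coef b x) → Upper a r → Upper b s → Pos e →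
            Upper c ((r + r) + (s + s) + e)
  Upper-+ a b c {r} {s} {e} sum ua ub 0<e = Upper-mono {c} (≤-reflexive
      (solve 3 (λ r s e → let e′ = con ½ :* (con ½ :* (con ½ :* e)) ; t = con ½ :* r :+ con ½ :* s :- (:- e′) :+ e′ in
         (t :+ t) :+ (t :+ t) := (r :+ r) :+ (s :+ s) :+ e) ≈-refl r s e))
    (Upper-double c (difference a (negate b)) (λ x → ≈-trans (sum x)
       (≈-trans (solve 2 (λ a b → a :+ b := con ½ :* (a :- (:- b)) :+ con ½ :* (a :- (:- b))) ≈-refl (coef a x) (coef b x))
         (+-cong (e₁ x) (e₁ x))))
      (parallelogram a (negate b) 0<e′ ua (Upper-cong b (negate b) (λ x → ≈-sym (≈-trans (sq-cong (negate-coef b x)) (solve 1 (λ x → (:- x) :* (:- x) := x :* x) ≈-refl (coef b x)))) ub)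
        λ h → ¬Pos-0 (Pos-mono (≤-by (Upper-nonneg (average a (negate b)) h) (≈-trans (+-cong ≈-refl (-‿cong (≈-sym fromℚ-0)))
           (≈-trans (solve 1 (λ e → (:- e) :- con 0ℚ := con 0ℚ :- e) ≈-refl e′) (+-cong fromℚ-0 ≈-refl)))) 0<e′)))
    where
      e′ = half * (half * (half * e))
      0<e′ : Pos e′
      0<e′ = Pos-* Pos-half (Pos-* Pos-half (Pos-* Pos-half 0<e))
      e₁ : ∀ x → half * (coef a x - - coef b x) ≈ coef (difference a (negate b)) x
      e₁ x = ≈-sym (≈-trans (difference-coef a (negate b) x) (*-cong ≈-refl (+-cong ≈-refl (-‿cong (negate-coef b x)))))

  Upper-untwist : ∀ τ k {r} → Upper k r → Upper (twist τ k) r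
  Upper-untwist τ k (μ , u) = mapᴹ from μ , λ x → ≤-respˡ
      (≈-sym (≈-trans (E-map from μ _) (E-cong μ λ g → sq-cong (≈-trans (twist-coef τ k _) (coef-cong k (shift g x)))))) (u (to x))
    where
      open Automorphism τ
      shift : ∀ g x → to (from g ⁻¹ ∙ x) ∼ g ⁻¹ ∙ to x
      shift g x = 𝔾.trans (to-∙ _ _) (𝔾.∙-congʳ (𝔾.trans (to-⁻¹ τ (from g)) (𝔾.⁻¹-cong (to-from g))))

  -- Support points are addressed by paths, which makes the addresses countable and independent of
  -- μ. Paths that stop early give ε, and what follows a leaf is ignored.
  at : Mix Γ → List Bool → Γ
  at (leaf x)  _           = x
  at (mid μ ν) []          = ε
  at (mid μ ν) (false ∷ p) = at μ p
  at (mid μ ν) (true ∷ p)  = at ν p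

  E-cong-at : ∀ μ {φ ψ} → (∀ p → φ (at μ p) ≈ ψ (at μ p)) → E μ φ ≈ E μ ψ
  E-cong-at (leaf x)  e = e []
  E-cong-at (mid μ ν) e = *-cong ≈-refl (+-cong (E-cong-at μ λ p → e (false ∷ p)) (E-cong-at ν λ p → e (true ∷ p)))

  ≤-by-rationals : ∀ {x y} → (∀ q → x ≤ fromℚ q → y ≤ fromℚ q) → y ≤ x
  ≤-by-rationals {x} h = ≤-closed λ e 0<e → let q , x≤q , q≤x+e = approx x e 0<e in ≤-trans (h q x≤q) q≤x+e

  δ : ℕ → R
  δ n = fromℚ (dyadic n)

  0<δ : ∀ n → Pos (δ n)
  0<δ n = Pos-fromℚ (0<dyadic n)

  δ-small : ∀ {e} → Pos e → ∃ λ N → ∀ n → N ℕ.≤ n → δ n ≤ e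
  δ-small (pos q 0<q h) = let N , d≤q = dyadic-small 0<q in
    N , λ n le → ≤-trans (≤-trans (fromℚ-mono (dyadic-mono le)) (fromℚ-mono d≤q)) h

  module _ (P Y : Pred Γ c) {C : R} (0<C : Pos C)
           (wide : ∀ k {r b} → 0# ≤ b → Upper k r → (∀ p → P p → b ≤ sq (coef k p)) → b * C ≤ r)
           (k₀ : Ker) (k₀-on : ∀ p → P p → coef k₀ p ≈ C) (k₀-off : ∀ g p → ¬ Y g → P p → coef k₀ (g ∙ p) ≈ 0#)
           where

    Separates : Ker → Set c
    Separates k = (∀ p → P p → coef k p ≈ C) × (∀ g p → ¬ Y g → P p → coef k (g ∙ p) ≈ 0#)

    Separates-average : ∀ {k l} → Separates k → Separates l → Separates (average k l)
    Separates-average (on , off) (on′ , off′) =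
      (λ p p∈ → ≈-trans (*-cong ≈-refl (+-cong (on p p∈) (on′ p p∈))) (solve 1 (λ x → con ½ :* (x :+ x) := x) ≈-refl C)) ,
      (λ g p g∉ p∈ → ≈-trans (*-cong ≈-refl (+-cong (off g p g∉ p∈) (off′ g p g∉ p∈))) (solve 1 (λ x → con ½ :* (x :+ x) := x) ≈-refl 0#))

    Attains : R → Set _
    Attains r = ∃ λ k → Separates k × Upper k r

    threshold : ∀ n → ∃ λ q → Attains (q + δ n) × ¬ Attains q
    threshold n = nearMinimum em Attains (λ r≤s (k , s , u) → k , s , Upper-mono {k} r≤s u) (λ r (k , _ , u) → Upper-nonneg k u)
      (fromℚ 1ℚ , k₀ , (k₀-on , k₀-off) , leaf ε , λ x → sq-coef≤1 k₀ _) (0<δ n)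

    Minimiser : ℕ → Ker → Set c
    Minimiser n k = Separates k × Upper k (proj₁ (threshold n) + δ n)

    minimiser : ∀ n → ∃ (Minimiser n)
    minimiser n = proj₁ (proj₂ (threshold n))

    -- The average of two minimisers separates again, so its mean square cannot reach the threshold,
    -- and the parallelogram law leaves little for the difference.
    Minimiser-close : ∀ n k l → Minimiser n k → Minimiser n l → Upper (difference k l) (δ n + δ n)
    Minimiser-close n k l (sk , uk) (sl , ul) = build (threshold n) uk ul
      where
        build : (t : ∃ λ q → Attains (q + δ n) × ¬ Attains q) → Upper k (proj₁ t + δ n) → Upper l (proj₁ t + δ n) → Upper (difference k l) (δ n + δ n)
        build (q , _ , ¬q) uk ul = Upper-mono {difference k l} (≤-reflexive
            (solve 2 (λ q d → con ½ :* (q :+ d) :+ con ½ :* (q :+ d) :- q :+ d := d :+ d) ≈-refl q (δ n)))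
          (parallelogram k l (0<δ n) uk ul λ u → ¬q (average k l , Separates-average {k} {l} sk sl , u))

    shift : Γ → Ker → Ker
    shift g k = difference (translate g k) k

    shift-coef : ∀ g k x → coef (shift g k) x ≈ half * (coef k (g ⁻¹ ∙ x) - coef k x)
    shift-coef g k x = ≈-trans (difference-coef (translate g k) k x) (*-cong ≈-refl (+-cong (translate-coef g k x) ≈-refl))

    -- The stabiliser of the common limit of the minimisers.  It depends on no
    -- choice, which makes it invariant under the automorphisms preserving P and Y.
    Stab : Γ → Set _
    Stab g = ∀ e → Pos e → ∃ λ N → ∀ n → N ℕ.≤ n → ∀ k → Minimiser n k → Upper (shift g k) e

    Stab-resp : ∀ {g h} → g ∼ h → Stab g → Stab h
    Stab-resp {g} {h} g∼h s e 0<e = let N , u = s e 0<e in N , λ n le k m →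
      Upper-cong (shift g k) (shift h k) (λ x → sq-cong (≈-trans (shift-coef g k x) (≈-trans
        (*-cong ≈-refl (+-cong (coef-cong k (𝔾.∙-congʳ (𝔾.⁻¹-cong g∼h))) ≈-refl)) (≈-sym (shift-coef h k x))))) (u n le k m)

    Stab-ε : Stab ε
    Stab-ε e 0<e = 0 , λ n _ k _ → leaf ε , λ x → ≤-respˡ
      (≈-sym (≈-trans (sq-cong (≈-trans (shift-coef ε k _) (≈-trans (*-cong ≈-refl (≈-trans (+-cong (coef-cong k (𝔾.trans (𝔾.∙-congʳ 𝔾P.ε⁻¹≈ε) (𝔾.identityˡ _))) ≈-refl) (-‿inverseʳ _))) (zeroʳ half)))) (zeroˡ 0#)))
      (Pos⇒0≤ 0<e)

    Stab-⁻¹ : ∀ {g} → Stab g → Stab (g ⁻¹)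
    Stab-⁻¹ {g} s e 0<e = let N , u = s e 0<e in N , λ n le k m →
      Upper-translate (shift g k) (shift (g ⁻¹) k) g (λ x → ≈-trans (sq-cong (shift-coef (g ⁻¹) k x))
        (≈-trans (sq-cong (*-cong ≈-refl (+-cong (coef-cong k (𝔾.∙-congʳ (𝔾P.⁻¹-involutive g))) (-‿cong (coef-cong k (𝔾.sym (𝔾P.\\-leftDividesʳ g x)))))))
          (≈-trans (solve 2 (λ a b → (con ½ :* (a :- b)) :* (con ½ :* (a :- b)) := (con ½ :* (b :- a)) :* (con ½ :* (b :- a))) ≈-refl _ _)
            (sq-cong (≈-sym (shift-coef g k (g ∙ x))))))) (u n le k m)

    Stab-∙ : ∀ {g h} → Stab g → Stab h → Stab (g ∙ h)
    Stab-∙ {g} {h} sg sh e 0<e = combine (sg e′ 0<e′) (sh e′ 0<e′)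
      where
        e′ = half * (half * (half * e))
        0<e′ : Pos e′
        0<e′ = Pos-* Pos-half (Pos-* Pos-half (Pos-* Pos-half 0<e))
        combine : (∃ λ N → ∀ n → N ℕ.≤ n → ∀ k → Minimiser n k → Upper (shift g k) e′) →
                  (∃ λ N → ∀ n → N ℕ.≤ n → ∀ k → Minimiser n k → Upper (shift h k) e′) →
                  ∃ λ N → ∀ n → N ℕ.≤ n → ∀ k → Minimiser n k → Upper (shift (g ∙ h) k) e
        combine (M , u) (N , v) = M ℕ.⊔ N , λ n le k m →
          Upper-mono {shift (g ∙ h) k} (≤-reflexive (solve 1 (λ e → let e′ = con ½ :* (con ½ :* (con ½ :* e)) in (e′ :+ e′) :+ (e′ :+ e′) :+ con ½ :* e := e) ≈-refl e))
            (Upper-+ (translate g (shift h k)) (shift g k) (shift (g ∙ h) k) (sum k)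
              (Upper-translate (shift h k) (translate g (shift h k)) (g ⁻¹) (λ x → sq-cong (translate-coef g (shift h k) x)) (v n (ℕ.≤-trans (ℕ.m≤n⊔m M N) le) k m))
              (u n (ℕ.≤-trans (ℕ.m≤m⊔n M N) le) k m) (Pos-* Pos-half 0<e))
          where
            sum : ∀ k x → coef (shift (g ∙ h) k) x ≈ coef (translate g (shift h k)) x + coef (shift g k) x
            sum k x = ≈-trans (shift-coef (g ∙ h) k x) (≈-trans (*-cong ≈-refl (+-cong (coef-cong k (𝔾.trans (𝔾.∙-congʳ (𝔾P.⁻¹-anti-homo-∙ g h)) (𝔾.assoc _ _ _))) ≈-refl))
              (≈-trans (solve 3 (λ a b c → con ½ :* (a :- c) := con ½ :* (a :- b) :+ con ½ :* (b :- c)) ≈-refl _ (coef k (g ⁻¹ ∙ x)) _)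
                (+-cong (≈-sym (≈-trans (translate-coef g (shift h k) x) (shift-coef h k (g ⁻¹ ∙ x)))) (≈-sym (shift-coef g k x)))))

    Stab⊈∁Y : ∀ {g} → ¬ Y g → ¬ Stab g
    Stab⊈∁Y {g} g∉Y s = absurd (s (half * (b * C)) (Pos-* Pos-half 0<bC))
      where
        b = sq (half * C)
        0<bC : Pos (b * C)
        0<bC = Pos-* (Pos-* (Pos-* Pos-half 0<C) (Pos-* Pos-half 0<C)) 0<C
        absurd : ¬ ∃ λ N → ∀ n → N ℕ.≤ n → ∀ k → Minimiser n k → Upper (shift g k) (half * (b * C))
        absurd (N , u) = step (minimiser N)
          where
            step : ¬ ∃ (Minimiser N)
            step (k , m@((on , off) , _)) = ¬Pos-0 (Pos-mono (≤-by (wide l (sq-nonneg _)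
                (Upper-translate (shift g k) l g (λ x → sq-cong (≈-trans (translate-coef (g ⁻¹) (shift g k) x) (coef-cong (shift g k) (𝔾.∙-congʳ (𝔾P.⁻¹-involutive g))))) (u N ℕ.≤-refl k m)) big)
                (≈-trans (solve 1 (λ x → con ½ :* x :- x := con 0ℚ :- con ½ :* x) ≈-refl (b * C)) (+-cong fromℚ-0 ≈-refl)))
                (Pos-* Pos-half 0<bC))
              where
                -- Moved by g so that at p it compares the values of `k` at p and at gp: it equals
                -- (C - 0)/2 on `P`, and wideness makes its mean square at least b · C.
                l = translate (g ⁻¹) (shift g k)
                big : ∀ p → P p → b ≤ sq (coef l p)
                big p p∈ = ≤-reflexive (sq-cong (≈-sym (≈-trans (translate-coef (g ⁻¹) (shift g k) p) (≈-trans (shift-coef g k _)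
                    (*-cong ≈-refl (≈-trans (+-cong here (-‿cong there)) C-0))))))
                  where
                    here : coef k (g ⁻¹ ∙ ((g ⁻¹) ⁻¹ ∙ p)) ≈ C
                    here = ≈-trans (coef-cong k (𝔾.trans (𝔾.∙-congˡ (𝔾.∙-congʳ (𝔾P.⁻¹-involutive g))) (𝔾P.\\-leftDividesʳ g p))) (on p p∈)
                    there : coef k ((g ⁻¹) ⁻¹ ∙ p) ≈ 0#
                    there = ≈-trans (coef-cong k (𝔾.∙-congʳ (𝔾P.⁻¹-involutive g))) (off g p g∉Y p∈)
                    C-0 : C - 0# ≈ C
                    C-0 = ≈-trans (+-cong ≈-refl (-‿cong (≈-sym fromℚ-0))) (solve 1 (λ c → c :- con 0ℚ := c) ≈-refl C)

    Stab⊆Y : ∀ {g} → Stab g → Y g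
    Stab⊆Y {g} s = decidable-stable em λ g∉Y → Stab⊈∁Y g∉Y s

    -- A translate of the limit is determined by its values on the supports of
    -- almost invariant measures, so that Stab has at most 2^ℵ₀ cosets.
    Code : Set
    Code = ℕ × List Bool × ℚ

    sample : ∀ n → ∃ λ (μ : Mix Γ) → ∀ k′ → SameSource k′ (proj₁ (minimiser n)) → NearlyInvariant μ (δ n) k′
    sample n = rightMean (proj₁ (minimiser n)) (0<δ n)

    code : Γ → Code → Set
    code g (n , p , q) = coef (proj₁ (minimiser n)) (g ⁻¹ ∙ at (proj₁ (sample n)) p) ≤ fromℚ q

    -- Equal codes make the g- and h-translates of the chosen minimiser agree on the support of its
    -- sample measure; their difference has the same source, so its mean square is nearly 0. The
    -- triangle inequality carries this to any other minimiser, which is close to the chosen one.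
    Stab-code : ∀ g h → (∀ i → code g i → code h i) → (∀ i → code h i → code g i) → Stab (h ⁻¹ ∙ g)
    Stab-code g h gh hg e 0<e = finish (δ-small 0<e′)
      where
        z = h ⁻¹ ∙ g
        -- The two uses of `Upper-+` below add up to 27 times δ n; `five` is what remains to 32.
        e′ = half * (half * (half * (half * (half * e))))
        0<e′ : Pos e′
        0<e′ = Pos-* Pos-half (Pos-* Pos-half (Pos-* Pos-half (Pos-* Pos-half (Pos-* Pos-half 0<e))))
        near : ∀ n → Upper (shift z (proj₁ (minimiser n))) (δ n + (δ n + δ n))
        near n = use (minimiser n) (sample n) λ p → ≤-antisym (≤-by-rationals λ q → hg (n , p , q)) (≤-by-rationals λ q → gh (n , p , q))
          where
            use : (m : ∃ (Minimiser n)) (s : ∃ λ (μ : Mix Γ) → ∀ k′ → SameSource k′ (proj₁ m) → NearlyInvariant μ (δ n) k′) →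
                  (∀ p → coef (proj₁ m) (g ⁻¹ ∙ at (proj₁ s) p) ≈ coef (proj₁ m) (h ⁻¹ ∙ at (proj₁ s) p)) →
                  Upper (shift z (proj₁ m)) (δ n + (δ n + δ n))
            use (k , _) (μ , inv) agree = Upper-translate d (shift z k) h same (Upper-mono {d} (≤-reflexive (+-identityˡ _))
                (E≤⇒Upper d {μ} (0<δ n) (inv d source) (≤-reflexive vanish)))
              where
                d = difference (translate g k) (translate h k)
                d-coef : ∀ x → coef d x ≈ half * (coef k (g ⁻¹ ∙ x) - coef k (h ⁻¹ ∙ x))
                d-coef x = ≈-trans (difference-coef (translate g k) (translate h k) x) (*-cong ≈-refl (+-cong (translate-coef g k x) (-‿cong (translate-coef h k x))))
                source : SameSource d k
                source x y = ≈-trans (*-cong ≈-refl (+-cong ≈-refl (weigh-source (- 1#) sq-1≤1 (translate h k) x y))) (solve 1 (λ x → con ½ :* (x :+ x) := x) ≈-refl _)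
                vanish : E μ (λ x → sq (coef d x)) ≈ 0#
                vanish = ≈-trans (E-cong-at μ λ p → ≈-trans (sq-cong (≈-trans (d-coef (at μ p)) (≈-trans (*-cong ≈-refl (≈-trans (+-cong (agree p) ≈-refl) (-‿inverseʳ _))) (zeroʳ half)))) (zeroˡ 0#)) (E-const μ 0#)
                same : ∀ x → sq (coef (shift z k) x) ≈ sq (coef d (h ∙ x))
                same x = sq-cong (≈-trans (shift-coef z k x) (≈-trans (*-cong ≈-refl (+-cong
                    (coef-cong k (𝔾.trans (𝔾.∙-congʳ (𝔾.trans (𝔾P.⁻¹-anti-homo-∙ (h ⁻¹) g) (𝔾.∙-congˡ (𝔾P.⁻¹-involutive h)))) (𝔾.assoc _ _ _)))
                    (-‿cong (coef-cong k (𝔾.sym (𝔾P.\\-leftDividesʳ h x)))))) (≈-sym (d-coef (h ∙ x)))))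
        finish : (∃ λ N → ∀ n → N ℕ.≤ n → δ n ≤ e′) → ∃ λ N → ∀ n → N ℕ.≤ n → ∀ k → Minimiser n k → Upper (shift z k) e
        finish (N , small) = N , λ n le k m → use n (small n le) k m (minimiser n) (near n)
          where
            use : ∀ n → δ n ≤ e′ → ∀ k → Minimiser n k → (m : ∃ (Minimiser n)) → Upper (shift z (proj₁ m)) (δ n + (δ n + δ n)) → Upper (shift z k) e
            use n δ≤e′ k m (l , m′) u = Upper-mono {shift z k}
                (≤-by (+-mono-≤ (16× δ≤e′) (+-mono-≤ (16× δ≤e′) (≤-trans (≤-reflexive fromℚ-0) (Pos⇒0≤ (Pos-* (0<δ n) (Pos-fromℚ (ℚ.positive⁻¹ five)))))))
                  (solve 2 (λ d e → let e′ = con ½ :* (con ½ :* (con ½ :* (con ½ :* (con ½ :* e)))) ; u = d :+ (d :+ d) ; s = ((d :+ d) :+ (d :+ d)) :+ (u :+ u) :+ d in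
                    (x16 e′ :+ (x16 e′ :+ d :* con five)) :- (x16 d :+ (x16 d :+ con 0ℚ)) := e :- ((s :+ s) :+ ((d :+ d) :+ (d :+ d)) :+ d)) ≈-refl (δ n) e))
              (Upper-+ (difference (translate z k) l) (difference l k) (shift z k) sum₂
                (Upper-+ (translate z (difference k l)) (shift z l) (difference (translate z k) l) sum₁
                  (Upper-translate (difference k l) (translate z (difference k l)) (z ⁻¹) (λ x → sq-cong (translate-coef z (difference k l) x)) (Minimiser-close n k l m m′))
                  u (0<δ n))
                (Minimiser-close n l k m′ m) (0<δ n))
              where
                five = 1ℚ ℚ.+ (1ℚ ℚ.+ (1ℚ ℚ.+ (1ℚ ℚ.+ 1ℚ)))
                x2 = λ x → x :+ x
                x16 = λ x → x2 (x2 (x2 (x2 x)))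
                16× : ∀ {a b} → a ≤ b → _
                16× h = let h₂ = +-mono-≤ h h ; h₄ = +-mono-≤ h₂ h₂ ; h₈ = +-mono-≤ h₄ h₄ in +-mono-≤ h₈ h₈
                middle : ∀ x → coef (difference (translate z k) l) x ≈ half * (coef k (z ⁻¹ ∙ x) - coef l x)
                middle x = ≈-trans (difference-coef (translate z k) l x) (*-cong ≈-refl (+-cong (translate-coef z k x) ≈-refl))
                sum₁ : ∀ x → coef (difference (translate z k) l) x ≈ coef (translate z (difference k l)) x + coef (shift z l) x
                sum₁ x = ≈-trans (middle x) (≈-trans (solve 3 (λ a b c → con ½ :* (a :- c) := con ½ :* (a :- b) :+ con ½ :* (b :- c)) ≈-refl _ (coef l (z ⁻¹ ∙ x)) _)
                  (+-cong (≈-sym (≈-trans (translate-coef z (difference k l) x) (difference-coef k l _))) (≈-sym (shift-coef z l x))))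
                sum₂ : ∀ x → coef (shift z k) x ≈ coef (difference (translate z k) l) x + coef (difference l k) x
                sum₂ x = ≈-trans (shift-coef z k x) (≈-trans (solve 3 (λ a b c → con ½ :* (a :- c) := con ½ :* (a :- b) :+ con ½ :* (b :- c)) ≈-refl _ (coef l x) _)
                  (+-cong (≈-sym (middle x)) (≈-sym (difference-coef l k x))))

    module _ (τ : Automorphism) (P-to : ∀ p → P p → P (Automorphism.to τ p)) (Y-to : ∀ g → Y (Automorphism.to τ g) → Y g) where
      open Automorphism τ

      Minimiser-twist : ∀ n k → Minimiser n k → Minimiser n (twist τ k)
      Minimiser-twist n k ((on , off) , u) =
        ((λ p p∈ → ≈-trans (twist-coef τ k p) (on (to p) (P-to p p∈))) ,
         (λ g p g∉ p∈ → ≈-trans (twist-coef τ k _) (≈-trans (coef-cong k (to-∙ g p)) (off (to g) (to p) (λ h → g∉ (Y-to g h)) (P-to p p∈))))) ,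
        Upper-untwist τ k u

      -- Twisting by τ permits replacing `shift (to g) k` by `shift g (twist τ k)`, and twisted
      -- minimisers are again minimisers for the same threshold.
      Stab-to : ∀ {g} → Stab g → Stab (to g)
      Stab-to {g} s e 0<e = let N , u = s e 0<e in N , λ n le k m →
        Upper-twist τ (shift (to g) k) (shift g (twist τ k)) (λ x → sq-cong (≈-trans (shift-coef (to g) k (to x))
          (≈-trans (*-cong ≈-refl (+-cong (≈-trans (coef-cong k (𝔾.trans (𝔾.∙-congʳ (𝔾.sym (to-⁻¹ τ g))) (𝔾.sym (to-∙ _ _)))) (≈-sym (twist-coef τ k _))) (-‿cong (≈-sym (twist-coef τ k x)))))
            (≈-sym (shift-coef g (twist τ k) x)))))
          (u n le (twist τ k) (Minimiser-twist n k m))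

-- Integration of simple functions and the kernel of translates

module Integral (em : ∀ {a} → ExcludedMiddle a) (ℱ : RealField) {c} (G : Group c c) where

  open Reals
  open Averages
  open import Defs using (module GroupSubsets)
  open Kernel em ℱ G
  open Upper em ℱ G
  open import Data.Bool.Base using (Bool; true; false)
  open import Data.Empty using (⊥-elim)
  open import Data.List.Base using (List; []; _∷_; _++_)
  open import Data.Product.Base using (∃; _×_; _,_; proj₁; proj₂)
  open import Data.Rational.Base using (0ℚ; 1ℚ)
  open import Data.Sum.Base using (_⊎_; inj₁; inj₂; [_,_]′)
  open import Level using (Level; _⊔_) renaming (suc to lsuc)
  open import Relation.Nullary using (Dec; yes; no)

  open RealField ℱ
  open Order ℱ
  open Averaging ℱ
  open GroupSubsets G using (_◁_)
  open 𝔾 using (_∙_; ε; _⁻¹) renaming (Carrier to Γ; _≈_ to _∼_)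

  -- A finitely additive invariant content on a lattice of sets. Complements are absent, since those
  -- of closed sets need not be closed; differences are measured through modularity.
  record Content (s : Level) : Set (lsuc (c ⊔ s)) where
    field
      𝕊       : Set s
      set     : 𝕊 → Pred Γ c
      set-resp : ∀ X {x y} → x ∼ y → x ∈ set X → y ∈ set X
      ν       : 𝕊 → R
      _∪ˢ_ _∩ˢ_ : 𝕊 → 𝕊 → 𝕊
      whole none : 𝕊
      _◁ˢ_    : Γ → 𝕊 → 𝕊
      set-∪   : ∀ X Y → set (X ∪ˢ Y) ≐ set X ∪ set Y
      set-∩   : ∀ X Y → set (X ∩ˢ Y) ≐ set X ∩ set Y
      set-◁   : ∀ g X → set (g ◁ˢ X) ≐ g ◁ set X
      ∈-whole : ∀ x → x ∈ set whole
      ∉-none  : ∀ x → x ∉ set none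
      ν-mono  : ∀ X Y → set X ⊆ set Y → ν X ≤ ν Y
      ν-modular : ∀ X Y → ν (X ∪ˢ Y) + ν (X ∩ˢ Y) ≈ ν X + ν Y
      ν-whole : ν whole ≈ 1#
      ν-none  : ν none ≈ 0#
      ν-◁     : ∀ g X → ν (g ◁ˢ X) ≈ ν X

  module _ {s} (𝓒 : Content s) where
    open Content 𝓒

    ν-cong : ∀ X Y → set X ≐ set Y → ν X ≈ ν Y
    ν-cong X Y (p , q) = ≤-antisym (ν-mono X Y p) (ν-mono Y X q)

    private
      to∪ : ∀ X Y {x} → x ∈ set X ⊎ x ∈ set Y → x ∈ set (X ∪ˢ Y)
      to∪ X Y = proj₂ (set-∪ X Y)
      of∪ : ∀ X Y {x} → x ∈ set (X ∪ˢ Y) → x ∈ set X ⊎ x ∈ set Y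
      of∪ X Y = proj₁ (set-∪ X Y)
      to∩ : ∀ X Y {x} → x ∈ set X → x ∈ set Y → x ∈ set (X ∩ˢ Y)
      to∩ X Y p q = proj₂ (set-∩ X Y) (p , q)
      of∩ : ∀ X Y {x} → x ∈ set (X ∩ˢ Y) → x ∈ set X × x ∈ set Y
      of∩ X Y = proj₁ (set-∩ X Y)

    indicator : 𝕊 → Γ → R
    indicator X x = value (em {P = x ∈ set X})
      where
        value : ∀ {a} {A : Set a} → Dec A → R
        value (yes _) = 1#
        value (no _)  = 0#

    indicator-∈ : ∀ X {x} → x ∈ set X → indicator X x ≈ 1#
    indicator-∈ X {x} x∈ with em {P = x ∈ set X}
    ... | yes _ = ≈-refl
    ... | no x∉ = ⊥-elim (x∉ x∈)

    indicator-∉ : ∀ X {x} → x ∉ set X → indicator X x ≈ 0#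
    indicator-∉ X {x} x∉ with em {P = x ∈ set X}
    ... | yes x∈ = ⊥-elim (x∉ x∈)
    ... | no _   = ≈-refl

    indicator-∩ : ∀ X Y x → indicator (X ∩ˢ Y) x ≈ indicator X x * indicator Y x
    indicator-∩ X Y x = cases em em
      where
        cases : Dec (x ∈ set X) → Dec (x ∈ set Y) → _
        cases (yes p) (yes q) = ≈-trans (indicator-∈ (X ∩ˢ Y) (to∩ X Y p q)) (≈-sym (≈-trans (*-cong (indicator-∈ X p) (indicator-∈ Y q)) (*-identityʳ 1#)))
        cases (no p)  _       = ≈-trans (indicator-∉ (X ∩ˢ Y) (λ h → p (proj₁ (of∩ X Y h)))) (≈-sym (≈-trans (*-cong (indicator-∉ X p) ≈-refl) (zeroˡ _)))
        cases _       (no q)  = ≈-trans (indicator-∉ (X ∩ˢ Y) (λ h → q (proj₂ (of∩ X Y h)))) (≈-sym (≈-trans (*-cong ≈-refl (indicator-∉ Y q)) (zeroʳ _)))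

    -- The content of X ∩ (U ∖ V).
    relative : 𝕊 → 𝕊 → 𝕊 → R
    relative U V X = ν (X ∩ˢ U) - ν ((X ∩ˢ U) ∩ˢ V)

    private
      split : ∀ T V Z → (ν (Z ∩ˢ T) - ν ((Z ∩ˢ T) ∩ˢ V)) + (ν T - ν (T ∩ˢ (V ∪ˢ Z))) ≈ ν T - ν (T ∩ˢ V)
      split T V Z = ≈-trans (+-cong (+-cong ≈-refl (-‿cong inter)) (+-cong ≈-refl (-‿cong union)))
        (≈-trans (solve 5 (λ zt i t u tv → (zt :- i) :+ (t :- u) := (t :- tv) :+ ((tv :+ zt) :- (u :+ i))) ≈-refl _ (ν ((T ∩ˢ V) ∩ˢ (Z ∩ˢ T))) _ (ν ((T ∩ˢ V) ∪ˢ (Z ∩ˢ T))) (ν (T ∩ˢ V)))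
          (≈-trans (+-cong ≈-refl (≈-trans (+-cong (≈-sym (ν-modular (T ∩ˢ V) (Z ∩ˢ T))) ≈-refl) (-‿inverseʳ _))) (+-identityʳ _)))
        where
          inter : ν ((Z ∩ˢ T) ∩ˢ V) ≈ ν ((T ∩ˢ V) ∩ˢ (Z ∩ˢ T))
          inter = ν-cong _ _ ((λ h → let zt , v = of∩ _ V h ; z , t = of∩ Z T zt in to∩ _ _ (to∩ T V t v) zt) ,
                              (λ h → let tv , zt = of∩ _ _ h in to∩ _ V zt (proj₂ (of∩ T V tv))))
          union : ν (T ∩ˢ (V ∪ˢ Z)) ≈ ν ((T ∩ˢ V) ∪ˢ (Z ∩ˢ T))
          union = ν-cong _ _
            ((λ h → let t , vz = of∩ T _ h in
               to∪ (T ∩ˢ V) (Z ∩ˢ T) ([ (λ v → inj₁ (to∩ T V t v)) , (λ z → inj₂ (to∩ Z T z t)) ]′ (of∪ V Z vz))) ,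
             (λ h → [ (λ tv → let t , v = of∩ T V tv in to∩ T _ t (to∪ V Z (inj₁ v)))
                    , (λ zt → let z , t = of∩ Z T zt in to∩ T _ t (to∪ V Z (inj₂ z))) ]′ (of∪ (T ∩ˢ V) (Z ∩ˢ T) h)))

      -- U ∖ V is the atom cut out by the sets already processed, and r collects the coefficients of
      -- those containing it; the next set Z splits the atom in two. At the end an inhabited atom
      -- gives r ≥ 0, and an empty one has content 0.
      integral-relative : ∀ (α : Comb 𝕊) r U V →
        (∀ x → x ∈ set U → x ∉ set V → 0# ≤ r + I α (λ X → indicator X x)) →
        0# ≤ r * (ν U - ν (U ∩ˢ V)) + I α (relative U V)
      integral-relative [] r U V h = ≤-respʳ (≈-sym (+-identityʳ _)) (cases em)
        where
          cases : Dec (∃ λ x → x ∈ set U × x ∉ set V) → 0# ≤ r * (ν U - ν (U ∩ˢ V))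
          cases (yes (x , u , v)) = *-nonneg (≤-respʳ (+-identityʳ r) (h x u v)) (≤⇒0≤ (ν-mono _ _ λ h → proj₁ (of∩ U V h)))
          cases (no none) = ≤-reflexive (≈-sym (≈-trans (*-cong ≈-refl (≈-trans (+-cong (ν-cong U (U ∩ˢ V) ((λ {x} u → to∩ U V u (in-V x u em)) , λ h → proj₁ (of∩ U V h))) ≈-refl) (-‿inverseʳ _))) (zeroʳ r)))
            where
              in-V : ∀ x → x ∈ set U → Dec (x ∈ set V) → x ∈ set V
              in-V x u (yes v) = v
              in-V x u (no v)  = ⊥-elim (none (x , u , v))
      integral-relative ((a , Z) ∷ α) r U V h = ≤-respˡ (+-identityˡ 0#) (≤-respʳ total (+-mono-≤ inside outside))
        where
          inside = integral-relative α (r + a) (Z ∩ˢ U) V λ x zu v → let z , u = of∩ Z U zu in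
            ≤-respʳ (≈-trans (+-cong ≈-refl (+-cong (≈-trans (*-cong ≈-refl (indicator-∈ Z z)) (*-identityʳ a)) ≈-refl)) (≈-sym (+-assoc _ _ _))) (h x u v)
          outside = integral-relative α r U (V ∪ˢ Z) λ x u vz →
            ≤-respʳ (+-cong ≈-refl (≈-trans (+-cong (≈-trans (*-cong ≈-refl (indicator-∉ Z (λ z → vz (to∪ V Z (inj₂ z))))) (zeroʳ a)) ≈-refl) (+-identityˡ _))) (h x u (λ v → vz (to∪ V Z (inj₁ v))))
          combine : I α (relative (Z ∩ˢ U) V) + I α (relative U (V ∪ˢ Z)) ≈ I α (relative U V)
          combine = ≈-trans (≈-sym (I-+ α _ _)) (I-cong α λ X → ≈-trans (+-cong (+-cong (ν-cong _ _ (assoc₁ X)) (-‿cong (ν-cong _ _ (assoc₂ X)))) ≈-refl) (split (X ∩ˢ U) V Z))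
            where
              assoc₁ : ∀ X → set (X ∩ˢ (Z ∩ˢ U)) ≐ set (Z ∩ˢ (X ∩ˢ U))
              assoc₁ X = (λ h → let x , zu = of∩ X _ h ; z , u = of∩ Z U zu in to∩ Z _ z (to∩ X U x u)) ,
                         (λ h → let z , xu = of∩ Z _ h ; x , u = of∩ X U xu in to∩ X _ x (to∩ Z U z u))
              assoc₂ : ∀ X → set ((X ∩ˢ (Z ∩ˢ U)) ∩ˢ V) ≐ set ((Z ∩ˢ (X ∩ˢ U)) ∩ˢ V)
              assoc₂ X = (λ h → let p , v = of∩ _ V h in to∩ _ V (proj₁ (assoc₁ X) p) v) ,
                         (λ h → let p , v = of∩ _ V h in to∩ _ V (proj₂ (assoc₁ X) p) v)
          total : ((r + a) * (ν (Z ∩ˢ U) - ν ((Z ∩ˢ U) ∩ˢ V)) + I α (relative (Z ∩ˢ U) V)) + (r * (ν U - ν (U ∩ˢ (V ∪ˢ Z))) + I α (relative U (V ∪ˢ Z)))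
                  ≈ r * (ν U - ν (U ∩ˢ V)) + (a * relative U V Z + I α (relative U V))
          total = ≈-trans (solve 6 (λ r a y s w t → ((r :+ a) :* y :+ s) :+ (r :* w :+ t) := r :* (y :+ w) :+ (a :* y :+ (s :+ t))) ≈-refl r a _ _ _ _)
            (+-cong (*-cong ≈-refl (split U V Z)) (+-cong ≈-refl combine))

    integral : ∀ (α : Comb 𝕊) → (∀ x → 0# ≤ I α (λ X → indicator X x)) → 0# ≤ I α ν
    integral α h = ≤-respʳ (≈-trans (+-cong (zeroˡ _) (I-cong α simplify)) (+-identityˡ _))
        (integral-relative α 0# whole none λ x _ _ → ≤-respʳ (≈-sym (+-identityˡ _)) (h x))
      where
        simplify : ∀ X → relative whole none X ≈ ν X
        simplify X = ≈-trans (+-cong (ν-cong _ _ ((λ h → proj₁ (of∩ X whole h)) , λ {x} h → to∩ X whole h (∈-whole x)))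
            (-‿cong (≈-trans (ν-cong _ none ((λ h → proj₂ (of∩ _ none h)) , λ {x} h → ⊥-elim (∉-none x h))) (≈-trans ν-none (≈-sym fromℚ-0)))))
          (solve 1 (λ x → x :- con 0ℚ := x) ≈-refl (ν X))

    private
      bind : ∀ {a b} {A : Set a} {B : Set b} → Comb A → (A → Comb B) → Comb B
      bind []            f = []
      bind ((r , x) ∷ α) f = reweight (λ r′ y → r′ * r , y) (f x) ++ bind α f

      I-bind : ∀ {a b} {A : Set a} {B : Set b} (α : Comb A) (f : A → Comb B) φ → I (bind α f) φ ≈ I α (λ x → I (f x) φ)
      I-bind []            f φ = ≈-refl
      I-bind ((r , x) ∷ α) f φ = ≈-trans (I-++ (reweight _ (f x)) (bind α f) φ)
        (+-cong (≈-trans (I-reweight (λ _ → r) (λ y → y) (f x) φ) (I-* (f x) r φ)) (I-bind α f φ))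

    -- With ν replaced by evaluation at a point x, the kernel is ϑ weighted by indicators and hence
    -- positive; `integral` transports the positivity from points to ν.
    intersections-schur : ∀ {a} {A : Set a} (ϑ : A → A → R) → PSD ϑ → (X : A → 𝕊) → PSD (λ a b → ν (X a ∩ˢ X b) * ϑ a b)
    intersections-schur ϑ psd X α = ≤-respʳ (rewritten ν) (integral β λ x → ≤-respʳ
        (≈-sym (≈-trans (rewritten (λ Y → indicator Y x)) (I-cong α λ a → I-cong α λ b →
          ≈-trans (*-cong (indicator-∩ (X a) (X b) x) ≈-refl) (solve 3 (λ u v w → (u :* v) :* w := u :* (v :* w)) ≈-refl _ _ _))))
        (PSD-weighted {ϑ = ϑ} (λ a → indicator (X a) x) (λ a → a) psd α))
      where
        β = bind α λ a → reweight (λ r b → r * ϑ a b , X a ∩ˢ X b) α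
        rewritten : ∀ φ → I β φ ≈ I α (λ a → I α (λ b → φ (X a ∩ˢ X b) * ϑ a b))
        rewritten φ = ≈-trans (I-bind α _ φ) (I-cong α λ a → ≈-trans (I-reweight (ϑ a) (λ b → X a ∩ˢ X b) α φ) (I-cong α λ b → *-comm _ _))

    ν≤1 : ∀ X → ν X ≤ 1#
    ν≤1 X = ≤-respʳ ν-whole (ν-mono X whole λ {x} _ → ∈-whole x)

    private
      ◁-cong : ∀ X {g h} → g ∼ h → set (g ◁ˢ X) ⊆ set (h ◁ˢ X)
      ◁-cong X {g} {h} g∼h p = let y , y∈ , e = proj₁ (set-◁ g X) p in proj₂ (set-◁ h X) (y , y∈ , 𝔾.trans e (𝔾.∙-congʳ g∼h))
      ◁-∙ : ∀ X g h → set ((g ∙ h) ◁ˢ X) ≐ g ◁ set (h ◁ˢ X)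
      ◁-∙ X g h =
        (λ p → let y , y∈ , e = proj₁ (set-◁ (g ∙ h) X) p in h ∙ y , proj₂ (set-◁ h X) (y , y∈ , 𝔾.refl) , 𝔾.trans e (𝔾.assoc g h y)) ,
        (λ (z , z∈ , e) → let y , y∈ , e′ = proj₁ (set-◁ h X) z∈ in
          proj₂ (set-◁ (g ∙ h) X) (y , y∈ , 𝔾.trans e (𝔾.trans (𝔾.∙-congˡ e′) (𝔾.sym (𝔾.assoc g h y)))))

    module _ (P Q : 𝕊) where
      translates : 𝒮 → 𝕊
      translates (ξ x) = x ◁ˢ P
      translates (η g) = g ◁ˢ Q

      private
        base : Bool → 𝕊
        base false = P
        base true  = Q
        translates-cong : ∀ {i x y} → x ∼ y → set (translates (i , x)) ⊆ set (translates (i , y))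
        translates-cong {false} = ◁-cong P
        translates-cong {true}  = ◁-cong Q
        translates-⊙ : ∀ g s → set (translates (g ⊙ s)) ≐ g ◁ set (translates s)
        translates-⊙ g (ξ x) = ◁-∙ P g x
        translates-⊙ g (η x) = ◁-∙ Q g x
        shifted : ∀ g s t → set (translates (g ⊙ s) ∩ˢ translates (g ⊙ t)) ≐ set (g ◁ˢ (translates s ∩ˢ translates t))
        shifted g s t =
          (λ h → let p , q = of∩ _ _ h
                     y , y∈ , e = proj₁ (translates-⊙ g s) p
                     z , z∈ , e′ = proj₁ (translates-⊙ g t) q
                 in proj₂ (set-◁ g _) (y , to∩ _ _ y∈ (set-resp (translates t) (𝔾P.∙-cancelˡ g _ _ (𝔾.trans (𝔾.sym e′) e)) z∈) , e)) ,
          (λ h → let y , y∈ , e = proj₁ (set-◁ g _) h ; p , q = of∩ _ _ y∈ in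
                 to∩ _ _ (proj₂ (translates-⊙ g s) (y , p , e)) (proj₂ (translates-⊙ g t) (y , q , e)))

      -- Morally ξ and η are the indicators of `P` and `Q` in L²(ν), on which G acts by translation.
      kernel : Ker
      kernel = record
        { κ      = λ s t → ν (translates s ∩ˢ translates t)
        ; schur  = λ ϑ psd s → intersections-schur ϑ psd (λ a → translates (s a))
        ; κ-sym  = λ s t → ν-cong _ _ ((λ h → let p , q = of∩ _ _ h in to∩ _ _ q p) , (λ h → let p , q = of∩ _ _ h in to∩ _ _ q p))
        ; κ-inv  = λ g s t → ≈-trans (ν-cong _ _ (shifted g s t)) (ν-◁ g _)
        ; κ-cong = λ {i} x∼y t → ν-cong _ _ ((λ h → let p , q = of∩ _ _ h in to∩ _ _ (translates-cong {i} x∼y p) q) ,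
                                           (λ h → let p , q = of∩ _ _ h in to∩ _ _ (translates-cong {i} (𝔾.sym x∼y) p) q))
        ; κ-diag = λ s → ν≤1 _ }

      module _ (Q⊇ : ∀ {x y} → x ∈ set P → y ∈ set P → x ∙ y ∈ set Q) where

        -- Here pP is contained in `Q`, so intersecting with `Q` loses nothing and invariance
        -- applies.
        kernel-on : ∀ p → p ∈ set P → Ker.coef kernel p ≈ ν P
        kernel-on p p∈ = ≈-trans (ν-cong _ (p ◁ˢ P)
            ((λ h → proj₁ (of∩ _ _ h)) , (λ h → let y , y∈ , e = proj₁ (set-◁ p P) h in
              to∩ _ _ h (proj₂ (set-◁ ε Q) (p ∙ y , Q⊇ p∈ y∈ , 𝔾.trans e (𝔾.sym (𝔾.identityˡ _))))))) (ν-◁ p P)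

      kernel-off : ∀ x → (∀ y → y ∈ set P → x ∙ y ∉ set Q) → Ker.coef kernel x ≈ 0#
      kernel-off x off = ≈-trans (ν-cong _ none
          ((λ h → let p , q = of∩ _ _ h
                      y , y∈ , e = proj₁ (set-◁ x P) p
                      z , z∈ , e′ = proj₁ (set-◁ ε Q) q
                  in ⊥-elim (off y y∈ (set-resp Q (𝔾.trans (𝔾.sym (𝔾.identityˡ z)) (𝔾.trans (𝔾.sym e′) e)) z∈))) ,
           (λ {y} h → ⊥-elim (∉-none y h)))) ν-none

    -- Chebyshev's inequality. The multiple b of the indicator of gP lies below the g-translate of
    -- the squared coefficient; averaging over g bounds it by r at every x, and integrating over x
    -- gives the claim.
    wide : ∀ (P : 𝕊) k {r b} → 0# ≤ b → Upper k r → (∀ p → p ∈ set P → b ≤ sq (Ker.coef k p)) → b * ν P ≤ r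
    wide P k {r} {b} 0≤b (μ , u) h = 0≤⇒≤ (≤-respʳ (evaluate ν total ν-whole) (integral α λ x →
        ≤-respʳ (≈-sym (evaluate (λ X → indicator X x) ≈-refl (indicator-∈ whole (∈-whole x)))) (≤⇒0≤ (≤-trans (E-mono μ λ g → pointwise x g em) (u x)))))
      where
        α : Comb 𝕊
        α = (r , whole) ∷ reweight (λ s g → s * (- b) , g ◁ˢ P) (toComb μ)
        evaluate : ∀ φ {y} → E μ (λ g → b * φ (g ◁ˢ P)) ≈ y → φ whole ≈ 1# → I α φ ≈ r - y
        evaluate φ e w = +-cong (≈-trans (*-cong ≈-refl w) (*-identityʳ r))
          (≈-trans (I-reweight (λ _ → - b) (λ g → g ◁ˢ P) (toComb μ) φ) (≈-trans (I-toComb μ _)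
            (≈-trans (E-cong μ λ g → solve 2 (λ b x → (:- b) :* x := (:- con 1ℚ) :* (b :* x)) ≈-refl b _)
              (≈-trans (E-* μ _ _) (≈-trans (solve 1 (λ x → (:- con 1ℚ) :* x := :- x) ≈-refl _) (-‿cong e))))))
        total : E μ (λ g → b * ν (g ◁ˢ P)) ≈ b * ν P
        total = ≈-trans (E-cong μ λ g → *-cong ≈-refl (ν-◁ g P)) (E-const μ _)
        pointwise : ∀ x g → Dec (x ∈ set (g ◁ˢ P)) → b * indicator (g ◁ˢ P) x ≤ sq (Ker.coef k (g ⁻¹ ∙ x))
        pointwise x g (yes x∈) = let y , y∈ , e = proj₁ (set-◁ g P) x∈ in
          ≤-respˡ (≈-sym (≈-trans (*-cong ≈-refl (indicator-∈ (g ◁ˢ P) x∈)) (*-identityʳ b)))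
            (h _ (set-resp P (𝔾.sym (𝔾.trans (𝔾.∙-congˡ e) (𝔾P.\\-leftDividesʳ g y))) y∈))
        pointwise x g (no x∉) = ≤-respˡ (≈-sym (≈-trans (*-cong ≈-refl (indicator-∉ (g ◁ˢ P) x∉)) (zeroʳ b))) (sq-nonneg _)

open import Defs

-- Closures and products in a topological group

module Topological (em : ∀ {a} → ExcludedMiddle a) {s} (G : Group s s) (τ : Topology (Group.setoid G)) (isTop : IsGroupTopology G τ)
    {J : Set s} (U : J → Group.Carrier G → Set s) (basis : Topology.IsNeighbourhoodBasis τ (Group.ε G) U) where

  open import Data.Empty using (⊥-elim)
  open import Data.Fin.Base using (Fin; zero; suc)
  open import Data.Product.Base using (Σ; ∃; _×_; _,_; proj₁; proj₂)
  open import Data.Sum.Base using (inj₁; inj₂)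
  open import Function.Base using (_∘_)
  open import Relation.Binary.Definitions using (_Respects_)
  open import Relation.Nullary using (¬_; Dec; yes; no)
  open import Relation.Nullary.Decidable using (decidable-stable)
  open import Relation.Unary using (Pred; _∈_; _∉_; _⊆_; _∩_; _∪_; ∁)

  open Group G
  import Algebra.Properties.Group G as GP
  open Topology τ
  open IsGroupTopology isTop
  open GroupSubsets G

  pair : ∀ {a} {A : Set a} → A → A → Fin 2 → A
  pair x y zero    = x
  pair x y (suc _) = y

  open-local : ∀ {S : Pred Carrier s} → (∀ x → x ∈ S → ∃ λ O → Open O × x ∈ O × O ⊆ S) → Open S
  open-local {S} h = open-ext
    ((λ ((x , x∈) , z∈) → proj₂ (proj₂ (proj₂ (h x x∈))) z∈) , (λ {x} x∈ → (x , x∈) , proj₁ (proj₂ (proj₂ (h x x∈)))))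
    (open-⋃ {J = Σ Carrier S} (λ (x , x∈) → proj₁ (h x x∈)) (λ (x , x∈) → proj₁ (proj₂ (h x x∈))))

  ∙-nearby : ∀ {O} → Open O → ∀ x y → x ∙ y ∈ O → ∃ λ V → ∃ λ W → Open V × Open W × x ∈ V × y ∈ W × (∀ {a b} → a ∈ V → b ∈ W → a ∙ b ∈ O)
  ∙-nearby oO x y xy∈ =
    let V , oV , ∈V , V⊆ = ∙-continuous _ oO (pair x y) xy∈
    in V zero , V (suc zero) , oV zero , oV (suc zero) , ∈V zero , ∈V (suc zero) ,
       λ {a} {b} a∈ b∈ → V⊆ (pair a b) λ { zero → a∈ ; (suc zero) → b∈ }

  open-translate : ∀ {O} g → Open O → Open (λ x → g ∙ x ∈ O)
  open-translate g oO = open-local λ x gx∈ →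
    let V , W , oV , oW , g∈V , x∈W , VW⊆ = ∙-nearby oO g x gx∈ in W , oW , x∈W , λ y∈ → VW⊆ g∈V y∈

  Closed-∪ : ∀ {X Y} → Closed X → Closed Y → Closed (X ∪ Y)
  Closed-∪ cX cY = open-ext ((λ (p , q) → λ { (inj₁ x) → p x ; (inj₂ y) → q y }) , (λ h → (h ∘ inj₁) , (h ∘ inj₂))) (open-∩ cX cY)

  Closed-∩ : ∀ {X Y} → Closed X → Closed Y → Closed (X ∩ Y)
  Closed-∩ {X} {Y} cX cY = open-local λ x x∉ → cases x x∉ em
    where
      cases : ∀ x → x ∉ X ∩ Y → Dec (x ∈ X) → ∃ λ O → Open O × x ∈ O × O ⊆ ∁ (X ∩ Y)
      cases x x∉ (yes x∈X) = ∁ Y , cY , (λ x∈Y → x∉ (x∈X , x∈Y)) , λ y∉ (_ , y∈) → y∉ y∈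
      cases x x∉ (no x∉X)  = ∁ X , cX , x∉X , λ y∉ (y∈ , _) → y∉ y∈

  Closed-◁ : ∀ {X} g → Closed X → Closed (g ◁ X)
  Closed-◁ {X} g cX = open-ext
    ((λ {x} h (y , y∈ , e) → open-resp cX (trans (∙-congˡ e) (GP.\\-leftDividesʳ g y)) h y∈) ,
     (λ {x} h x∈ → h (g ⁻¹ ∙ x , x∈ , sym (GP.\\-leftDividesˡ g x))))
    (open-translate (g ⁻¹) cX)

  Closed-⁻ˢ : ∀ {X} → X Respects _≈_ → Closed X → Closed (X ⁻ˢ)
  Closed-⁻ˢ {X} resp cX = open-ext
    ((λ {x} h (y , y∈ , e) → h (resp (trans (sym (GP.⁻¹-involutive y)) (⁻¹-cong (sym e))) y∈)) ,
     (λ {x} h x∈ → h (x ⁻¹ , x∈ , sym (GP.⁻¹-involutive x))))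
    (⁻¹-continuous _ cX)

  -- The closure computed from the basis; unlike cl it does not raise the level.
  closure : Pred Carrier s → Pred Carrier s
  closure X x = ∀ j → ∃ λ u → u ∈ U j × x ∙ u ∈ X

  module _ {X : Pred Carrier s} (resp : X Respects _≈_) where

    avoid : ∀ {x} j → (∀ u → u ∈ U j → x ∙ u ∉ X) → ∃ λ O → Open O × x ∈ O × (∀ z → z ∈ O → z ∉ X)
    avoid {x} j h = let O , oO , ε∈ , O⊆ = proj₁ basis j in
      (λ z → x ⁻¹ ∙ z ∈ O) , open-translate (x ⁻¹) oO , open-resp oO (sym (inverseˡ x)) ε∈ ,
      λ z z∈ z∈X → h (x ⁻¹ ∙ z) (O⊆ z∈) (resp (sym (GP.\\-leftDividesˡ x z)) z∈X)

    cl⇒closure : cl X ⊆ closure X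
    cl⇒closure {x} h j = let O , oO , ε∈ , O⊆ = proj₁ basis j
                             z , z∈O , z∈X = h (λ z → x ⁻¹ ∙ z ∈ O) (open-translate (x ⁻¹) oO) (open-resp oO (sym (inverseˡ x)) ε∈)
                         in x ⁻¹ ∙ z , O⊆ z∈O , resp (sym (GP.\\-leftDividesˡ x z)) z∈X

    Closed-closure : Closed (closure X)
    Closed-closure = open-local λ x x∉ →
      let j , h = witness x x∉ em ; O , oO , x∈O , O∩X = avoid j h
      in O , oO , x∈O , λ {z} z∈O z∈cl → meets O oO z z∈O z∈cl O∩X
      where
        witness : ∀ x → x ∉ closure X → Dec (∃ λ j → ∀ u → u ∈ U j → x ∙ u ∉ X) → ∃ λ j → ∀ u → u ∈ U j → x ∙ u ∉ X
        witness x x∉ (yes w) = w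
        witness x x∉ (no ¬w) = ⊥-elim (x∉ λ j → decidable-stable em λ none → ¬w (j , λ u u∈ xu∈ → none (u , u∈ , xu∈)))
        meets : ∀ O → Open O → ∀ z → z ∈ O → closure X z → ¬ (∀ z → z ∈ O → z ∉ X)
        meets O oO z z∈O z∈cl O∩X =
          let j , Uj⊆ = proj₂ basis (λ u → z ∙ u ∈ O) ((λ u → z ∙ u ∈ O) , open-translate z oO , open-resp oO (sym (identityʳ z)) z∈O , λ h → h)
              u , u∈ , zu∈ = z∈cl j
          in O∩X _ (Uj⊆ u∈) zu∈

  closure⇒cl : ∀ {X} → closure X ⊆ cl X
  closure⇒cl {X} {x} h O oO x∈O =
    let j , Uj⊆ = proj₂ basis (λ u → x ∙ u ∈ O) ((λ u → x ∙ u ∈ O) , open-translate x oO , open-resp oO (sym (identityʳ x)) x∈O , λ h → h)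
        u , u∈ , xu∈ = h j
    in x ∙ u , Uj⊆ u∈ , xu∈

  closure-resp : ∀ {X} → X Respects _≈_ → closure X Respects _≈_
  closure-resp resp x≈y h j = let u , u∈ , xu∈ = h j in u , u∈ , resp (∙-congʳ x≈y) xu∈

  cl-mono : ∀ {X Y} → X ⊆ Y → cl X ⊆ cl Y
  cl-mono X⊆Y h O oO x∈ = let z , z∈O , z∈X = h O oO x∈ in z , z∈O , X⊆Y z∈X

  ⊆cl : ∀ {X} → X ⊆ cl X
  ⊆cl x∈ O oO x∈O = _ , x∈O , x∈

  cl-closed : ∀ {X} → Closed X → cl X ⊆ X
  cl-closed {X} cX h = decidable-stable em λ x∉ → let z , z∉ , z∈ = h (∁ X) cX x∉ in z∉ z∈

  cl-least : ∀ {X Y} → X ⊆ Y → Closed Y → cl X ⊆ Y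
  cl-least X⊆Y cY h = cl-closed cY (cl-mono X⊆Y h)

  cl-idem : ∀ {X Y} → X Respects _≈_ → Y ⊆ cl X → cl Y ⊆ cl X
  cl-idem resp Y⊆ h = closure⇒cl (cl-least (λ y∈ → cl⇒closure resp (Y⊆ y∈)) (Closed-closure resp) h)

  cl-∙ : ∀ {X Y x y} → x ∈ cl X → y ∈ cl Y → x ∙ y ∈ cl (X · Y)
  cl-∙ {x = x} {y} hx hy O oO xy∈ =
    let V , W , oV , oW , x∈V , y∈W , VW⊆ = ∙-nearby oO x y xy∈
        a , a∈V , a∈X = hx V oV x∈V
        b , b∈W , b∈Y = hy W oW y∈W
    in a ∙ b , VW⊆ a∈V b∈W , a , b , a∈X , b∈Y , refl

  cl-⁻¹ : ∀ {X x} → x ∈ cl X → x ⁻¹ ∈ cl (X ⁻ˢ)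
  cl-⁻¹ hx O oO x∈ = let z , z∈O , z∈X = hx _ (⁻¹-continuous O oO) x∈ in z ⁻¹ , z∈O , z , z∈X , refl

  cl-resp : ∀ {X} → cl X Respects _≈_
  cl-resp x≈y h O oO y∈ = h O oO (open-resp oO (sym x≈y) y∈)

  -- {(g , x) | x ∈ X, x⁻¹g ∈ Y}, whose projection to the first coordinate is X · Y.
  Factorisations : Pred Carrier s → Pred Carrier s → Pred (Fin 2 → Carrier) s
  Factorisations X Y v = v (suc zero) ∈ X × (v (suc zero) ⁻¹ ∙ v zero) ∈ Y

  Closed-Factorisations : ∀ {X Y} → Closed X → Closed Y → Topology.Closed (Power τ 2) (Factorisations X Y)
  Closed-Factorisations {X} {Y} cX cY v v∉ = cases em
    where
      Goal = Σ (Fin 2 → Pred Carrier s) λ V → (∀ k → Open (V k)) × (∀ k → v k ∈ V k) × (∀ y → (∀ k → y k ∈ V k) → y ∈ ∁ (Factorisations X Y))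
      cases : Dec (v (suc zero) ∈ X) → Goal
      cases (no x∉)  = pair (λ _ → ⊤′) (∁ X) , (λ { zero → open-U ; (suc zero) → cX }) , (λ { zero → _ ; (suc zero) → x∉ }) , λ y y∈ (p , _) → y∈ (suc zero) p
        where open import Data.Unit.Polymorphic using () renaming (⊤ to ⊤′)
      cases (yes x∈) =
        let V , W , oV , oW , ∈V , ∈W , VW⊆ = ∙-nearby cY (v (suc zero) ⁻¹) (v zero) (λ h → v∉ (x∈ , h))
        in pair W (λ x → x ⁻¹ ∈ V) , (λ { zero → oW ; (suc zero) → ⁻¹-continuous V oV }) , (λ { zero → ∈W ; (suc zero) → ∈V }) ,
           λ y y∈ (_ , q) → VW⊆ (y∈ (suc zero)) (y∈ zero) q

  Closed-· : ∀ {X Y} → X Respects _≈_ → Y Respects _≈_ →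
             Topology.Closed (Power τ 1) (λ y → ∃ λ v → v ∈ Factorisations X Y × (∀ (i : Fin 1) → y i ≈ v zero)) → Closed (X · Y)
  Closed-· {X} {Y} rX rY cl₁ = open-local {S = ∁ (X · Y)} λ g g∉ →
    let V , oV , g∈V , V⊆ = cl₁ (λ _ → g) (λ (v , (p , q) , e) → g∉ (v (suc zero) , v (suc zero) ⁻¹ ∙ g , p , rY (∙-congˡ (sym (e zero))) q , sym (GP.\\-leftDividesˡ _ g)))
    in V zero , oV zero , g∈V zero , λ {z} z∈ (x , y , x∈ , y∈ , e) →
       V⊆ (λ _ → z) (λ { zero → z∈ }) (pair z x , (x∈ , rY (trans (sym (GP.\\-leftDividesʳ x y)) (∙-congˡ (sym e))) y∈) , λ _ → refl)

-- Type-definable subsets of the group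

module TypeDefinability (em : ∀ {a} → ExcludedMiddle a) {ℓ : Level} {L : Language ℓ} (κ : Set ℓ) {M M* : Structure L} (M≼M* : M ≼ M*)
                 (monster : IsMonster κ M M*) (G : DefinableGroup M*) where

  open import Algebra.Bundles using (Group)
  open Definable
  open SmallSets
  import Data.Empty as Empty₀
  open import Data.Empty.Polymorphic using (⊥; ⊥-elim)
  open import Data.Fin.Base using (Fin; zero; suc; _↑ˡ_; _↑ʳ_)
  open import Data.List.Base using (List; []; _∷_)
  open import Data.List.Relation.Unary.All as All using (All; []; _∷_)
  open import Data.List.Relation.Unary.Any using (here; there)
  open import Data.Nat.Base using (ℕ; zero; suc)
  open import Data.Product.Base using (Σ; ∃; _×_; _,_; proj₁; proj₂)
  open import Data.Sum.Base as Sum using (_⊎_; inj₁; inj₂; [_,_]′)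
  open import Data.Unit.Polymorphic using (⊤; tt)
  open import Data.Vec.Base as Vec using (Vec; []; _∷_; _++_; lookup; map; concat; tabulate)
  import Data.Vec.Properties as Vec
  open import Function.Base using (_∘_; id)
  open import Function.Bundles using (_⇔_; mk⇔; Equivalence)
  open import Level using (Lift; lift) renaming (suc to lsuc)
  open import Relation.Binary.Definitions using (_Respects_)
  open import Relation.Binary.PropositionalEquality.Core using (_≡_; refl; sym; trans; cong; cong₂; subst)
  open import Relation.Nullary using (¬_; Dec; yes; no)
  open import Relation.Nullary.Decidable using (decidable-stable)
  open import Relation.Unary using (Pred; _∈_; _≐_; _∩_; _∪_)

  open DefinableGroup G using (dim; dom; graph; isGroupIn; group)
  open IsGroupIn isGroupIn using (graph-∙)
  module 𝕄 = Group group
  open 𝕄 using (_∙_; ε; _⁻¹; Carrier; _≈_)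
  open GroupSubsets group
  open IsMonster monster
  open Equivalence using (to; from)
  import Algebra.Properties.Group group as GP

  C : Set ℓ
  C = ∣ M* ∣

  TameA : Set ℓ → Set ℓ
  TameA = Tame em κ {M = M} large

  Dom : Vec C dim → Set ℓ
  Dom x = M* ⊨ dom [ x ]

  Gr : Vec C dim → Vec C dim → Vec C dim → Set ℓ
  Gr x y z = M* ⊨ graph [ x ++ (y ++ z) ]

  coord : Carrier → Vec C dim
  coord = proj₁

  fixed : ∀ {A : Set ℓ} (p : A → C) {n} (v : Vec C n) (q : Fin n → A) → (∀ i → p (q i) ≡ lookup v i) → map p (tabulate q) ≡ v
  fixed p v q e = trans (sym (Vec.tabulate-∘ p q)) (trans (Vec.tabulate-cong e) (Vec.tabulate∘lookup v))

  module _ {A : Set ℓ} (p : A → C) where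
    open Arg

    Def-dom : ∀ {ms} (a : Arg M* p ms dim) → Def M* p ms (λ e → Dom (val a e))
    Def-dom a = Def-form M* p dom a

    Def-graph : ∀ {ms} (a b c : Arg M* p ms dim) → Def M* p ms (λ e → Gr (val a e) (val b e) (val c e))
    Def-graph a b c = Def-form M* p graph (_⊞_ M* p a (_⊞_ M* p b c))

    v₀ : ∀ {m ms} → Arg M* p (m ∷ ms) m
    v₀ = variable′ M* p (here refl)
    v₁ : ∀ {m m₁ ms} → Arg M* p (m₁ ∷ m ∷ ms) m
    v₁ = variable′ M* p (there (here refl))
    v₂ : ∀ {m m₁ m₂ ms} → Arg M* p (m₁ ∷ m₂ ∷ m ∷ ms) m
    v₂ = variable′ M* p (there (there (here refl)))

    constants : ∀ {ms′} ms (e : Env M* ms) (q : Fin (size ms) → A) → (∀ i → p (q i) ≡ lookup (flat M* {ms} e) i) →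
                ∃ λ (σ : All (Arg M* p ms′) ms) → ∀ e′ → args M* p σ e′ ≡ e
    constants []       tt      q h = [] , λ _ → refl
    constants (m ∷ ms) (y , e) q h =
      let σ , eq = constants ms e (λ i → q (m ↑ʳ i)) (λ i → trans (h (m ↑ʳ i)) (Vec.lookup-++ʳ y (flat M* {ms} e) i))
      in parameter M* p (tabulate (λ i → q (i ↑ˡ size ms))) ∷ σ ,
         λ e′ → cong₂ _,_ (fixed p y _ (λ i → trans (h (i ↑ˡ size ms)) (Vec.lookup-++ˡ y (flat M* {ms} e) i))) (eq e′)

    record TDR (ms : List ℕ) (X : Env M* ms → Set ℓ) : Set (lsuc ℓ) where
      constructor tdr
      field
        {J} : Set ℓ
        S   : J → Env M* ms → Set ℓ
        dfn : ∀ j → Def M* p ms (S j)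
        mem : ∀ e → X e ⇔ (∀ j → S j e)

    Def⇒TDR : ∀ {ms X} → Def M* p ms X → TDR ms X
    Def⇒TDR {X = X} d = tdr {J = ⊤} (λ _ → X) (λ _ → d) λ e → mk⇔ (λ x _ → x) (λ h → h tt)

    TDR-× : ∀ {ms X X′} → TDR ms X → TDR ms X′ → TDR ms (λ e → X e × X′ e)
    TDR-× (tdr S d m) (tdr S′ d′ m′) = tdr [ S , S′ ]′ (λ { (inj₁ j) → d j ; (inj₂ j) → d′ j }) λ e →
      mk⇔ (λ { (x , y) (inj₁ j) → to (m e) x j ; (x , y) (inj₂ j) → to (m′ e) y j })
          (λ h → from (m e) (h ∘ inj₁) , from (m′ e) (h ∘ inj₂))

    TDR-⋂ : ∀ {ms} {K : Set ℓ} {X : K → Env M* ms → Set ℓ} → (∀ k → TDR ms (X k)) → TDR ms (λ e → ∀ k → X k e)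
    TDR-⋂ {K = K} t = tdr {J = Σ K (λ k → TDR.J (t k))} (λ (k , j) → TDR.S (t k) j) (λ (k , j) → TDR.dfn (t k) j) λ e →
      mk⇔ (λ x (k , j) → to (TDR.mem (t k) e) (x k) j) (λ h k → from (TDR.mem (t k) e) λ j → h (k , j))

    TDR-∀ : ∀ {ms} m {X : Env M* (m ∷ ms) → Set ℓ} → TDR (m ∷ ms) X → TDR ms (λ e → ∀ y → X (y , e))
    TDR-∀ m (tdr S d mem) = tdr (λ j e → ∀ y → S j (y , e)) (λ j → Def-∀ M* p m (d j)) λ e →
      mk⇔ (λ x j y → to (mem (y , e)) (x y) j) (λ h y → from (mem (y , e)) λ j → h j y)

    TDR-subst : ∀ {ms ms′ X} → TDR ms X → (σ : All (Arg M* p ms′) ms) → TDR ms′ (λ e → X (args M* p σ e))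
    TDR-subst (tdr S d m) σ = tdr (λ j e → S j (args M* p σ e)) (λ j → Def-subst M* p (d j) σ) λ e → m (args M* p σ e)

  TDR-params : ∀ {A B : Set ℓ} (p : A → C) (q : B → C) (f : A → B) → (∀ a → q (f a) ≡ p a) → ∀ {ms X} → TDR p ms X → TDR q ms X
  TDR-params p q f h (tdr S d m) = tdr S (λ j → Def-params M* p q f h (d j)) m

  -- Compactness.
  TDR-∃ : ∀ {A : Set ℓ} (p : A → C) → TameA A → ∀ {ms} m {X : Env M* (m ∷ ms) → Set ℓ} → TDR p (m ∷ ms) X → TDR p ms (λ e → ∃ λ y → X (y , e))
  -- Indexed by finite lists: the quantifier passes through an intersection only once the family is
  -- closed under finite conjunctions.
  TDR-∃ {A} p tame {ms} m {X} (tdr {J} S d mem) = tdr {J = List J} (λ js e → ∃ λ y → All (λ j → S j (y , e)) js)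
      (λ js → Def-∃ M* p em m (Def-All M* p em d js)) λ e →
      mk⇔ (λ (y , x) js → y , All.universal (to (mem (y , e)) x) js)
          (λ h → let (y , _) , all = realise e h in y , from (mem (y , e)) all)
    where
      -- The entries of `e` are named by finitely many new parameters, so that saturation is applied
      -- to a type in y alone.
      realise : ∀ e → (∀ js → ∃ λ y → All (λ j → S j (y , e)) js) → ∃ λ (e′ : Env M* (m ∷ [])) → ∀ j → S j (proj₁ e′ , e)
      realise e h = saturation M* q saturated (Small-tame em κ {M = M} large (Tame-⊎ em κ {M = M} large tame (Tame-Fin em κ {M = M} large (size ms))))
          (λ j (y , _) → S j (y , e)) dfn λ js → let y , all = h js in (y , tt) , all
        where
          q : A ⊎ Lift ℓ (Fin (size ms)) → C
          q (inj₁ a)        = p a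
          q (inj₂ (lift i)) = lookup (flat M* {ms} e) i
          cs = constants q {m ∷ []} ms e (inj₂ ∘ lift) (λ _ → refl)
          dfn : ∀ j → Def M* q (m ∷ []) (λ (y , _) → S j (y , e))
          dfn j = Def-⇔ M* q (λ (y , _) → ≡⇒⇔ (cong (λ e → S j (y , e)) (proj₂ cs _)))
            (Def-subst M* q (Def-params M* p q inj₁ (λ _ → refl) (d j)) (v₀ q ∷ proj₁ cs))

  -- Points of the group carry a proof of `dom`, whereas formulas speak of bare coordinates; X′ is
  -- unconstrained on tuples outside `dom`.
  TD : ∀ {A : Set ℓ} (p : A → C) → Pred Carrier ℓ → Set (lsuc ℓ)
  TD p X = ∃ λ (X′ : Env M* (dim ∷ []) → Set ℓ) → TDR p (dim ∷ []) X′ × ∀ g → g ∈ X ⇔ X′ (coord g , tt)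

  TD-resp : ∀ {A : Set ℓ} {p : A → C} {X} → TD p X → X Respects _≈_
  TD-resp (X′ , _ , m) {x} {y} x≈y x∈ = from (m y) (subst (λ v → X′ (v , tt)) x≈y (to (m x) x∈))

  TD-ext : ∀ {A : Set ℓ} {p : A → C} {X Y} → X ≐ Y → TD p X → TD p Y
  TD-ext (X⊆ , Y⊆) (X′ , t , m) = X′ , t , λ g → mk⇔ (to (m g) ∘ Y⊆) (X⊆ ∘ from (m g))

  TD-params : ∀ {A B : Set ℓ} {p : A → C} {q : B → C} (f : A → B) → (∀ a → q (f a) ≡ p a) → ∀ {X} → TD p X → TD q X
  TD-params {p = p} {q} f h (X′ , t , m) = X′ , TDR-params p q f h t , m

  TD⇒TypeDefinable : ∀ {A : Set ℓ} {p : A → C} {X} → TD p X → TypeDefinableOver M* p coord X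
  TD⇒TypeDefinable {A} {p} (X′ , tdr {J} S d mem , m) = (λ θ → Lift ℓ (∃ λ j → θ ≡ proj₁ (toFormOver M* p (d j)))) , λ g →
    mk⇔ (λ { x θ (lift (j , refl)) → to (proj₂ (toFormOver M* p (d j)) (coord g)) (to (mem _) (to (m g) x) j) })
        (λ h → from (m g) (from (mem _) λ j → from (proj₂ (toFormOver M* p (d j)) (coord g)) (h _ (lift (j , refl)))))

  TypeDefinable⇒TD : ∀ {A : Set ℓ} {p : A → C} {X} → TypeDefinableOver M* p coord X → TD p X
  TypeDefinable⇒TD {A} {p} {X} (Φ , h) = (λ (x , _) → Realises M* p x Φ) ,
    tdr {J = ∃ Φ} (λ (θ , _) (x , _) → Sat M* p x θ) (λ (θ , _) → fromFormOver M* p θ) (λ _ → mk⇔ (λ r (θ , θ∈) → r θ θ∈) (λ r θ θ∈ → r (θ , θ∈))) , h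

  ≈⇒Gr : ∀ {x y z : Carrier} → x ∙ y ≈ z → Gr (coord x) (coord y) (coord z)
  ≈⇒Gr {x} {y} {z} = from (graph-∙ x y z)

  Gr⇒≈ : ∀ {x y z : Carrier} → Gr (coord x) (coord y) (coord z) → x ∙ y ≈ z
  Gr⇒≈ {x} {y} {z} = to (graph-∙ x y z)

  module _ {A : Set ℓ} {p : A → C} where

    TD-whole : TD p (λ _ → ⊤)
    TD-whole = (λ _ → ⊤) , Def⇒TDR p (Def-⊤ M* p) , λ _ → ⇔-refl

    TD-none : TD p (λ _ → ⊥)
    TD-none = (λ _ → ⊥) , Def⇒TDR p (Def-⊥ M* p) , λ _ → ⇔-refl

    TD-∩ : ∀ {X Y} → TD p X → TD p Y → TD p (X ∩ Y)
    TD-∩ (X′ , t , m) (Y′ , u , n) = _ , TDR-× p t u , λ g → mk⇔ (λ (x , y) → to (m g) x , to (n g) y) (λ (x , y) → from (m g) x , from (n g) y)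

    TD-∪ : ∀ {X Y} → TD p X → TD p Y → TD p (X ∪ Y)
    TD-∪ (X′ , tdr {J} S d mem , m) (Y′ , tdr {K} T e men , n) = (λ z → X′ z ⊎ Y′ z) ,
      tdr {J = J × K} (λ (j , k) z → S j z ⊎ T k z) (λ (j , k) → Def-⊎ M* p em (d j) (e k)) (λ z →
        mk⇔ (λ { (inj₁ x) (j , k) → inj₁ (to (mem z) x j) ; (inj₂ y) (j , k) → inj₂ (to (men z) y k) })
            (λ h → decide z h em)) ,
      λ g → mk⇔ (Sum.map (to (m g)) (to (n g))) (Sum.map (from (m g)) (from (n g)))
      where
        decide : ∀ z → (∀ jk → S (proj₁ jk) z ⊎ T (proj₂ jk) z) → Dec (∃ λ j → ¬ S j z) → X′ z ⊎ Y′ z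
        decide z h (yes (j , ¬s)) = inj₂ (from (men z) λ k → [ (λ s → Empty₀.⊥-elim (¬s s)) , id ]′ (h (j , k)))
        decide z h (no all)       = inj₁ (from (mem z) λ j → decidable-stable em λ ¬s → all (j , ¬s))

    -- Phrased with universal quantifiers, which pass through intersections without compactness. The
    -- identity is recognised as the idempotent of the group, so it needs no parameters.
    TD-⁻ˢ : ∀ {X} → TD p X → TD p (X ⁻ˢ)
    TD-⁻ˢ {X} td@(X′ , t , m) = _ , relation , λ g → mk⇔ (forward g) (backward g)
      where
        relation : TDR p (dim ∷ []) (λ (z , _) → ∀ y → ∀ e → (Dom y × Dom e × Gr e e e × Gr z y e) → X′ (y , tt))
        relation = TDR-∀ p dim (TDR-∀ p dim (implied (Def-× M* p em (Def-dom p (v₁ p)) (Def-× M* p em (Def-dom p (v₀ p)) (Def-× M* p em (Def-graph p (v₀ p) (v₀ p) (v₀ p)) (Def-graph p (v₂ p) (v₁ p) (v₀ p)))))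
            (TDR-subst p t (v₁ p ∷ []))))
          where
            implied : ∀ {ms S Y} → Def M* p ms S → TDR p ms Y → TDR p ms (λ e → S e → Y e)
            implied d (tdr T e n) = tdr _ (λ j → Def-→ M* p d (e j)) λ z → mk⇔ (λ h j s → to (n z) (h s) j) (λ h s → from (n z) λ j → h j s)
        forward : ∀ g → g ∈ X ⁻ˢ → ∀ y e → (Dom y × Dom e × Gr e e e × Gr (coord g) y e) → X′ (y , tt)
        forward g (x , x∈ , g≈x⁻¹) y e (dy , de , eee , gye) = to (m (y , dy)) (TD-resp td {x} {y , dy} (sym y≈x) x∈)
          where
            e≈ε : (e , de) ≈ ε
            e≈ε = GP.identityˡ-unique (e , de) (e , de) (Gr⇒≈ {e , de} {e , de} {e , de} eee)
            y≈x : (y , dy) ≈ x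
            y≈x = trans (GP.inverseʳ-unique g (y , dy) (trans (Gr⇒≈ {g} {y , dy} {e , de} gye) e≈ε)) (trans (𝕄.⁻¹-cong {g} {x ⁻¹} g≈x⁻¹) (GP.⁻¹-involutive x))
        backward : ∀ g → (∀ y e → (Dom y × Dom e × Gr e e e × Gr (coord g) y e) → X′ (y , tt)) → g ∈ X ⁻ˢ
        backward g h = g ⁻¹ , from (m (g ⁻¹)) (h _ _ (proj₂ (g ⁻¹) , proj₂ ε , ≈⇒Gr {ε} {ε} {ε} (𝕄.identityˡ ε) , ≈⇒Gr {g} {g ⁻¹} {ε} (𝕄.inverseʳ g))) ,
                       sym (GP.⁻¹-involutive g)

    TD-· : TameA A → ∀ {X Y} → TD p X → TD p Y → TD p (X · Y)
    TD-· tame (X′ , t , m) (Y′ , u , n) = _ , TDR-∃ p tame dim (TDR-∃ p tame dim (TDR-× p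
        (Def⇒TDR p (Def-× M* p em (Def-dom p (v₁ p)) (Def-× M* p em (Def-dom p (v₀ p)) (Def-graph p (v₁ p) (v₀ p) (v₂ p)))))
        (TDR-× p (TDR-subst p t (v₁ p ∷ [])) (TDR-subst p u (v₀ p ∷ []))))) ,
      λ g → mk⇔ (λ (x , y , x∈ , y∈ , e) → coord x , coord y , (proj₂ x , proj₂ y , ≈⇒Gr {x} {y} {g} (sym e)) , to (m x) x∈ , to (n y) y∈)
                (λ (x , y , (dx , dy , gr) , x∈ , y∈) → (x , dx) , (y , dy) , from (m (x , dx)) x∈ , from (n (y , dy)) y∈ , sym (Gr⇒≈ {x , dx} {y , dy} {g} gr))

    Factorisations-TypeDefinable : ∀ {X Y} → TD p X → TD p Y →
      TypeDefinableOver M* p (λ (v : Fin 2 → Carrier) → concat (tabulate (coord ∘ v))) (λ v → v (suc zero) ∈ X × (v (suc zero) ⁻¹ ∙ v zero) ∈ Y)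
    Factorisations-TypeDefinable {X} {Y} tdX@(X′ , t , m) tdY@(Y′ , u , n) = convert relation
      where
        Rel : Env M* (dim ∷ dim ∷ []) → Set ℓ
        Rel (g , x , _) = X′ (x , tt) × (∀ z → (Dom z × Gr x z g) → Y′ (z , tt))
        relation : TDR p (dim ∷ dim ∷ []) Rel
        relation = TDR-× p (TDR-subst p t (v₁ p ∷ [])) (TDR-∀ p dim (implied (Def-× M* p em (Def-dom p (v₀ p)) (Def-graph p (v₂ p) (v₀ p) (v₁ p))) (TDR-subst p u (v₀ p ∷ []))))
          where
            implied : ∀ {ms S Y} → Def M* p ms S → TDR p ms Y → TDR p ms (λ e → S e → Y e)
            implied d (tdr T e n) = tdr _ (λ j → Def-→ M* p d (e j)) λ z → mk⇔ (λ h j s → to (n z) (h s) j) (λ h s → from (n z) λ j → h j s)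
        iff : ∀ v → (v (suc zero) ∈ X × (v (suc zero) ⁻¹ ∙ v zero) ∈ Y) ⇔ Rel (coord (v zero) , coord (v (suc zero)) , tt)
        iff v = mk⇔ (λ (x∈ , y∈) → to (m x) x∈ , λ z (dz , gr) → to (n (z , dz)) (TD-resp tdY {x ⁻¹ ∙ g} {z , dz} (sym (trans (sym (GP.\\-leftDividesʳ x (z , dz))) (𝕄.∙-congˡ {x ⁻¹} {x ∙ (z , dz)} {g} (Gr⇒≈ {x} {z , dz} {g} gr)))) y∈))
                    (λ (x∈ , h) → from (m x) x∈ , from (n (x ⁻¹ ∙ g)) (h _ (proj₂ (x ⁻¹ ∙ g) , ≈⇒Gr {x} {x ⁻¹ ∙ g} {g} (GP.\\-leftDividesˡ x g))))
          where
            g = v zero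
            x = v (suc zero)
        convert : TDR p (dim ∷ dim ∷ []) Rel → _
        -- `size (dim ∷ dim ∷ [])` and `2 * dim` reduce to the same sum, and `flat` to the same
        -- concatenation, so the formulas serve without renaming.
        convert (tdr {J} S d mem) = (λ θ → Lift ℓ (∃ λ j → θ ≡ Def.formula (d j))) , λ v →
          mk⇔ (λ { h θ (lift (j , refl)) → to (Def.sat (d j) _) (to (mem _) (to (iff v) h) j) })
              (λ h → from (iff v) (from (mem _) λ j → from (Def.sat (d j) _) (h _ (lift (j , refl)))))

  TD-◁ : ∀ {A : Set ℓ} {p : A → C} g {X} → TD p X → TD {A = A ⊎ Lift ℓ (Fin dim)} [ p , (λ (lift i) → lookup (coord g) i) ]′ (g ◁ X)
  TD-◁ {A} {p} g {X} td@(X′ , tdr {J} S d mem , m) = _ , tdr _ dfn (λ _ → ⇔-refl) , λ z →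
      mk⇔ (λ (y , y∈ , e) j x (dx , gr) → to (mem _) (to (m (x , dx)) (TD-resp td {y} {x , dx} (GP.∙-cancelˡ g y (x , dx) (trans (sym e) (sym (Gr⇒≈ {g} {x , dx} {z} gr)))) y∈)) j)
          (λ h → g ⁻¹ ∙ z , from (m (g ⁻¹ ∙ z)) (from (mem _) λ j → h j _ (proj₂ (g ⁻¹ ∙ z) , ≈⇒Gr {g} {g ⁻¹ ∙ z} {z} (GP.\\-leftDividesˡ g z))) , sym (GP.\\-leftDividesˡ g z))
    where
      q : A ⊎ Lift ℓ (Fin dim) → C
      q = [ p , (λ (lift i) → lookup (coord g) i) ]′
      as = tabulate (inj₂ ∘ lift)
      dfn : ∀ j → Def M* q (dim ∷ []) (λ (z , _) → ∀ y → (Dom y × Gr (coord g) y z) → S j (y , tt))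
      dfn j = Def-∀ M* q dim (Def-→ M* q (Def-× M* q em (Def-dom q (v₀ q))
          (Def-⇔ M* q (λ (y , z , _) → ≡⇒⇔ (cong (λ v → Gr v y z) (fixed q (coord g) (inj₂ ∘ lift) λ _ → refl))) (Def-graph q (parameter M* q as) (v₀ q) (v₁ q))))
        (Def-subst M* q (Def-params M* p q inj₁ (λ _ → refl) (d j)) (v₀ q ∷ [])))

-- The lattice of closed type-definable sets

module Measure (em : ∀ {a} → ExcludedMiddle a) (ℱ : RealField) {ℓ : Level} {L : Language ℓ} (κ : Set ℓ) {M M* : Structure L} (M≼M* : M ≼ M*)
                 (monster : IsMonster κ M M*) (G : DefinableGroup M*) (𝒯 : ⋁GroupTopology M* G)
                 (projections : Setting.ProjectionsClosed κ M≼M* G 𝒯) (m : Setting.Mean κ M≼M* G 𝒯) where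

  open Reals
  open Definable
  open SmallSets
  import Data.Empty as Empty₀
  open import Data.Empty.Polymorphic using (⊥; ⊥-elim)
  open import Data.Fin.Base using (Fin; zero; suc)
  open import Data.List.Base using (List)
  open import Data.Nat.Base using (zero; suc)
  open import Data.Product.Base using (_,_)
  open import Data.Rational.Base using (ℚ)
  open import Data.Sum.Base using (_⊎_; inj₁; inj₂; [_,_]′)
  open import Data.Unit.Polymorphic using (⊤; tt)
  open import Data.Vec.Base using (Vec; lookup)
  open import Function.Base using (id)
  open import Function.Bundles using (Equivalence)
  open import Function.Construct.Identity using (⇔-id)
  open import Level using (Lift; lift) renaming (suc to lsuc)
  open import Relation.Binary.Definitions using (_Respects_)
  open import Relation.Binary.PropositionalEquality.Core using (refl)
  open import Relation.Unary using (Pred; _≐_; _∩_; _∪_; Empty)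

  open TypeDefinability em κ M≼M* monster G
  open Setting κ M≼M* G 𝒯 using (Closed; 𝒟; module 𝒟; Mean)
  open DefinableGroup G using (dim; isGroupIn; group)
  open GroupSubsets group
  open ⋁GroupTopology 𝒯 using (topology; family)
  open ⋁Family family using (Index; member)
  open IsMonster monster
  open 𝕄 using (Carrier; _≈_)
  open Equivalence using (to)

  private
    same : M* ≡ₑ M*
    same _ = ⇔-id _

  open Topological em group topology (⋁GroupTopology.isGroupTopology 𝒯 M* same isGroupIn) {Index M*} (member M*)
    (⋁GroupTopology.isBasis 𝒯 M* same isGroupIn) public

  open Cuts em ℱ
  module ℛ = RealField ℱ

  -- Members of the lattice, with few enough parameters that unions stay in it.
  record Block : Set (lsuc ℓ) where
    no-eta-equality
    field
      set    : Pred Carrier ℓ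
      closed : Closed set
      A      : Set ℓ
      tame   : TameA A
      p      : A → C
      td     : TD p set
  open Block public

  abstract
    toD : Block → 𝒟
    toD X = record { set = set X ; closed = closed X ; typeDefinable = A X , Small-tame em κ {M = M} large (tame X) , p X , TD⇒TypeDefinable (td X) }

    toD-set : ∀ X → 𝒟.set (toD X) ≐ set X
    toD-set X = id , id

  resp : ∀ X → set X Respects _≈_
  resp X {x} {y} = TD-resp (td X) {x} {y}

  infixl 6 _∪ᵇ_ _∩ᵇ_
  _∪ᵇ_ _∩ᵇ_ _·ᵇ_ : Block → Block → Block
  X ∪ᵇ Y = record
    { set = set X ∪ set Y ; closed = Closed-∪ (closed X) (closed Y) ; A = A X ⊎ A Y ; tame = Tame-⊎ em κ {M = M} large (tame X) (tame Y)
    ; p = [ p X , p Y ]′ ; td = TD-∪ (TD-params inj₁ (λ _ → refl) (td X)) (TD-params inj₂ (λ _ → refl) (td Y)) }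
  X ∩ᵇ Y = record
    { set = set X ∩ set Y ; closed = Closed-∩ (closed X) (closed Y) ; A = A X ⊎ A Y ; tame = Tame-⊎ em κ {M = M} large (tame X) (tame Y)
    ; p = [ p X , p Y ]′ ; td = TD-∩ (TD-params inj₁ (λ _ → refl) (td X)) (TD-params inj₂ (λ _ → refl) (td Y)) }

  Closed-product : ∀ {A : Set ℓ} {p : A → C} {X Y} → TameA A → TD p X → TD p Y → Closed X → Closed Y → Closed (X · Y)
  Closed-product {A} {p} {X} {Y} tame tdX tdY cX cY = Closed-· {X} {Y} (λ {x} {y} → TD-resp tdX {x} {y}) (λ {x} {y} → TD-resp tdY {x} {y})
    (projections 2 (Factorisations X Y) (A , Small-tame em κ {M = M} large tame , p , Factorisations-TypeDefinable tdX tdY)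
      (Closed-Factorisations cX cY) 1 (λ _ → zero) λ { {zero} {zero} () })

  X ·ᵇ Y = record
    { set = set X · set Y ; closed = Closed-product tm tdX tdY (closed X) (closed Y) ; A = A X ⊎ A Y ; tame = tm
    ; p = [ p X , p Y ]′ ; td = TD-· tm tdX tdY }
    where
      tm = Tame-⊎ em κ {M = M} large (tame X) (tame Y)
      tdX = TD-params {p = p X} {q = [ p X , p Y ]′} inj₁ (λ _ → refl) (td X)
      tdY = TD-params {p = p Y} {q = [ p X , p Y ]′} inj₂ (λ _ → refl) (td Y)

  _◁ᵇ_ : Carrier → Block → Block
  g ◁ᵇ X = record
    { set = g ◁ set X ; closed = Closed-◁ g (closed X) ; A = A X ⊎ Lift ℓ (Fin dim)
    ; tame = Tame-⊎ em κ {M = M} large (tame X) (Tame-Fin em κ {M = M} large dim) ; p = [ p X , (λ (lift i) → lookup (coord g) i) ]′ ; td = TD-◁ g (td X) }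

  nothing whole : Block
  nothing = record
    { set = λ _ → ⊥ ; closed = open-local λ x _ → (λ _ → ⊤) , Topology.open-U topology , tt , λ _ ()
    ; A = Lift ℓ (Fin 0) ; tame = Tame-Fin em κ {M = M} large 0 ; p = λ { (lift ()) } ; td = TD-none }
  whole = record
    { set = λ _ → ⊤ ; closed = open-local λ x h → Empty₀.⊥-elim (h tt)
    ; A = Lift ℓ (Fin 0) ; tame = Tame-Fin em κ {M = M} large 0 ; p = λ { (lift ()) } ; td = TD-whole }

-- Fourfold products of wide sets contain the invariant component

module FourfoldProducts (em : ∀ {a} → ExcludedMiddle a) (ℱ : RealField) {ℓ : Level} {L : Language ℓ} (κ : Set ℓ) {M M* : Structure L} (M≼M* : M ≼ M*)
                 (monster : IsMonster κ M M*) (G : DefinableGroup M*) (𝒯 : ⋁GroupTopology M* G)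
                 (projections : Setting.ProjectionsClosed κ M≼M* G 𝒯) (m : Setting.Mean κ M≼M* G 𝒯) where

  open Reals
  open Averages
  open Definable
  open SmallSets
  open import Data.Bool.Base using (Bool; true)
  import Data.Empty as Empty₀
  open import Data.Empty.Polymorphic using (⊥)
  open import Data.Sum.Base as Sum using ()
  open import Data.Product.Base using (∃; _×_; _,_; proj₁; proj₂)
  open import Data.Rational.Base using (0ℚ; 1ℚ)
  open import Data.Vec.Base as Vec using (Vec; _++_; map)
  import Data.Vec.Properties as Vec
  open import Function.Base using (id)
  open import Function.Bundles using (_⇔_; mk⇔; Equivalence; Inverse)
  open import Level using (Lift; lift) renaming (suc to lsuc)
  open import Relation.Binary.PropositionalEquality.Core using (_≡_; refl; sym; trans; cong; cong₂; subst)
  open import Relation.Nullary using (¬_)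
  open import Relation.Unary using (Pred; _∈_; _⊆_)

  open DefinableGroup G using (dim; dom; graph; group)
  open TypeDefinability em κ M≼M* monster G
  open Measure em ℱ κ M≼M* monster G 𝒯 projections m
  open Cuts em ℱ
  open Integral em ℱ group
  open Upper em ℱ group using (Automorphism)

  open Setting κ M≼M* G 𝒯 using (M-Invariant; IsG⁰⁰⁰; Mean)
  open GroupSubsets group
  open IsMonster monster
  open 𝕄 using (_∙_; ε; _⁻¹; Carrier; _≈_)
  open Equivalence using (to; from)
  open RealField ℱ using (R; 0#; 1#) renaming (_≤_ to _≤ʳ_; _≈_ to _≈ʳ_)
  open Order ℱ using (Pos)
  import Algebra.Properties.Group group as GP

  ι : ∣ M ∣ → C
  ι = _≼_.to M≼M*

  measure : Block → R
  measure X = value (Mean.mean m (toD X))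

  open Setting κ M≼M* G 𝒯 using (module 𝒟)

  private
    ⊆D : ∀ X {x} → x ∈ set X → x ∈ 𝒟.set (toD X)
    ⊆D X = proj₂ (toD-set X)

    D⊆ : ∀ X {x} → x ∈ 𝒟.set (toD X) → x ∈ set X
    D⊆ X = proj₁ (toD-set X)

  measure-mono : ∀ X Y → set X ⊆ set Y → measure X ≤ʳ measure Y
  measure-mono X Y X⊆Y = value-mono _ _ (Mean.monotone m (toD X) (toD Y) λ {x} h → ⊆D Y {x} (X⊆Y (D⊆ X {x} h)))

  measure-modular : ∀ X Y → measure (X ∪ᵇ Y) ℛ.+ measure (X ∩ᵇ Y) ≈ʳ measure X ℛ.+ measure Y
  measure-modular X Y = ℛ.≈-trans (ℛ.+-cong (ℛ.≈-trans
      (value-cong _ _ (Mean.mean-∪ m (toD X) (toD Y) (toD (X ∪ᵇ Y)) (toD (X ∩ᵇ Y))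
        ((λ {x} h → Sum.map (⊆D X {x}) (⊆D Y {x}) (D⊆ (X ∪ᵇ Y) {x} h)) , (λ {x} h → ⊆D (X ∪ᵇ Y) {x} (Sum.map (D⊆ X {x}) (D⊆ Y {x}) h)))
        ((λ {x} h → let p , q = D⊆ (X ∩ᵇ Y) {x} h in ⊆D X {x} p , ⊆D Y {x} q) , (λ {x} (p , q) → ⊆D (X ∩ᵇ Y) {x} (D⊆ X {x} p , D⊆ Y {x} q)))))
      (value-modular (Mean.mean m (toD X)) (Mean.mean m (toD Y)) (Mean.mean m (toD (X ∩ᵇ Y))))) ℛ.≈-refl)
    (ℛ.solve 3 (λ x y w → ((x ℛ.:+ y) ℛ.:- w) ℛ.:+ w ℛ.:= x ℛ.:+ y) ℛ.≈-refl (measure X) (measure Y) (measure (X ∩ᵇ Y)))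

  measure-whole : measure whole ≈ʳ 1#
  measure-whole = ℛ.≈-trans (value-cong _ _ (Mean.mean-G m (toD whole) λ x → ⊆D whole {x} _)) (ℛ.≈-trans (value-fromℚ 1ℚ) ℛ.fromℚ-1)

  measure-nothing : measure nothing ≈ʳ 0#
  measure-nothing = ℛ.≈-trans (value-cong _ _ (Mean.mean-∅ m (toD nothing) λ x h → lower′ (D⊆ nothing {x} h))) (ℛ.≈-trans (value-fromℚ 0ℚ) ℛ.fromℚ-0)
    where
      lower′ : ⊥ {ℓ} → Empty₀.⊥
      lower′ ()

  measure-◁ : ∀ g X → measure (g ◁ᵇ X) ≈ʳ measure X
  measure-◁ g X = value-cong _ _ (Mean.invariant m g (toD X) (toD (g ◁ᵇ X))
    ((λ {x} h → let y , y∈ , e = D⊆ (g ◁ᵇ X) {x} h in y , ⊆D X {y} y∈ , e) , (λ {x} (y , y∈ , e) → ⊆D (g ◁ᵇ X) {x} (y , D⊆ X {y} y∈ , e))))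

  measure-nonneg : ∀ X → 0# ≤ʳ measure X
  measure-nonneg X = Order.≤-respˡ ℱ measure-nothing (measure-mono nothing X λ ())

  measure-∪ : ∀ X Y → measure (X ∪ᵇ Y) ≤ʳ measure X ℛ.+ measure Y
  measure-∪ X Y = Order.≤-respˡ ℱ (ℛ.+-identityʳ (measure (X ∪ᵇ Y))) (Order.≤-respʳ ℱ (measure-modular X Y)
    (ℛ.+-mono-≤ (Order.≤-refl ℱ {measure (X ∪ᵇ Y)}) (measure-nonneg (X ∩ᵇ Y))))

  content : Content (lsuc ℓ)
  content = record
    { 𝕊 = Block ; set = set ; set-resp = λ X {x} {y} → resp X {x} {y} ; ν = measure
    ; _∪ˢ_ = _∪ᵇ_ ; _∩ˢ_ = _∩ᵇ_ ; whole = whole ; none = nothing ; _◁ˢ_ = _◁ᵇ_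
    ; set-∪ = λ X Y → id , id ; set-∩ = λ X Y → id , id ; set-◁ = λ g X → id , id
    ; ∈-whole = λ _ → _ ; ∉-none = λ _ ()
    ; ν-mono = measure-mono ; ν-modular = measure-modular ; ν-whole = measure-whole ; ν-none = measure-nothing ; ν-◁ = measure-◁ }

  Fixes : Aut M* → Set ℓ
  Fixes σ = ∀ a → Aut.to σ (ι a) ≡ ι a

  invariant : ∀ {X} → TD ι X → ∀ σ → Fixes σ → ∀ x y → coord y ≡ map (Aut.to σ) (coord x) → x ∈ X ⇔ y ∈ X
  invariant {X} td σ fix x y e = mk⇔ (λ x∈ → from (h y) λ θ θ∈ → to (moved θ) (to (h x) x∈ θ θ∈)) (λ y∈ → from (h x) λ θ θ∈ → from (moved θ) (to (h y) y∈ θ θ∈))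
    where
      h = proj₂ (TD⇒TypeDefinable td)
      moved : ∀ θ → Sat M* ι (coord x) θ ⇔ Sat M* ι (coord y) θ
      moved (k , φ , a) = ⇔-trans (⊨-aut M* σ φ (coord x ++ map ι a)) (≡⇒⇔ (cong (λ v → M* ⊨ φ [ v ])
        (trans (Vec.map-++ (Aut.to σ) (coord x) (map ι a)) (cong₂ _++_ (sym e) (trans (sym (Vec.map-∘ (Aut.to σ) ι a)) (Vec.map-cong fix a))))))

  act : Aut M* → Carrier → Carrier
  act σ x = map (Aut.to σ) (coord x) , to (⊨-aut M* σ dom (coord x)) (proj₂ x)

  act-∙ : ∀ σ x y → act σ (x ∙ y) ≈ act σ x ∙ act σ y
  act-∙ σ x y = sym (Gr⇒≈ {act σ x} {act σ y} {act σ (x ∙ y)} (subst (λ v → M* ⊨ graph [ v ]) eq (to (⊨-aut M* σ graph _) (≈⇒Gr {x} {y} {x ∙ y} refl))))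
    where
      s = Aut.to σ
      eq : map s (coord x ++ (coord y ++ coord (x ∙ y))) ≡ map s (coord x) ++ (map s (coord y) ++ map s (coord (x ∙ y)))
      eq = trans (Vec.map-++ s (coord x) _) (cong (map s (coord x) ++_) (Vec.map-++ s (coord y) _))

  automorphism : Aut M* → Automorphism
  automorphism σ = record
    { to = act σ
    ; from = λ x → back x , from (⊨-aut M* σ dom (back x)) (subst (λ v → M* ⊨ dom [ v ]) (sym (round x)) (proj₂ x))
    ; to-cong = λ e → cong (map (Aut.to σ)) e
    ; to-∙ = act-∙ σ
    ; to-ε = GP.identityˡ-unique (act σ ε) (act σ ε) (trans (sym (act-∙ σ ε ε)) (cong (map (Aut.to σ)) (𝕄.identityˡ ε)))
    ; to-from = round }
    where
      back : Carrier → Vec C dim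
      back x = map (Inverse.from (Aut.bij σ)) (coord x)
      round : ∀ x → map (Aut.to σ) (back x) ≡ coord x
      round x = trans (sym (Vec.map-∘ (Aut.to σ) (Inverse.from (Aut.bij σ)) (coord x)))
        (trans (Vec.map-cong (Inverse.strictlyInverseˡ (Aut.bij σ)) (coord x)) (Vec.map-id (coord x)))

  -- Classically, a proposition of any level has a copy in Set ℓ.
  Squash : ∀ {a} → Set a → Set ℓ
  Squash P = Lift ℓ (truth em κ {M = M} large P ≡ true)

  squash : ∀ {a} {P : Set a} → P → Squash P
  squash p = lift (truth-true em κ {M = M} large p)

  unsquash : ∀ {a} {P : Set a} → Squash P → P
  unsquash (lift e) = true-truth em κ {M = M} large e

  module _ (P : Block) (P-td : TD ι (set P)) (0<P : Pos (measure P)) where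
    private
      Y : Pred Carrier ℓ
      Y = set P · set P · set P ⁻ˢ · set P ⁻ˢ

      Q : Block
      Q = P ·ᵇ P

      -- Solving for g: as soon as gpP meets PP, the element g lies in P⁴. This is the origin of the
      -- fourfold product.
      ∈Y : ∀ {g p y a b} → p ∈ set P → y ∈ set P → a ∈ set P → b ∈ set P → (g ∙ p) ∙ y ≈ a ∙ b → Y g
      ∈Y {g} {p} {y} {a} {b} p∈ y∈ a∈ b∈ e = (a ∙ b) ∙ y ⁻¹ , p ⁻¹ ,
        (a ∙ b , y ⁻¹ , (a , b , a∈ , b∈ , refl) , (y , y∈ , refl) , refl) , (p , p∈ , refl) ,
        sym (trans (𝕄.∙-congʳ {p ⁻¹} {(a ∙ b) ∙ y ⁻¹} {g ∙ p} (trans (𝕄.∙-congʳ {y ⁻¹} {a ∙ b} {(g ∙ p) ∙ y} (sym e)) (GP.//-rightDividesʳ y (g ∙ p)))) (GP.//-rightDividesʳ p g))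

      open Stabiliser em ℱ group

      k₀ : _
      k₀ = kernel content P Q

      wideP : ∀ k {r b} → _ → _ → _ → _
      wideP k {r} {b} = wide content P k {r} {b}

      on : ∀ p → p ∈ set P → _
      on = kernel-on content P Q (λ {x} {y} x∈ y∈ → x , y , x∈ , y∈ , refl)

      off : ∀ g p → ¬ Y g → p ∈ set P → _
      off g p g∉ p∈ = kernel-off content P Q (g ∙ p) λ y y∈ (a , b , a∈ , b∈ , e) → g∉ (∈Y {g} {p} {y} {a} {b} p∈ y∈ a∈ b∈ e)

      S : Carrier → Set _
      S = Stab (set P) Y 0<P wideP k₀ on off

      -- Minimality of G⁰⁰⁰ concerns predicates in `Set ℓ`, while `Stab` quantifies over kernels and
      -- lies higher.
      H : Pred Carrier ℓ
      H x = Squash (S x)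

      subgroup : IsSubgroup H
      subgroup = record
        { resp = λ {x} {y} e h → squash (Stab-resp (set P) Y 0<P wideP k₀ on off {x} {y} e (unsquash h))
        ; ε-closed = squash (Stab-ε (set P) Y 0<P wideP k₀ on off)
        ; ∙-closed = λ {x} {y} h k → squash (Stab-∙ (set P) Y 0<P wideP k₀ on off {x} {y} (unsquash h) (unsquash k))
        ; ⁻¹-closed = λ {x} h → squash (Stab-⁻¹ (set P) Y 0<P wideP k₀ on off {x} (unsquash h)) }

      Y-td : TD ι Y
      Y-td = TD-· tame-ι (TD-· tame-ι (TD-· tame-ι P-td P-td) (TD-⁻ˢ P-td)) (TD-⁻ˢ P-td)
        where tame-ι = Tame-model em κ {M = M} large

      H-invariant : M-Invariant H
      H-invariant σ fix x y e h = squash (Stab-resp (set P) Y 0<P wideP k₀ on off {act σ x} {y} (sym e)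
        (Stab-to (set P) Y 0<P wideP k₀ on off (automorphism σ) (λ p → to (invariant P-td σ fix p (act σ p) refl)) (λ g → from (invariant Y-td σ fix g (act σ g) refl)) {x} (unsquash h)))

      samples = Tame-samples em κ {M = M} large

      code′ : Carrier → Code (set P) Y 0<P wideP k₀ on off → Set
      code′ = code (set P) Y 0<P wideP k₀ on off

      -- The code of a group element, carried along the embedding of sample positions in `Formulas`,
      -- so that cosets are counted by `Answers`.
      question : Carrier → Formulas em κ {M = M} large → Bool
      question g θ = truth em κ {M = M} large (∃ λ i → proj₁ samples i ≡ θ × code′ g i)

      transfer : ∀ g h → (∀ θ → question g θ ≡ question h θ) → ∀ i → code′ g i → code′ h i
      transfer g h e i c = let j , ej , cj = true-truth em κ {M = M} large {P = ∃ λ j → proj₁ samples j ≡ proj₁ samples i × code′ h j} (trans (sym (e (proj₁ samples i))) (truth-true em κ {M = M} large (i , refl , c)))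
                           in subst (code′ h) (proj₂ samples ej) cj

      H-bounded : BoundedIndex κ H
      H-bounded = Answers em κ {M = M} large question , Small-Answers em κ {M = M} large question , representative em κ {M = M} large question , λ g →
        let h = representative em κ {M = M} large question (answer em κ {M = M} large question g)
            e = representative-answer em κ {M = M} large question g
        in answer em κ {M = M} large question g , h ⁻¹ ∙ g ,
           squash (Stab-code (set P) Y 0<P wideP k₀ on off g h (transfer g h (λ θ → sym (e θ))) (transfer h g e)) , sym (GP.\\-leftDividesˡ h g)

    G⁰⁰⁰⊆P⁴ : ∀ {G⁰⁰⁰} → IsG⁰⁰⁰ G⁰⁰⁰ → G⁰⁰⁰ ⊆ set P · set P · set P ⁻ˢ · set P ⁻ˢ
    G⁰⁰⁰⊆P⁴ (_ , least) {x} x∈ = Stab⊆Y (set P) Y 0<P wideP k₀ on off {x} (unsquash (least H (subgroup , lift H-invariant , H-bounded) x∈))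

-- A point of the invariant component that is wide over the small model

module WidePoints (em : ∀ {a} → ExcludedMiddle a) (ℱ : RealField) {ℓ : Level} {L : Language ℓ} (κ : Set ℓ) {M M* : Structure L} (M≼M* : M ≼ M*)
                 (monster : IsMonster κ M M*) (G : DefinableGroup M*) (𝒯 : ⋁GroupTopology M* G)
                 (projections : Setting.ProjectionsClosed κ M≼M* G 𝒯) (m : Setting.Mean κ M≼M* G 𝒯) where

  open Reals
  open Averages
  open Definable
  open SmallSets
  import Data.Empty as Empty₀
  open import Data.Empty.Polymorphic using (⊥; ⊥-elim)
  open import Data.Fin.Base using (Fin; zero; suc; _↑ˡ_)
  open import Data.List.Base using (List; []; _∷_)
  open import Data.List.Relation.Unary.All as All using (All; []; _∷_)
  open import Data.List.Relation.Unary.Any using (here; there)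
  open import Data.Nat.Base using (zero; suc; _+_)
  open import Data.Product.Base using (Σ; ∃; _×_; _,_; proj₁; proj₂)
  open import Data.Sum.Base as Sum using (_⊎_; inj₁; inj₂; [_,_]′)
  open import Data.Unit.Polymorphic using (tt)
  open import Data.Vec.Base as Vec using (Vec; []; _∷_; _++_; lookup; map; tabulate; allFin)
  import Data.Vec.Properties as Vec
  open import Function.Base using (_∘_; id)
  open import Function.Bundles using (_⇔_; mk⇔; Equivalence)
  open import Function.Construct.Identity using (⇔-id)
  open import Level using (Lift; lift; lower)
  open import Relation.Binary.PropositionalEquality.Core using (_≡_; refl; sym; trans; cong; cong₂; subst)
  open import Relation.Nullary using (¬_; Dec; yes; no)
  open import Relation.Nullary.Decidable using (decidable-stable)
  open import Relation.Unary using (Pred; _∈_; _⊆_; _≐_)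

  open DefinableGroup G using (dim; group)
  open TypeDefinability em κ M≼M* monster G
  open Measure em ℱ κ M≼M* monster G 𝒯 projections m
  open FourfoldProducts em ℱ κ M≼M* monster G 𝒯 projections m
  open Setting κ M≼M* G 𝒯 using (M-Invariant)
  open GroupSubsets group
  open ⋁GroupTopology 𝒯 using (family)
  open ⋁Family family using (arity; φ; φ⇒dom)
  open IsMonster monster
  open 𝕄 using (_∙_; ε; _⁻¹; Carrier; _≈_)
  open Equivalence using (to; from)
  open RealField ℱ using (0#) renaming (_≤_ to _≤ʳ_)
  open Order ℱ using (Pos; Pos-mono; ¬Pos-0)
  import Algebra.Properties.Group group as GP

  tame-Fin : ∀ n → TameA (Lift ℓ (Fin n))
  tame-Fin n = Tame-Fin em κ {M = M} large n

  tame-ι : TameA ∣ M ∣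
  tame-ι = Tame-model em κ {M = M} large

  tame-⊎ : ∀ {A B : Set ℓ} → TameA A → TameA B → TameA (A ⊎ B)
  tame-⊎ = Tame-⊎ em κ {M = M} large

  ⊆closure : ∀ {X} → (∀ {x y} → x ≈ y → x ∈ X → y ∈ X) → X ⊆ closure X
  ⊆closure {X} r {x} x∈ = cl⇒closure {X} (λ {a} {b} → r {a} {b}) {x} (⊆cl {X} {x} x∈)

  closure-least : ∀ {X} (Y : Block) → X ⊆ set Y → closure X ⊆ set Y
  closure-least {X} Y X⊆Y {x} x∈ = cl-least {X} {set Y} X⊆Y (closed Y) {x} (closure⇒cl {X} {x} x∈)

  -- Ranging over basic neighbourhoods means an intersection over the formulas φᵢ and a first-order
  -- quantifier over their parameters in the monster model. Hence closing a set adds no parameters.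
  closure-td : ∀ {A : Set ℓ} {p : A → C} {X} → TameA A → TD p X → TD p (closure X)
  closure-td {A} {p} {X} tame (X′ , t , mem) = Rel , relation , λ g → mk⇔ (forward g) (backward g)
    where
      Rel : Env M* (dim ∷ []) → Set ℓ
      Rel (x , _) = ∀ i (y : Vec C (arity i)) → ∃ λ u → M* ⊨ φ i [ u ++ y ] × ∃ λ z → (Dom z × Gr x u z) × X′ (z , tt)
      forward : ∀ g → g ∈ closure X → Rel (coord g , tt)
      forward g h i y = let u , u∈ , gu∈ = h (i , y) in coord u , u∈ , coord (g ∙ u) , (proj₂ (g ∙ u) , ≈⇒Gr {g} {u} {g ∙ u} refl) , to (mem (g ∙ u)) gu∈
      backward : ∀ g → Rel (coord g , tt) → g ∈ closure X
      backward g h (i , y) = let u , u∈ , z , (dz , gr) , z∈ = h i y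
                                 u′ = u , φ⇒dom M* (λ _ → ⇔-id _) i u y u∈
        in u′ , u∈ , from (mem (g ∙ u′)) (subst (λ v → X′ (v , tt)) (sym (Gr⇒≈ {g} {u′} {z , dz} gr)) z∈)
      relation : TDR p (dim ∷ []) Rel
      relation = TDR-⋂ p λ i → TDR-∀ p (arity i) (TDR-∃ p tame dim (TDR-× p (Def⇒TDR p (Def-form M* p (φ i) (_⊞_ M* p (v₀ p) (v₁ p))))
        (TDR-∃ p tame dim (TDR-× p (Def⇒TDR p (Def-× M* p em (Def-dom p (v₀ p)) (Def-graph p (variable′ M* p (there (there (there (here refl))))) (v₁ p) (v₀ p))))
          (TDR-subst p t (v₀ p ∷ []))))))

  points : (Env M* (dim ∷ []) → Set ℓ) → Pred Carrier ℓ
  points S g = S (coord g , tt)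

  points-resp : ∀ S {x y} → x ≈ y → x ∈ points S → y ∈ points S
  points-resp S e = subst (λ v → S (v , tt)) e

  -- Only the finitely many parameters of the defining formula are retained.
  finite-hull : ∀ {A : Set ℓ} {q : A → C} {S} → Def M* q (dim ∷ []) S → Block
  finite-hull {A} {q} {S} (def (k , ψ , a) s) = record
    { set = closure (points S) ; closed = Closed-closure (λ {x} {y} → points-resp S {x} {y}) ; A = Lift ℓ (Fin k) ; tame = tame-Fin k ; p = q′
    ; td = closure-td {X = points S} (tame-Fin k) (S , Def⇒TDR q′ (def (k , ψ , tabulate lift) λ e →
        ⇔-trans (s e) (≡⇒⇔ (cong (λ b → M* ⊨ ψ [ flat M* {dim ∷ []} e ++ b ]) (sym (fixed q′ (map q a) lift λ _ → refl))))) , λ _ → ⇔-refl) }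
    where
      q′ : Lift ℓ (Fin k) → C
      q′ (lift i) = lookup (map q a) i

  abstract
    -- Defined for any `A`, as the parameters below include coset representatives, known to be small
    -- but not tame.
    hull : ∀ {A : Set ℓ} {q : A → C} {S} → Def M* q (dim ∷ []) S → Block
    hull = finite-hull

    hull-set : ∀ {A : Set ℓ} {q : A → C} {S} (d : Def M* q (dim ∷ []) S) → set (hull d) ≐ closure (points S)
    hull-set (def _ _) = id , id

  hull-⊆ : ∀ {A : Set ℓ} {q : A → C} {S} (d : Def M* q (dim ∷ []) S) Y → points S ⊆ set Y → set (hull d) ⊆ set Y
  hull-⊆ {S = S} d Y S⊆Y {x} h = closure-least {points S} Y S⊆Y {x} (proj₁ (hull-set d) {x} h)

  ⊆-hull : ∀ {A : Set ℓ} {q : A → C} {S} (d : Def M* q (dim ∷ []) S) → points S ⊆ set (hull d)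
  ⊆-hull {S = S} d {x} h = proj₂ (hull-set d) {x} (⊆closure {points S} (λ {a} {b} → points-resp S {a} {b}) {x} h)

  hull-mono : ∀ {A B : Set ℓ} {q : A → C} {r : B → C} {S T} (d : Def M* q (dim ∷ []) S) (e : Def M* r (dim ∷ []) T) →
              points S ⊆ points T → measure (hull d) ≤ʳ measure (hull e)
  hull-mono d e S⊆T = measure-mono (hull d) (hull e) λ {x} → hull-⊆ d (hull e) (λ {y} h → ⊆-hull e {y} (S⊆T {y} h)) {x}

  WideOver : ∀ {A : Set ℓ} (q : A → C) → Carrier → Set ℓ
  WideOver {A} q y = ∀ (θ : FormOver A dim) → Sat M* q (coord y) θ → Lift ℓ (Pos (measure (hull (fromFormOver M* q θ))))

  wide-Def : ∀ {A : Set ℓ} {q : A → C} {y} → WideOver q y → ∀ {S} (d : Def M* q (dim ∷ []) S) → y ∈ points S → Pos (measure (hull d))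
  wide-Def {q = q} {y} w d y∈ = let θ , h = toFormOver M* q d in
    Pos-mono (hull-mono (fromFormOver M* q θ) d λ {x} → from (h (coord x))) (lower (w θ (to (h (coord y)) y∈)))

  wide-params : ∀ {A B : Set ℓ} {q : A → C} {r : B → C} (f : B → A) → (∀ b → q (f b) ≡ r b) → ∀ {y} → WideOver q y → WideOver r y
  wide-params {q = q} {r} f h {y} w θ y∈ = lift (Pos-mono (hull-mono d (fromFormOver M* r θ) λ {x} x∈ → x∈) (wide-Def {q = q} {y} w d y∈))
    where d = Def-params M* r q f h (fromFormOver M* r θ)

  -- A filter of wide definable sets is realised by a point that is wide over
  -- any given small set.
  module _ {B : Set ℓ} (r : B → C) (Θ : Pred (FormOver {L = L} B dim) ℓ) {A : Set ℓ} (q : A → C) (f : B → A) (qf≡r : ∀ b → q (f b) ≡ r b) (small : Small κ A) where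
    private
      conj : List (∃ Θ) → Env M* (dim ∷ []) → Set ℓ
      conj ks e = All (λ (θ , _) → Sat M* r (proj₁ e) θ) ks

      conj-Def : ∀ ks → Def M* r (dim ∷ []) (conj ks)
      conj-Def ks = Def-All M* r em (λ (θ , _) → fromFormOver M* r θ) ks

      Null : FormOver A dim → Set
      Null θ = ¬ Pos (measure (hull (fromFormOver M* q θ)))

      Index′ : Set ℓ
      Index′ = ∃ Θ ⊎ Σ (FormOver A dim) Null

      T : Index′ → Env M* (dim ∷ []) → Set ℓ
      T (inj₁ (θ , _)) (x , _) = Sat M* r x θ
      T (inj₂ (θ , _)) (x , _) = Sat M* q x θ → ⊥ {ℓ}

      T-Def : ∀ j → Def M* q (dim ∷ []) (T j)
      T-Def (inj₁ (θ , _)) = Def-params M* r q f qf≡r (fromFormOver M* r θ)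
      T-Def (inj₂ (θ , _)) = Def-→ M* q (fromFormOver M* q θ) (Def-⊥ M* q)

      trues : List Index′ → List (∃ Θ)
      trues []            = []
      trues (inj₁ k ∷ js) = k ∷ trues js
      trues (inj₂ _ ∷ js) = trues js

      nulls : List Index′ → Block
      nulls []                  = nothing
      nulls (inj₁ _ ∷ js)       = nulls js
      nulls (inj₂ (θ , _) ∷ js) = hull (fromFormOver M* q θ) ∪ᵇ nulls js

      ≤0 : ∀ {x} → ¬ Pos x → x ≤ʳ 0#
      ≤0 {x} h = Order.≤-closed⁺ ℱ λ e 0<e → ≤0+e e 0<e (ℛ.≤-total x e)
        where
          ≤0+e : ∀ e → Pos e → x ≤ʳ e ⊎ e ≤ʳ x → x ≤ʳ 0# ℛ.+ e
          ≤0+e e 0<e (inj₁ x≤e) = ℛ.≤-trans x≤e (ℛ.≤-reflexive (ℛ.≈-sym (ℛ.+-identityˡ e)))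
          ≤0+e e 0<e (inj₂ e≤x) = Empty₀.⊥-elim (h (Pos-mono e≤x 0<e))

      nulls-null : ∀ js → measure (nulls js) ≤ʳ 0#
      nulls-null []                   = ℛ.≤-reflexive measure-nothing
      nulls-null (inj₁ _ ∷ js)        = nulls-null js
      nulls-null (inj₂ (θ , nl) ∷ js) = ℛ.≤-trans (measure-∪ (hull (fromFormOver M* q θ)) (nulls js))
        (Order.≤-respʳ ℱ (ℛ.+-identityˡ 0#) (ℛ.+-mono-≤ (≤0 nl) (nulls-null js)))

      sort : ∀ js x → x ∈ points (conj (trues js)) → All (λ j → T j (coord x , tt)) js ⊎ x ∈ set (nulls js)
      sort []                  x h       = inj₁ []
      sort (inj₁ k ∷ js)       x (s ∷ h) = Sum.map₁ (s ∷_) (sort js x h)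
      sort (inj₂ (θ , nl) ∷ js) x h      = decide em (sort js x h)
        where
          decide : Dec (Sat M* q (coord x) θ) → All (λ j → T j (coord x , tt)) js ⊎ x ∈ set (nulls js) →
                   All (λ j → T j (coord x , tt)) (inj₂ (θ , nl) ∷ js) ⊎ x ∈ set (nulls (inj₂ (θ , nl) ∷ js))
          decide (yes s) _        = inj₂ (inj₁ (⊆-hull (fromFormOver M* q θ) {x} s))
          decide (no ¬s) (inj₁ a) = inj₁ ((λ s → Empty₀.⊥-elim (¬s s)) ∷ a)
          decide (no ¬s) (inj₂ n) = inj₂ (inj₂ n)

    realise-wide : (dom∈ : ∃ λ θ → θ ∈ Θ × (∀ x → Sat M* r x θ → Dom x)) → (∀ ks → Pos (measure (hull (conj-Def ks)))) →
                   ∃ λ y → (∀ θ → θ ∈ Θ → Sat M* r (coord y) θ) × WideOver q y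
    realise-wide (θ₀ , θ₀∈ , θ₀-dom) wideΘ = finish (saturation M* q saturated small T T-Def λ js → found js em)
      where
        -- If no point satisfied the finite part, the conjunction of its formulas from Θ would lie
        -- in a finite union of null hulls. That union is closed, so it would contain the hull of
        -- the conjunction, which has positive measure.
        found : ∀ js → Dec (∃ λ (x : Carrier) → All (λ j → T j (coord x , tt)) js) → ∃ λ e → All (λ j → T j e) js
        found js (yes (x , h)) = (coord x , tt) , h
        found js (no none) = Empty₀.⊥-elim (¬Pos-0 (Pos-mono (ℛ.≤-trans
          (measure-mono (hull (conj-Def (trues js))) (nulls js) λ {x} → hull-⊆ (conj-Def (trues js)) (nulls js) (λ {y} h → side y (sort js y h)) {x}) (nulls-null js)) (wideΘ (trues js))))
          where
            side : ∀ y → All (λ j → T j (coord y , tt)) js ⊎ y ∈ set (nulls js) → y ∈ set (nulls js)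
            side y (inj₁ a) = Empty₀.⊥-elim (none (y , a))
            side y (inj₂ n) = n
        finish : (∃ λ e → ∀ j → T j e) → _
        finish ((y , _) , h) = (y , θ₀-dom y (h (inj₁ (θ₀ , θ₀∈)))) , (λ θ θ∈ → h (inj₁ (θ , θ∈))) , λ θ s →
          lift (decidable-stable em λ ¬p → lower′ (h (inj₂ (θ , ¬p)) s))
          where
            lower′ : ⊥ {ℓ} → Empty₀.⊥
            lower′ ()

  module _ {B : Set ℓ} (tame : TameA B) (r : B → C) (y y′ : Carrier) (tp : ∀ θ → Sat M* r (coord y) θ → Sat M* r (coord y′) θ) where
    private
      Params : Set ℓ
      Params = B ⊎ Lift ℓ (Fin dim)

      with-point : Vec C dim → Params → C
      with-point x = [ r , (λ (lift i) → lookup x i) ]′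

      coordinate : Fin dim → Arg M* r (dim ∷ []) 1
      coordinate l = record { source = record { params = [] ; src = λ _ → inj₁ (l ↑ˡ 0) } ; val = λ (x , _) → lookup x l ∷ []
                            ; den = λ { (x , _) zero → sym (Vec.lookup-++ˡ x [] l) } }

      arg : ∀ {k} → Vec Params k → Arg M* r (dim ∷ []) k
      arg []                  = parameter M* r []
      arg (inj₁ b ∷ i)        = _⊞_ M* r (parameter M* r (b ∷ [])) (arg i)
      arg (inj₂ (lift l) ∷ i) = _⊞_ M* r (coordinate l) (arg i)

      arg-val : ∀ {k} (i : Vec Params k) x → Arg.val (arg i) (x , tt) ≡ map (with-point x) i
      arg-val []                  x = refl
      arg-val (inj₁ b ∷ i)        x = cong (r b ∷_) (arg-val i x)
      arg-val (inj₂ (lift l) ∷ i) x = cong (lookup x l ∷_) (arg-val i x)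

      transfer : ∀ {S} → Def M* r (dim ∷ []) S → y ∈ points S → y′ ∈ points S
      transfer d y∈ = let θ , h = toFormOver M* r d in from (h (coord y′)) (tp θ (to (h (coord y)) y∈))

      -- The backward direction is the forward one for the negation of ψ: complete types included in
      -- one another are equal.
      equivalent : ∀ {k} (ψ : Form L k) i → M* ⊨ ψ [ map (with-point (coord y)) i ] ⇔ M* ⊨ ψ [ map (with-point (coord y′)) i ]
      equivalent ψ i = mk⇔
        (λ h → subst (λ v → M* ⊨ ψ [ v ]) (arg-val i (coord y′)) (transfer (Def-form M* r ψ (arg i)) (subst (λ v → M* ⊨ ψ [ v ]) (sym (arg-val i (coord y))) h)))
        (λ h → decidable-stable em λ ¬h → lower′ (transfer (Def-→ M* r (Def-form M* r ψ (arg i)) (Def-⊥ M* r))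
          (λ s → Empty₀.⊥-elim (¬h (subst (λ v → M* ⊨ ψ [ v ]) (arg-val i (coord y)) s))) (subst (λ v → M* ⊨ ψ [ v ]) (sym (arg-val i (coord y′))) h)))
        where
          lower′ : ⊥ {ℓ} → Empty₀.⊥
          lower′ ()

    conjugate : ∃ λ (σ : Aut M*) → (∀ b → Aut.to σ (r b) ≡ r b) × coord y′ ≡ map (Aut.to σ) (coord y)
    conjugate = let σ , h = homogeneous (Small-tame em κ {M = M} large (tame-⊎ tame (tame-Fin dim))) (with-point (coord y)) (with-point (coord y′)) equivalent
      in σ , (λ b → h (inj₁ b)) , lookup-ext (coord y′) (map (Aut.to σ) (coord y)) (λ i → trans (sym (h (inj₂ (lift i)))) (sym (Vec.lookup-map i (Aut.to σ) (coord y))))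

  -- An M-invariant subgroup of bounded index contains a point that is wide over
  -- M.  As the coordinates of a small set of coset representatives are not known
  -- to form a small set, a pair x, y in one coset with y wide over x is reached
  -- by adding the coordinates of x to the base one at a time.
  module _ {H : Pred Carrier ℓ} (subgroup : IsSubgroup H) (H-invariant : M-Invariant H) (bounded : BoundedIndex κ H) where
    open IsSubgroup subgroup renaming (resp to H-resp)
    private
      A′ = proj₁ bounded
      small-A′ = proj₁ (proj₂ bounded)
      rep : A′ → Carrier
      rep = proj₁ (proj₂ (proj₂ bounded))
      cover : ∀ g → ∃ λ a → g ∈ rep a ◁ H
      cover = proj₂ (proj₂ (proj₂ bounded))

      select : ∀ {n} → Carrier → Vec (Fin dim) n → Vec C n
      select x es = map (lookup (coord x)) es

      base : ∀ {n} → Vec C n → ∣ M ∣ ⊎ Lift ℓ (Fin n) → C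
      base v = [ ι , (λ (lift i) → lookup v i) ]′

      base-tame : ∀ n → TameA (∣ M ∣ ⊎ Lift ℓ (Fin n))
      base-tame n = tame-⊎ tame-ι (tame-Fin n)

      State : ∀ {n} → Vec (Fin dim) n → Set ℓ
      State es = ∃ λ x → ∃ λ y → x ⁻¹ ∙ y ∈ H × WideOver (base (select x es)) y

      dom-formula : ∀ {B : Set ℓ} (r : B → C) → ∃ λ (θ : FormOver B dim) → ∀ x → Dom x ⇔ Sat M* r x θ
      dom-formula r = toFormOver M* r (Def-dom r (v₀ r))

      start : State []
      start = build (realise-wide r (λ θ → Lift ℓ (θ ≡ θ₀)) r id (λ _ → refl) (Small-tame em κ {M = M} large (base-tame 0))
          (θ₀ , lift refl , λ x → from (proj₂ (dom-formula r) x)) λ ks → Pos-mono (measure-mono whole (hull (all-Def ks)) λ {x} _ → ⊆-hull (all-Def ks) {x} (everything x ks))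
            (Pos-mono (ℛ.≤-reflexive (ℛ.≈-trans ℛ.fromℚ-1 (ℛ.≈-sym measure-whole))) (Order.Pos-fromℚ ℱ (ℚ.positive⁻¹ 1ℚ))))
        where
          open import Data.Rational.Base using (1ℚ)
          import Data.Rational.Properties as ℚ
          r = base {0} []
          θ₀ = proj₁ (dom-formula r)
          all-Def : ∀ (ks : List (∃ λ θ → Lift ℓ (θ ≡ θ₀))) → Def M* r (dim ∷ []) (λ e → All (λ (θ , _) → Sat M* r (proj₁ e) θ) ks)
          all-Def ks = Def-All M* r em (λ (θ , _) → fromFormOver M* r θ) ks
          everything : ∀ x (ks : List (∃ λ θ → Lift ℓ (θ ≡ θ₀))) → All (λ (θ , _) → Sat M* r (coord x) θ) ks
          everything x []                      = []
          everything x ((_ , lift refl) ∷ ks) = to (proj₂ (dom-formula r) (coord x)) (proj₂ x) ∷ everything x ks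
          build : (∃ λ y → (∀ θ → Lift ℓ (θ ≡ θ₀) → Sat M* r (coord y) θ) × WideOver r y) → State []
          build (y , _ , w) = y , y , H-resp {ε} {y ⁻¹ ∙ y} (sym (𝕄.inverseˡ y)) ε-closed , w

      -- For every coset that meets the tuples agreeing with x so far, one such tuple is chosen and
      -- its j-th coordinate added, which costs one parameter per coset. Let y′ realise tp(y) over
      -- the old base and be wide over the new one. An automorphism over the old base taking y to y′
      -- moves x into the coset of y′; so a tuple x′ was chosen in that coset, and it replaces x.
      step : ∀ {n} (j : Fin dim) (es : Vec (Fin dim) n) → State es → State (j ∷ es)
      step {n} j es (x , y , x⁻¹y∈ , w) = build
          (realise-wide r Θ q inj₁ (λ _ → refl) (Small-⊎ em κ {M = M} large (base-tame n) small-A′)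
            (proj₁ (dom-formula r) , to (proj₂ (dom-formula r) (coord y)) (proj₂ y) , λ z → from (proj₂ (dom-formula r) z))
            λ ks → wide-Def {q = r} {y} w (Def-All M* r em (λ (θ , _) → fromFormOver M* r θ) ks) (All.universal (λ (_ , s) → s) ks))
        where
          v = select x es
          r = base v
          Θ : Pred (FormOver (∣ M ∣ ⊎ Lift ℓ (Fin n)) dim) ℓ
          Θ θ = Sat M* r (coord y) θ
          Reached : A′ → Set ℓ
          Reached a = ∃ λ x′ → x′ ∈ rep a ◁ H × select x′ es ≡ v
          value′ : ∀ {a} → Dec (Reached a) → C
          value′ (yes (x′ , _)) = lookup (coord x′) j
          -- A filler for cosets in which no tuple was chosen; the coset of y′ is shown not to be
          -- one of them.
          value′ (no _)         = lookup (coord ε) j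
          q : (∣ M ∣ ⊎ Lift ℓ (Fin n)) ⊎ A′ → C
          q = [ r , (λ a → value′ (em {P = Reached a})) ]′
          build : (∃ λ y′ → (∀ θ → θ ∈ Θ → Sat M* r (coord y′) θ) × WideOver q y′) → State (j ∷ es)
          build (y′ , tp , w′) = locate (cover y′) (conjugate (base-tame n) r y y′ tp)
            where
              locate : (∃ λ a → y′ ∈ rep a ◁ H) → (∃ λ (σ : Aut M*) → (∀ b → Aut.to σ (r b) ≡ r b) × coord y′ ≡ map (Aut.to σ) (coord y)) → State (j ∷ es)
              locate (a , h , h∈ , y′≈) (σ , fix , σy) = use em reached refl
                where
                  x₁ = act σ x
                  x₁⁻¹y′∈ : x₁ ⁻¹ ∙ y′ ∈ H
                  x₁⁻¹y′∈ = H-resp {act σ (x ⁻¹ ∙ y)} {x₁ ⁻¹ ∙ y′}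
                    (trans (act-∙ σ (x ⁻¹) y) (𝕄.∙-cong {act σ (x ⁻¹)} {x₁ ⁻¹} {act σ y} {y′} inv (sym σy)))
                    (H-invariant σ (λ c → fix (inj₁ c)) (x ⁻¹ ∙ y) (act σ (x ⁻¹ ∙ y)) refl x⁻¹y∈)
                    where
                      inv : act σ (x ⁻¹) ≈ x₁ ⁻¹
                      inv = Upper-to-⁻¹ (automorphism σ) x
                        where open Upper em ℱ group renaming (to-⁻¹ to Upper-to-⁻¹)
                  same-coset : ∀ {x₂} → x₂ ⁻¹ ∙ y′ ∈ H → x₂ ∈ rep a ◁ H
                  same-coset {x₂} k∈ = h ∙ (x₂ ⁻¹ ∙ y′) ⁻¹ , ∙-closed h∈ (⁻¹-closed k∈) ,
                    trans (sym (trans (𝕄.∙-congˡ {y′} {(x₂ ⁻¹ ∙ y′) ⁻¹} {y′ ⁻¹ ∙ x₂} (trans (GP.⁻¹-anti-homo-∙ (x₂ ⁻¹) y′) (𝕄.∙-congˡ {y′ ⁻¹} {(x₂ ⁻¹) ⁻¹} {x₂} (GP.⁻¹-involutive x₂)))) (GP.\\-leftDividesˡ y′ x₂)))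
                      (trans (𝕄.∙-congʳ {(x₂ ⁻¹ ∙ y′) ⁻¹} {y′} {rep a ∙ h} y′≈) (𝕄.assoc (rep a) h ((x₂ ⁻¹ ∙ y′) ⁻¹)))
                  select-σ : ∀ {k} (fs : Vec (Fin dim) k) → (∀ i → Aut.to σ (lookup (select x fs) i) ≡ lookup (select x fs) i) → select x₁ fs ≡ select x fs
                  select-σ []       e = refl
                  select-σ (f ∷ fs) e = cong₂ _∷_ (trans (Vec.lookup-map f (Aut.to σ) (coord x)) (e zero)) (select-σ fs (e ∘ suc))
                  reached : Reached a
                  reached = x₁ , same-coset {x₁} x₁⁻¹y′∈ , select-σ es (λ i → fix (inj₂ (lift i)))
                  -- The equation identifies x′ with the tuple whose coordinate was made a parameter
                  -- of `q`; the witness `reached` itself may be a different tuple.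
                  use : (d : Dec (Reached a)) → Reached a → d ≡ em {P = Reached a} → State (j ∷ es)
                  use (no ¬r) r∈ _ = Empty₀.⊥-elim (¬r r∈)
                  use (yes (x′ , (h′ , h′∈ , x′≈) , sel)) _ d≡ = x′ , y′ , H-resp {h′ ⁻¹ ∙ h} {x′ ⁻¹ ∙ y′} eq (∙-closed (⁻¹-closed h′∈) h∈) ,
                      wide-params {q = q} {base (select x′ (j ∷ es))} g g-eq {y′} w′
                    where
                      eq : h′ ⁻¹ ∙ h ≈ x′ ⁻¹ ∙ y′
                      eq = sym (trans (𝕄.∙-cong {x′ ⁻¹} {h′ ⁻¹ ∙ rep a ⁻¹} {y′} {rep a ∙ h} (trans (𝕄.⁻¹-cong {x′} {rep a ∙ h′} x′≈) (GP.⁻¹-anti-homo-∙ (rep a) h′)) y′≈)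
                        (trans (𝕄.assoc (h′ ⁻¹) (rep a ⁻¹) (rep a ∙ h)) (𝕄.∙-congˡ {h′ ⁻¹} {rep a ⁻¹ ∙ (rep a ∙ h)} {h} (GP.\\-leftDividesʳ (rep a) h))))
                      g : ∣ M ∣ ⊎ Lift ℓ (Fin (suc n)) → (∣ M ∣ ⊎ Lift ℓ (Fin n)) ⊎ A′
                      g (inj₁ c)              = inj₁ (inj₁ c)
                      g (inj₂ (lift zero))    = inj₂ a
                      g (inj₂ (lift (suc i))) = inj₁ (inj₂ (lift i))
                      g-eq : ∀ b → q (g b) ≡ base (select x′ (j ∷ es)) b
                      g-eq (inj₁ c)              = refl
                      g-eq (inj₂ (lift zero))    = cong value′ (sym d≡)
                      g-eq (inj₂ (lift (suc i))) = cong (λ u → lookup u i) (sym sel)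

      run : ∀ {n} (es : Vec (Fin dim) n) → State es
      run []       = start
      run (j ∷ es) = step j es (run es)

    -- If θ over M holds at x⁻¹y, its translate by x contains y and is definable over M and x, hence
    -- wide; by invariance of the mean θ is wide too.
    wide-member : ∃ λ h → h ∈ H × WideOver ι h
    wide-member = build (run (allFin dim))
      where
        build : State (allFin dim) → ∃ λ h → h ∈ H × WideOver ι h
        build (x , y , h∈ , w) = x ⁻¹ ∙ y , h∈ , λ θ s → lift (Pos-mono (ℛ.≤-trans
            (measure-mono (hull (d θ)) (x ◁ᵇ hull (fromFormOver M* ι θ)) λ {z} → hull-⊆ (d θ) (x ◁ᵇ hull (fromFormOver M* ι θ)) (λ {z} (u , (du , gr) , u∈) →
              (u , du) , ⊆-hull (fromFormOver M* ι θ) {u , du} u∈ , sym (Gr⇒≈ {x} {u , du} {z} gr)) {z})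
            (ℛ.≤-reflexive (measure-◁ x (hull (fromFormOver M* ι θ)))))
            (wide-Def {q = q} {y} w (d θ) (coord (x ⁻¹ ∙ y) , (proj₂ (x ⁻¹ ∙ y) , ≈⇒Gr {x} {x ⁻¹ ∙ y} {y} (GP.\\-leftDividesˡ x y)) , s)))
          where
            q = base (select x (allFin dim))
            as = tabulate {n = dim} (λ i → inj₂ {A = ∣ M ∣} (lift {ℓ = ℓ} i))
            x≡ : map q as ≡ coord x
            x≡ = fixed q (coord x) (λ i → inj₂ (lift i)) λ i → trans (Vec.lookup-map i (lookup (coord x)) (allFin dim)) (cong (lookup (coord x)) (Vec.lookup-allFin i))
            d : ∀ θ → Def M* q (dim ∷ []) (λ (z , _) → ∃ λ u → (Dom u × Gr (coord x) u z) × Sat M* ι u θ)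
            d θ = Def-∃ M* q em dim (Def-× M* q em
              (Def-× M* q em (Def-dom q (v₀ q)) (Def-⇔ M* q (λ (u , z , _) → ≡⇒⇔ (cong (λ v → Gr v u z) x≡)) (Def-graph q (parameter M* q as) (v₀ q) (v₁ q))))
              (Def-subst M* q (Def-params M* ι q inj₁ (λ _ → refl) (fromFormOver M* ι θ)) (v₀ q ∷ [])))

-- Closures of the connected components

module Closures (em : ∀ {a} → ExcludedMiddle a) (ℱ : RealField) {ℓ : Level} {L : Language ℓ} (κ : Set ℓ) {M M* : Structure L} (M≼M* : M ≼ M*)
                 (monster : IsMonster κ M M*) (G : DefinableGroup M*) (𝒯 : ⋁GroupTopology M* G)
                 (projections : Setting.ProjectionsClosed κ M≼M* G 𝒯) (m : Setting.Mean κ M≼M* G 𝒯) where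

  open Reals
  open Averages
  open Definable
  open import Data.Fin.Base using (Fin; suc)
  open import Data.List.Base using (List; []; _∷_)
  open import Data.List.Relation.Unary.All as All using (All; []; _∷_)
  open import Data.List.Relation.Unary.Any using (here; there)
  open import Data.Product.Base using (∃; _×_; _,_; proj₁; proj₂)
  open import Data.Rational.Base as ℚ using (ℚ)
  import Data.Rational.Properties as ℚ
  open import Data.Sum.Base using (_⊎_; inj₁; inj₂; [_,_]′)
  open import Data.Unit.Polymorphic using (⊤; tt)
  open import Data.Vec.Base using (Vec; []; _∷_; _++_; lookup; map; tabulate)
  open import Function.Bundles using (mk⇔; Equivalence)
  open import Function.Construct.Identity using (⇔-id)
  open import Level using (Lift; lift; lower)
  open import Relation.Binary.PropositionalEquality.Core using (_≡_; refl; sym; trans; cong)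
  open import Relation.Unary using (Pred; _∈_; _⊆_; _≐_)

  open DefinableGroup G using (dim; group)
  open TypeDefinability em κ M≼M* monster G
  open Measure em ℱ κ M≼M* monster G 𝒯 projections m
  open FourfoldProducts em ℱ κ M≼M* monster G 𝒯 projections m
  open WidePoints em ℱ κ M≼M* monster G 𝒯 projections m
  open Cuts em ℱ
  open SmallSets using (Small-tame)
  open Setting κ M≼M* G 𝒯 using (cl; Closed; M-TypeDefinable; IsG⁰⁰; IsG⁰⁰⁰; 𝒟; module 𝒟; Mean; module Mean)
  open GroupSubsets group
  open ⋁GroupTopology 𝒯 using (family)
  open ⋁Family family using (member; arity; φ; φ⇒dom)
  open IsMonster monster using (saturated; large)
  open 𝕄 using (_∙_; ε; _⁻¹; Carrier; _≈_)
  open Equivalence using (to; from)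
  open Order ℱ using (Pos; Pos-mono; pos)
  import Algebra.Properties.Group group as GP

  Quad : Pred Carrier ℓ → Pred Carrier ℓ
  Quad X = X · X · X ⁻ˢ · X ⁻ˢ

  Quad-resp : ∀ X {x y} → x ≈ y → x ∈ Quad X → y ∈ Quad X
  Quad-resp X e (a , b , a∈ , b∈ , x≈) = a , b , a∈ , b∈ , trans (sym e) x≈

  Quad-intro : ∀ {X} a b c d → a ∈ X → b ∈ X → c ∈ X → d ∈ X → ((a ∙ b) ∙ c ⁻¹) ∙ d ⁻¹ ∈ Quad X
  Quad-intro a b c d a∈ b∈ c∈ d∈ = (a ∙ b) ∙ c ⁻¹ , d ⁻¹ , (a ∙ b , c ⁻¹ , (a , b , a∈ , b∈ , refl) , (c , c∈ , refl) , refl) , (d , d∈ , refl) , refl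

  Quad-elim : ∀ {X g} → g ∈ Quad X → ∃ λ a → ∃ λ b → ∃ λ c → ∃ λ d → a ∈ X × b ∈ X × c ∈ X × d ∈ X × g ≈ ((a ∙ b) ∙ c ⁻¹) ∙ d ⁻¹
  Quad-elim {X} {g} (u , v , (w , z , (a , b , a∈ , b∈ , w≈) , (c , c∈ , z≈) , u≈) , (d , d∈ , v≈) , g≈) = a , b , c , d , a∈ , b∈ , c∈ , d∈ ,
    trans g≈ (𝕄.∙-cong {u} {(a ∙ b) ∙ c ⁻¹} {v} {d ⁻¹} (trans u≈ (𝕄.∙-cong {w} {a ∙ b} {z} {c ⁻¹} w≈ z≈)) v≈)

  Quad-td : ∀ {X} → TD ι X → TD ι (Quad X)
  Quad-td t = TD-· tame-ι (TD-· tame-ι (TD-· tame-ι t t) (TD-⁻ˢ t)) (TD-⁻ˢ t)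

  Quad-closed : ∀ {X} → TD ι X → Closed X → Closed (Quad X)
  Quad-closed {X} t cX = Closed-product tame-ι (TD-· tame-ι (TD-· tame-ι t t) (TD-⁻ˢ t)) (TD-⁻ˢ t)
      (Closed-product tame-ι (TD-· tame-ι t t) (TD-⁻ˢ t) (Closed-product tame-ι t t cX cX) c⁻) c⁻
    where
      c⁻ : Closed (X ⁻ˢ)
      c⁻ = Closed-⁻ˢ (λ {x} {y} → TD-resp t {x} {y}) cX

  Quad-closure : ∀ {X} → Quad (closure X) ⊆ closure (Quad X)
  Quad-closure {X} {g} g∈ = build (Quad-elim {closure X} {g} g∈)
    where
      build : _ → g ∈ closure (Quad X)
      build (a , b , c , d , a∈ , b∈ , c∈ , d∈ , g≈) = cl⇒closure {Quad X} (λ {x} {y} → Quad-resp X {x} {y}) {g}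
        (cl-resp {Quad X} {((a ∙ b) ∙ c ⁻¹) ∙ d ⁻¹} {g} (sym g≈)
          (cl-∙ {X · X · X ⁻ˢ} {X ⁻ˢ} {(a ∙ b) ∙ c ⁻¹} {d ⁻¹} (cl-∙ {X · X} {X ⁻ˢ} {a ∙ b} {c ⁻¹} (cl-∙ {X} {X} {a} {b} (⇒ a a∈) (⇒ b b∈)) (cl-⁻¹ {X} {c} (⇒ c c∈))) (cl-⁻¹ {X} {d} (⇒ d d∈))))
        where
          ⇒ : ∀ x → x ∈ closure X → x ∈ cl X
          ⇒ x = closure⇒cl {X} {x}

  Quad-subgroup : ∀ {X H} → IsSubgroup H → X ⊆ H → Quad X ⊆ H
  Quad-subgroup {X} {H} sub X⊆H {g} g∈ = build (Quad-elim {X} {g} g∈)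
    where
      open IsSubgroup sub renaming (resp to H-resp)
      build : _ → g ∈ H
      build (a , b , c , d , a∈ , b∈ , c∈ , d∈ , g≈) = H-resp {((a ∙ b) ∙ c ⁻¹) ∙ d ⁻¹} {g} (sym g≈)
        (∙-closed (∙-closed (∙-closed (X⊆H {a} a∈) (X⊆H {b} b∈)) (⁻¹-closed (X⊆H {c} c∈))) (⁻¹-closed (X⊆H {d} d∈)))

  -- The realisations of tp(h / M).
  Realisations : Carrier → Pred Carrier ℓ
  Realisations h t = ∀ θ → Sat M* ι (coord h) θ → Sat M* ι (coord t) θ

  Realisations-td : ∀ h → TD ι (Realisations h)
  Realisations-td h = (λ (x , _) → ∀ θ → Sat M* ι (coord h) θ → Sat M* ι x θ) ,
    tdr {J = ∃ λ θ → Sat M* ι (coord h) θ} (λ (θ , _) (x , _) → Sat M* ι x θ) (λ (θ , _) → fromFormOver M* ι θ)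
      (λ _ → mk⇔ (λ r (θ , s) → r θ s) (λ r θ s → r (θ , s))) , λ _ → ⇔-id _

  definable : FormOver ∣ M ∣ dim → Pred Carrier ℓ
  definable θ g = Sat M* ι (coord g) θ

  -- Compactness, applied to factorisations g u = t₁ t₂ t₃⁻¹ t₄⁻¹ with u in a
  -- basic neighbourhood of the identity.
  closure-realisations : ∀ h g → (∀ θ → Sat M* ι (coord h) θ → g ∈ closure (Quad (definable θ))) → g ∈ closure (Quad (Realisations h))
  closure-realisations h g near (i , y) = finish (saturation M* q saturated (Small-tame em κ {M = M} large param-tame) S S-Def found)
    where
      Param : Set ℓ
      Param = ∣ M ∣ ⊎ (Lift ℓ (Fin dim) ⊎ Lift ℓ (Fin (arity i)))
      param-tame : TameA Param
      param-tame = tame-⊎ tame-ι (tame-⊎ (tame-Fin dim) (tame-Fin (arity i)))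
      q : Param → C
      q = [ ι , [ (λ (lift l) → lookup (coord g) l) , (λ (lift l) → lookup y l) ]′ ]′
      gs = tabulate {n = dim} (λ l → inj₂ {A = ∣ M ∣} (inj₁ {B = Lift ℓ (Fin (arity i))} (lift {ℓ = ℓ} l)))
      ys = tabulate {n = arity i} (λ l → inj₂ {A = ∣ M ∣} (inj₂ {A = Lift ℓ (Fin dim)} (lift {ℓ = ℓ} l)))
      gs≡ : map q gs ≡ coord g
      gs≡ = fixed q (coord g) _ λ _ → refl
      ys≡ : map q ys ≡ y
      ys≡ = fixed q y _ λ _ → refl

      ctx : List _
      ctx = dim ∷ dim ∷ dim ∷ dim ∷ dim ∷ []

      -- The factorisation cleared of inverses, g u t₄ t₃ = t₁ t₂, so that the graph of
      -- multiplication suffices; z₀, z₁ and z₂ are the partial products from the left.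
      Base : Env M* ctx → Set ℓ
      Base (u , t₁ , t₂ , t₃ , t₄ , _) = M* ⊨ φ i [ u ++ y ] × (Dom t₁ × Dom t₂ × Dom t₃ × Dom t₄) ×
        ∃ λ z₀ → (Dom z₀ × Gr (coord g) u z₀) × ∃ λ z₁ → (Dom z₁ × Gr z₀ t₄ z₁) × ∃ λ z₂ → (Dom z₂ × Gr z₁ t₃ z₂) × Gr t₁ t₂ z₂

      v : ∀ {ms n} → _ → Arg M* q ms n
      v k = variable′ M* q k

      Base-Def : Def M* q ctx Base
      Base-Def = Def-× M* q em inU (Def-× M* q em inG (Def-∃ M* q em dim (Def-× M* q em eq₀ (Def-∃ M* q em dim (Def-× M* q em eq₁ (Def-∃ M* q em dim (Def-× M* q em eq₂ eq₃)))))))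
        where
          inU = Def-⇔ M* q (λ (u , _) → ≡⇒⇔ (cong (λ w → M* ⊨ φ i [ u ++ w ]) ys≡)) (Def-form M* q (φ i) (_⊞_ M* q (v₀ q) (parameter M* q ys)))
          inG = Def-× M* q em (Def-dom q (v₁ q)) (Def-× M* q em (Def-dom q (v₂ q)) (Def-× M* q em
            (Def-dom q (v (there (there (there (here refl)))))) (Def-dom q (v (there (there (there (there (here refl)))))))))
          eq₀ = Def-× M* q em (Def-dom q (v₀ q))
            (Def-⇔ M* q (λ (z₀ , u , _) → ≡⇒⇔ (cong (λ w → Gr w u z₀) gs≡)) (Def-graph q (parameter M* q gs) (v₁ q) (v₀ q)))
          eq₁ = Def-× M* q em (Def-dom q (v₀ q)) (Def-graph q (v₁ q) (v (there (there (there (there (there (there (here refl)))))))) (v₀ q))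
          eq₂ = Def-× M* q em (Def-dom q (v₀ q)) (Def-graph q (v₁ q) (v (there (there (there (there (there (there (here refl)))))))) (v₀ q))
          eq₃ = Def-graph q (v (there (there (there (there (here refl)))))) (v (there (there (there (there (there (here refl))))))) (v₀ q)

      Types : Set ℓ
      Types = ∃ λ θ → Sat M* ι (coord h) θ

      S : ⊤ {ℓ} ⊎ Types → Env M* ctx → Set ℓ
      S (inj₁ _)       e                              = Base e
      S (inj₂ (θ , _)) (u , t₁ , t₂ , t₃ , t₄ , _) = Sat M* ι t₁ θ × Sat M* ι t₂ θ × Sat M* ι t₃ θ × Sat M* ι t₄ θ

      S-Def : ∀ j → Def M* q ctx (S j)
      S-Def (inj₁ _)       = Base-Def
      S-Def (inj₂ (θ , _)) = Def-× M* q em (at (v₁ q)) (Def-× M* q em (at (v₂ q)) (Def-× M* q em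
          (at (v (there (there (there (here refl)))))) (at (v (there (there (there (there (here refl)))))))))
        where
          at : (a : Arg M* q ctx dim) → Def M* q ctx (λ e → Sat M* ι (Arg.val a e) θ)
          at a = Def-subst M* q (Def-params M* ι q inj₁ (λ _ → refl) (fromFormOver M* ι θ)) (a ∷ [])

      types : List (⊤ {ℓ} ⊎ Types) → List Types
      types []            = []
      types (inj₁ _ ∷ js) = types js
      types (inj₂ t ∷ js) = t ∷ types js

      found : ∀ js → ∃ λ e → All (λ j → S j e) js
      found js = use (near (proj₁ conj) (to (proj₂ conj (coord h)) (All.universal (λ (_ , s) → s) (types js))) (i , y))
        where
          conj = toFormOver M* ι (Def-All M* ι em (λ (θ , _) → fromFormOver M* ι θ) (types js))
          use : (∃ λ u → u ∈ member M* (i , y) × g ∙ u ∈ Quad (definable (proj₁ conj))) → ∃ λ e → All (λ j → S j e) js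
          use (u , u∈ , gu∈) = split (Quad-elim {definable (proj₁ conj)} {g ∙ u} gu∈)
            where
              split : _ → ∃ λ e → All (λ j → S j e) js
              split (a , b , c , d , a∈ , b∈ , c∈ , d∈ , eq) = (coord u , coord a , coord b , coord c , coord d , tt) ,
                  go js (from (proj₂ conj (coord a)) a∈) (from (proj₂ conj (coord b)) b∈) (from (proj₂ conj (coord c)) c∈) (from (proj₂ conj (coord d)) d∈)
                where
                  gud = (g ∙ u) ∙ d
                  gudc = ((g ∙ u) ∙ d) ∙ c
                  gud≈ : gud ≈ (a ∙ b) ∙ c ⁻¹
                  gud≈ = trans (𝕄.∙-congʳ {d} {g ∙ u} {((a ∙ b) ∙ c ⁻¹) ∙ d ⁻¹} eq) (GP.//-rightDividesˡ d ((a ∙ b) ∙ c ⁻¹))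
                  gudc≈ : gudc ≈ a ∙ b
                  gudc≈ = trans (𝕄.∙-congʳ {c} {gud} {(a ∙ b) ∙ c ⁻¹} gud≈) (GP.//-rightDividesˡ c (a ∙ b))
                  base : Base (coord u , coord a , coord b , coord c , coord d , tt)
                  base = u∈ , (proj₂ a , proj₂ b , proj₂ c , proj₂ d) , coord (g ∙ u) , (proj₂ (g ∙ u) , ≈⇒Gr {g} {u} {g ∙ u} refl) ,
                    coord gud , (proj₂ gud , ≈⇒Gr {g ∙ u} {d} {gud} refl) , coord gudc , (proj₂ gudc , ≈⇒Gr {gud} {c} {gudc} refl) , ≈⇒Gr {a} {b} {gudc} (sym gudc≈)
                  Holds : Carrier → List (⊤ {ℓ} ⊎ Types) → Set ℓ
                  Holds x js = All (λ (θ , _) → Sat M* ι (coord x) θ) (types js)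
                  go : ∀ js → Holds a js → Holds b js → Holds c js → Holds d js → All (λ j → S j (coord u , coord a , coord b , coord c , coord d , tt)) js
                  go []            _        _        _        _        = []
                  go (inj₁ _ ∷ js) p        r        s        t        = base ∷ go js p r s t
                  go (inj₂ _ ∷ js) (p ∷ ps) (r ∷ rs) (s ∷ ss) (t ∷ ts) = (p , r , s , t) ∷ go js ps rs ss ts

      finish : (∃ λ e → ∀ j → S j e) → ∃ λ u → u ∈ member M* (i , y) × g ∙ u ∈ Quad (Realisations h)
      finish ((u , t₁ , t₂ , t₃ , t₄ , _) , all) = close (all (inj₁ tt))
        where
          close : Base (u , t₁ , t₂ , t₃ , t₄ , tt) → ∃ λ u → u ∈ member M* (i , y) × g ∙ u ∈ Quad (Realisations h)
          close (u∈ , (d₁ , d₂ , d₃ , d₄) , z₀ , (e₀ , g₀) , z₁ , (e₁ , g₁) , z₂ , (e₂ , g₂) , g₃) =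
            U , u∈ , Quad-resp (Realisations h) {((a ∙ b) ∙ c ⁻¹) ∙ d ⁻¹} {g ∙ U} (sym gu≈)
              (Quad-intro {Realisations h} a b c d (λ θ s → proj₁ (all (inj₂ (θ , s)))) (λ θ s → proj₁ (proj₂ (all (inj₂ (θ , s)))))
                (λ θ s → proj₁ (proj₂ (proj₂ (all (inj₂ (θ , s)))))) (λ θ s → proj₂ (proj₂ (proj₂ (all (inj₂ (θ , s)))))))
            where
              U = u , φ⇒dom M* (λ _ → ⇔-id _) i u y u∈
              a = t₁ , d₁
              b = t₂ , d₂
              c = t₃ , d₃
              d = t₄ , d₄
              Z₀ = z₀ , e₀
              Z₁ = z₁ , e₁
              Z₂ = z₂ , e₂
              z₁≈ : Z₁ ≈ (a ∙ b) ∙ c ⁻¹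
              z₁≈ = trans (sym (GP.//-rightDividesʳ c Z₁)) (𝕄.∙-congʳ {c ⁻¹} {Z₁ ∙ c} {a ∙ b} (trans (Gr⇒≈ {Z₁} {c} {Z₂} g₂) (sym (Gr⇒≈ {a} {b} {Z₂} g₃))))
              gu≈ : g ∙ U ≈ ((a ∙ b) ∙ c ⁻¹) ∙ d ⁻¹
              gu≈ = trans (Gr⇒≈ {g} {U} {Z₀} g₀) (trans (sym (GP.//-rightDividesʳ d Z₀)) (𝕄.∙-congʳ {d ⁻¹} {Z₀ ∙ d} {(a ∙ b) ∙ c ⁻¹} (trans (Gr⇒≈ {Z₀} {d} {Z₁} g₁) z₁≈)))

  block : ∀ {X} → TD ι X → Closed X → Block
  block {X} t cX = record { set = X ; closed = cX ; A = ∣ M ∣ ; tame = tame-ι ; p = ι ; td = t }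

  module Conclusion {G⁰⁰ G⁰⁰⁰ : Pred Carrier ℓ} (is⁰⁰ : IsG⁰⁰ G⁰⁰) (is⁰⁰⁰ : IsG⁰⁰⁰ G⁰⁰⁰) where
    private
      H = G⁰⁰⁰
      subgroup = proj₁ (proj₁ is⁰⁰⁰)
      H-invariant = lower (proj₁ (proj₂ (proj₁ is⁰⁰⁰)))
      bounded = proj₂ (proj₂ (proj₁ is⁰⁰⁰))
      open IsSubgroup subgroup renaming (resp to H-resp)

      member-h = wide-member subgroup H-invariant bounded
      h = proj₁ member-h

      D = Realisations h
      D̂ = Quad D

      D⊆H : D ⊆ H
      D⊆H {t} t∈ = let σ , fix , e = conjugate tame-ι ι h t t∈ in H-invariant σ fix h t e (proj₁ (proj₂ member-h))

      D̂⊆H : D̂ ⊆ H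
      D̂⊆H {x} = Quad-subgroup {D} {H} subgroup (λ {t} → D⊆H {t}) {x}

      D̂-td : TD ι D̂
      D̂-td = Quad-td (Realisations-td h)

      H⊆closure-D̂ : H ⊆ closure D̂
      H⊆closure-D̂ {g} g∈ = closure-realisations h g λ θ s → Quad-closure {definable θ} {g} (part θ s)
        where
          part : ∀ θ → Sat M* ι (coord h) θ → g ∈ Quad (closure (definable θ))
          part θ s = G⁰⁰⁰⊆P⁴ B B-td 0<B is⁰⁰⁰ {g} g∈
            where
              d = fromFormOver M* ι θ
              B-td : TD ι (closure (definable θ))
              B-td = closure-td {X = definable θ} tame-ι (_ , Def⇒TDR ι d , λ _ → ⇔-id _)
              B : Block
              B = block B-td (Closed-closure (λ {x} {y} → points-resp (λ (x , _) → Sat M* ι x θ) {x} {y}))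
              0<B : Pos (measure B)
              0<B = Pos-mono (measure-mono (hull d) B λ {x} → proj₁ (hull-set d) {x}) (lower (proj₂ (proj₂ member-h) θ s))

      H⊆G⁰⁰ : H ⊆ G⁰⁰
      H⊆G⁰⁰ {x} = proj₂ is⁰⁰⁰ G⁰⁰ (proj₁ (proj₁ is⁰⁰) , lift (λ σ fix x y e → to (invariant (TypeDefinable⇒TD (proj₁ (proj₂ (proj₁ is⁰⁰)))) σ fix x y e)) , proj₂ (proj₂ (proj₁ is⁰⁰))) {x}

      D̂-resp : ∀ {x y} → x ≈ y → x ∈ D̂ → y ∈ D̂
      D̂-resp {x} {y} = Quad-resp D {x} {y}

      -- The source of type-definability: H is merely invariant over M, but its closure inherits a
      -- type over M from `D̂`.
      closure-D̂≐ : closure D̂ ≐ closure H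
      closure-D̂≐ =
        (λ {x} k j → let u , u∈ , xu∈ = k j in u , u∈ , D̂⊆H {x ∙ u} xu∈) ,
        (λ {x} k → closure-least {H} (block (closure-td tame-ι D̂-td) (Closed-closure (λ {a} {b} → D̂-resp {a} {b}))) (λ {z} → H⊆closure-D̂ {z}) {x} k)

      closure-subgroup : IsSubgroup (closure H)
      closure-subgroup = record
        { resp = λ {x} {y} → closure-resp {H} H-resp {x} {y}
        ; ε-closed = ⊆closure {H} H-resp {ε} ε-closed
        ; ∙-closed = λ {x} {y} p q → cl⇒closure H-resp {x ∙ y} (cl-mono {H · H} {H} (λ {z} (a , b , a∈ , b∈ , e) → H-resp {a ∙ b} {z} (sym e) (∙-closed a∈ b∈)) {x ∙ y}
            (cl-∙ {H} {H} {x} {y} (closure⇒cl {H} {x} p) (closure⇒cl {H} {y} q)))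
        ; ⁻¹-closed = λ {x} p → cl⇒closure H-resp {x ⁻¹} (cl-mono {H ⁻ˢ} {H} (λ {z} (a , a∈ , e) → H-resp {a ⁻¹} {z} (sym e) (⁻¹-closed a∈)) {x ⁻¹} (cl-⁻¹ {H} {x} (closure⇒cl {H} {x} p))) }

      closure-bounded : BoundedIndex κ (closure H)
      closure-bounded = let A , small , r , cover = bounded in A , small , r , λ g →
        let a , k , k∈ , e = cover g in a , k , ⊆closure {H} H-resp {k} k∈ , e

      G⁰⁰⊆closure-H : G⁰⁰ ⊆ closure H
      G⁰⁰⊆closure-H {x} = proj₂ is⁰⁰ (closure H) (closure-subgroup , TD⇒TypeDefinable (TD-ext closure-D̂≐ (closure-td tame-ι D̂-td)) , closure-bounded) {x}

    closures-agree : cl G⁰⁰ ≐ cl G⁰⁰⁰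
    closures-agree = (λ {x} → cl-idem {H} {G⁰⁰} H-resp (λ {z} k → closure⇒cl {H} {z} (G⁰⁰⊆closure-H {z} k)) {x}) ,
                     (λ {x} → cl-mono {H} {G⁰⁰} (λ {z} → H⊆G⁰⁰ {z}) {x})

    dense-part : ∃ λ D̂ → M-TypeDefinable D̂ × D̂ ⊆ G⁰⁰⁰ × cl D̂ ≐ cl G⁰⁰
    dense-part = D̂ , TD⇒TypeDefinable D̂-td , (λ {x} → D̂⊆H {x}) ,
      (λ {x} → cl-mono {D̂} {G⁰⁰} (λ {z} k → H⊆G⁰⁰ {z} (D̂⊆H {z} k)) {x}) ,
      (λ {x} → cl-idem {D̂} {G⁰⁰} (λ {a} {b} → D̂-resp {a} {b}) (λ {z} k → closure⇒cl {D̂} {z} (proj₂ closure-D̂≐ {z} (G⁰⁰⊆closure-H {z} k))) {x})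

    wide-products : ∀ (P : 𝒟) → M-TypeDefinable (𝒟.set P) → Mean.Wide m P → G⁰⁰ ⊆ Quad (𝒟.set P)
    wide-products P mtd wide {x} x∈ = closure-least {H} (block (Quad-td t) (Quad-closed t (𝒟.closed P)))
        (λ {g} → G⁰⁰⁰⊆P⁴ B t 0<B is⁰⁰⁰ {g}) {x} (G⁰⁰⊆closure-H {x} x∈)
      where
        t : TD ι (𝒟.set P)
        t = TypeDefinable⇒TD mtd
        B : Block
        B = block t (𝒟.closed P)
        0<B : Pos (measure B)
        0<B = build wide
          where
            build : 0ᴿ <ᴿ Mean.mean m P → Pos (measure B)
            -- `q` is only known to be at least 0; openness of the cut provides a strictly positive
            -- `q′`.
            build (q , q∈ , q∉) = let q′ , q<q′ , q′∈ = ℝ.open′ (Mean.mean m P) q∈ in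
              pos q′ (ℚ.≤-<-trans (ℚ.≮⇒≥ q∉) q<q′) (ℛ.≤-trans (value-≥ (Mean.mean m P) q′∈)
                (value-mono _ _ (Mean.monotone m P (toD B) λ {z} → proj₂ (toD-set B) {z})))

proposition3p52 :
  (∀ {a} → ExcludedMiddle a) →
  ∀ {ℓ : Level} {L : Language ℓ} (κ : Set ℓ) {M M* : Structure L}
    (M≼M* : M ≼ M*) → IsMonster κ M M* →
    (G : DefinableGroup M*) (𝒯 : ⋁GroupTopology M* G) →
    let open Setting κ M≼M* G 𝒯 in
    ProjectionsClosed →
    (m : Mean) →
    (G⁰⁰ G⁰⁰⁰ : Pred Carrier ℓ) → IsG⁰⁰ G⁰⁰ → IsG⁰⁰⁰ G⁰⁰⁰ →
    (cl G⁰⁰ ≐ cl G⁰⁰⁰)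
    × (∃ λ D̂ → M-TypeDefinable D̂ × D̂ ⊆ G⁰⁰⁰ × cl D̂ ≐ cl G⁰⁰)
    × (∀ (P : 𝒟) → M-TypeDefinable (set P) → Mean.Wide m P →
         G⁰⁰ ⊆ set P · set P · (set P) ⁻ˢ · (set P) ⁻ˢ)
proposition3p52 em κ M≼M* monster G 𝒯 projections m G⁰⁰ G⁰⁰⁰ is⁰⁰ is⁰⁰⁰ =
  closures-agree , dense-part , wide-products
  where open Closures.Conclusion em (Cauchy.realField em) κ M≼M* monster G 𝒯 projections m is⁰⁰ is⁰⁰⁰
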